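{- Suppose $\mathbb K$ is a computable age with the hereditary property (HP), the joint embedding property (JEP), and the cofinal amalgamation property (CAP). Then $\mathbb K$ has an $\mathscr{EI}(\mathbb K)''$-computable cofinal Fraïssé limit, where $\mathscr{EI}(\mathbb K)''$ is the double Turing jump of the embedding information $\mathscr{EI}(\mathbb K)$.
   Context: Languages and structures. $\mathcal{L}$ is a countable language (relation symbols of positive arity; function symbols of any arity, 0-ary ones being constants) with a computable representation: relation symbols $R_n$ and function symbols $F_m$ are indexed bijectively by disjoint computable subsets of $\omega$, with arity computable from the index. An $\mathcal{L}$-structure $\mathcal{M}$ is c.e. if its underlying set $M$ is a c.e. subset of $\omega$ and the sets $\{(n,\mathbf a): \mathcal M\models R_n(\mathbf a)\}$, $\{(n,\mathbf a): \mathcal M\models \neg R_n(\mathbf a)\}$, $\{(m,\mathbf a,b): \mathcal M\models F_m(\mathbf a)=b\}$ are c.e.; it is computable if moreover $M$ is computable. "$\mathfrak s$-computable" versions of notions are obtained by relativizing to the Turing degree $\mathfrak s$. Tuples are finite; $\mathrm{cl}_{\mathcal M}(\mathbf a)$ is the smallest substructure of $\mathcal M$ containing $\mathbf a$. For tuples of the same length, $\mathbf a\sim\mathbf b$ means that coordinates of $\mathbf a$ are equal exactly when the corresponding coordinates of $\mathbf b$ are; for $\mathbf a\in\mathcal A$, $\mathbf b\in\mathcal B$ of the same length, $\mathbf a\simeq\mathbf b$ means that for every atomic $\mathcal L$-formula $\varphi$, $\mathcal A\models\varphi(\mathbf a)$ iff $\mathcal B\models\varphi(\mathbf b)$; equivalently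 $\mathbf a\mapsto\mathbf b$ extends to an isomorphism $\mathrm{cl}(\mathbf a)\to\mathrm{cl}(\mathbf b)$. Ages. An age is a collection of finitely generated $\mathcal L$-structures closed under isomorphism. A computable age (computable representation of an age $\mathcal K$) is a c.e. set $\mathbb K$ of triples $(\mathbf a,\mathcal A,i)$ (computable structures being given by indices), with exactly one triple for each $i\in\omega$, written $\mathbb I(i)=(\mathbf a_i,\mathcal A_i,i)$, such that each $\mathcal A_i$ is a computable $\mathcal L$-structure in $\mathcal K$ with $\mathcal A_i=\mathrm{cl}_{\mathcal A_i}(\mathbf a_i)$, and every $\mathcal B\in\mathcal K$ is isomorphic to some $\mathcal A_i$. $\mathbb K$ is said to have a property of ages if $\mathcal K$ does. The embedding information $\mathscr{EI}(\mathbb K)$ is the set of tuples $(\mathbb I(k_0),\mathbf b_0,\mathbb I(k_1),\mathbf b_1)$ with $\mathbf b_0\in\mathcal A_{k_0}$, $\mathbf b_1\in\mathcal A_{k_1}$ and $\mathbf b_0\simeq\mathbf b_1$. (HP): for all $\mathcal B\in\mathcal K$, $\mathcal A\subseteq\mathcal B$ implies $\mathcal A\in\mathcal K$. (JEP): for all $\mathcal A,\mathcal B\in\mathcal K$ there is $\mathcal C\in\mathcal K$ into which both embed. An amalgamation base is an $\mathcal A'\in\mathcal K$ such that whenever $\mathcal B,\mathcal C\in\mathcal K$ and $f_{\mathcal B}:\mathcal A'\to\mathcal B$, $f_{\mathcal C}:\mathcal A'\to\mathcal C$ are embeddings, there are $\mathcal D\in\mathcal K$ and embeddings $\alpha_{\mathcal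 B}:\mathcal B\to\mathcal D$, $\alpha_{\mathcal C}:\mathcal C\to\mathcal D$ with $\alpha_{\mathcal B}\circ f_{\mathcal B}=\alpha_{\mathcal C}\circ f_{\mathcal C}$. (CAP): every $\mathcal A\in\mathcal K$ embeds into some amalgamation base in $\mathcal K$. Cofinal Fraïssé limits. The age of a structure $\mathcal M$ is the collection of $\mathcal L$-structures isomorphic to a finitely generated substructure of $\mathcal M$. A cofinal collection in $\mathcal M$ is a collection $E$ of finite tuples in $\mathcal M$ such that: for every finite tuple $\mathbf a$ in $\mathcal M$ there is $\mathbf b\in E$ with $\mathbf a\subseteq\mathrm{cl}_{\mathcal M}(\mathbf b)$; if $\mathbf b\in E$ and $\mathbf a\subseteq\mathrm{cl}_{\mathcal M}(\mathbf b)$ is a finite tuple then $\mathbf a\mathbf b\in E$; and if $\mathbf a\in E$ and $\mathbf a\simeq\mathbf b$ then $\mathbf b\in E$. An $\mathfrak s$-computable structure $\mathcal M$ is $\mathfrak s$-computably cofinally ultrahomogeneous if, for some $\mathfrak s$-computable cofinal collection $E$ in $\mathcal M$, there is an $\mathfrak s$-computable $g$ whose domain is the set of pairs $(\mathbf a,\mathbf b)$ of tuples in $\mathcal M$ with $\mathbf a\in E$ and $\mathbf a\sim\mathbf b$, such that $g(\mathbf a,\mathbf b)$ is the index of an $\mathfrak s$-computable bijection $g_{\mathbf a,\mathbf b}:\mathcal M\to\mathcal M$ with $g_{\mathbf a,\mathbf b}(\mathbf a)=\mathbf b$, and if $\mathbf a\simeq\mathbf b$ then $g_{\mathbf a,\mathbf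 b}$ is an automorphism of $\mathcal M$. An $\mathfrak s$-computable structure $\mathcal M$ is an $\mathfrak s$-computable cofinal Fraïssé limit of $\mathbb K$ if $\mathcal M$ is $\mathfrak s$-computably cofinally ultrahomogeneous and $\mathbb K$ is an $\mathfrak s$-computable representation of the age of $\mathcal M$. -}

module Defs where

open import Level using (0ℓ) renaming (suc to lsuc)
open import Data.Bool using (Bool; T)
open import Data.Empty using (⊥)
open import Data.Fin using (Fin)
open import Data.Nat using (ℕ; zero; suc; _+_; _<_)
open import Data.Nat.Properties using (+-suc; +-comm; +-identityʳ)
open import Data.Product using (Σ; Σ-syntax; ∃; ∃-syntax; _×_; _,_; proj₁; proj₂)
open import Data.Vec using (Vec; []; _∷_; _++_; lookup; map)
open import Data.Vec.Relation.Binary.Pointwise.Inductive as Pointwise using (Pointwise)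
open import Data.Vec.Relation.Unary.All as All using (All)
open import Data.Vec.Relation.Unary.All.Properties as All using ()
open import Function using (_∘_; _⇔_)
open import Function.Bundles using (Injection; Bijection)
open import Relation.Binary.Bundles using (Setoid)
open import Relation.Binary.Definitions using (_Respects_)
open import Relation.Binary.PropositionalEquality
  using (_≡_; refl; sym; trans; cong; setoid)
import Relation.Binary.Construct.On as On
open import Relation.Nullary using (¬_)
open import Relation.Unary using (Pred; _∈_; _∉_; ∅)

------------------------------------------------------------------------
-- Oracle computability

-- Cantor pairing; `unpair` walks along the antidiagonals.

triangle : ℕ → ℕ
triangle zero    = zero
triangle (suc n) = suc n + triangle n

⟨_,_⟩ : ℕ → ℕ → ℕ
⟨ x , y ⟩ = triangle (x + y) + x

next : ℕ × ℕ → ℕ × ℕ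
next (x , zero)  = zero , suc x
next (x , suc y) = suc x , y

unpair : ℕ → ℕ × ℕ
unpair zero    = zero , zero
unpair (suc n) = next (unpair n)

π₁ π₂ : ℕ → ℕ
π₁ = proj₁ ∘ unpair
π₂ = proj₂ ∘ unpair

private
  pair-next : ∀ p → ⟨ proj₁ (next p) , proj₂ (next p) ⟩ ≡ suc ⟨ proj₁ p , proj₂ p ⟩
  pair-next (x , zero) rewrite +-identityʳ x | +-identityʳ (x + triangle x) =
    cong suc (+-comm x (triangle x))
  pair-next (x , suc y) rewrite +-suc x y = +-suc (triangle (suc (x + y))) x

pair-unpair : ∀ n → ⟨ π₁ n , π₂ n ⟩ ≡ n
pair-unpair zero    = refl
pair-unpair (suc n) = trans (pair-next (unpair n)) (cong suc (pair-unpair n))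

private
  -- The diagonal x + y = d, traversed by increasing x.
  diagonal : ∀ d x y → x + y ≡ d → unpair (triangle d + x) ≡ (x , y)
  diagonal zero    zero    zero    _  = refl
  diagonal (suc d) zero    (suc y) eq
    rewrite +-identityʳ (d + triangle d) | +-comm d (triangle d)
          | diagonal d d zero (+-identityʳ d) = cong (zero ,_) (sym eq)
  diagonal d       (suc x) y       eq
    rewrite +-suc (triangle d) x
          | diagonal d x (suc y) (trans (+-suc x y) eq) = refl

unpair-pair : ∀ x y → unpair ⟨ x , y ⟩ ≡ (x , y)
unpair-pair x y = diagonal (x + y) x y refl

-- Codes for the partial functions ℕ ⇀ ℕ computable with an oracle, in the
-- style of Kleene's recursive functions, with multiple arguments paired up.

data Code : Set where
  zeroᶜ succᶜ leftᶜ rightᶜ oracleᶜ : Code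
  pairᶜ compᶜ precᶜ                : Code → Code → Code
  minᶜ                             : Code → Code

infix 4 _⊢_[_]⇓_

-- O ⊢ c [ x ]⇓ y : with oracle O, program c halts on input x with output y.

data _⊢_[_]⇓_ (O : Pred ℕ 0ℓ) : Code → ℕ → ℕ → Set where
  ⇓zero   : ∀ {x} → O ⊢ zeroᶜ [ x ]⇓ 0
  ⇓succ   : ∀ {x} → O ⊢ succᶜ [ x ]⇓ suc x
  ⇓left   : ∀ {x} → O ⊢ leftᶜ [ x ]⇓ π₁ x
  ⇓right  : ∀ {x} → O ⊢ rightᶜ [ x ]⇓ π₂ x
  ⇓yes    : ∀ {x} → x ∈ O → O ⊢ oracleᶜ [ x ]⇓ 1
  ⇓no     : ∀ {x} → x ∉ O → O ⊢ oracleᶜ [ x ]⇓ 0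
  ⇓pair   : ∀ {f g x y z} → O ⊢ f [ x ]⇓ y → O ⊢ g [ x ]⇓ z →
            O ⊢ pairᶜ f g [ x ]⇓ ⟨ y , z ⟩
  ⇓comp   : ∀ {f g x y z} → O ⊢ g [ x ]⇓ y → O ⊢ f [ y ]⇓ z →
            O ⊢ compᶜ f g [ x ]⇓ z
  ⇓prec-0 : ∀ {f g x a y} → unpair x ≡ (a , zero) →
            O ⊢ f [ a ]⇓ y → O ⊢ precᶜ f g [ x ]⇓ y
  ⇓prec-s : ∀ {f g x a n r y} → unpair x ≡ (a , suc n) →
            O ⊢ precᶜ f g [ ⟨ a , n ⟩ ]⇓ r → O ⊢ g [ ⟨ a , ⟨ n , r ⟩ ⟩ ]⇓ y →
            O ⊢ precᶜ f g [ x ]⇓ y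
  ⇓min    : ∀ {f x n} → O ⊢ f [ ⟨ x , n ⟩ ]⇓ 0 →
            (∀ k → k < n → ∃[ r ] O ⊢ f [ ⟨ x , k ⟩ ]⇓ suc r) →
            O ⊢ minᶜ f [ x ]⇓ n

-- Gödel numbers.

⌜_⌝ : Code → ℕ
⌜ zeroᶜ ⌝     = ⟨ 0 , 0 ⟩
⌜ succᶜ ⌝     = ⟨ 1 , 0 ⟩
⌜ leftᶜ ⌝     = ⟨ 2 , 0 ⟩
⌜ rightᶜ ⌝    = ⟨ 3 , 0 ⟩
⌜ oracleᶜ ⌝   = ⟨ 4 , 0 ⟩
⌜ pairᶜ f g ⌝ = ⟨ 5 , ⟨ ⌜ f ⌝ , ⌜ g ⌝ ⟩ ⟩
⌜ compᶜ f g ⌝ = ⟨ 6 , ⟨ ⌜ f ⌝ , ⌜ g ⌝ ⟩ ⟩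
⌜ precᶜ f g ⌝ = ⟨ 7 , ⟨ ⌜ f ⌝ , ⌜ g ⌝ ⟩ ⟩
⌜ minᶜ f ⌝    = ⟨ 8 , ⌜ f ⌝ ⟩

-- φ O e x y : the e-th partial O-computable function maps x to y. A number
-- that is not the Gödel number of a code indexes the empty function.

φ : Pred ℕ 0ℓ → ℕ → ℕ → ℕ → Set
φ O e x y = ∃[ c ] (⌜ c ⌝ ≡ e × O ⊢ c [ x ]⇓ y)

Halts : Pred ℕ 0ℓ → ℕ → Pred ℕ 0ℓ
Halts O e x = ∃[ y ] φ O e x y

infix 8 _′

_′ : Pred ℕ 0ℓ → Pred ℕ 0ℓ
(O ′) e = Halts O e e

Enumerates : Pred ℕ 0ℓ → ℕ → Pred ℕ 0ℓ → Set
Enumerates O e A = ∀ x → x ∈ A ⇔ Halts O e x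

Decides : Pred ℕ 0ℓ → ℕ → Pred ℕ 0ℓ → Set
Decides O e A = ∀ x → (x ∈ A → φ O e x 1) × (x ∉ A → φ O e x 0)

CE : Pred ℕ 0ℓ → Pred ℕ 0ℓ → Set
CE O A = ∃[ e ] Enumerates O e A

Computable : Pred ℕ 0ℓ → Pred ℕ 0ℓ → Set
Computable O A = ∃[ e ] Decides O e A

ComputableFun : Pred ℕ 0ℓ → (ℕ → ℕ) → Set
ComputableFun O f = ∃[ e ] (∀ x → φ O e x (f x))

codeᵛ : ∀ {n} → Vec ℕ n → ℕ
codeᵛ []       = 0
codeᵛ (x ∷ xs) = suc ⟨ x , codeᵛ xs ⟩

------------------------------------------------------------------------
-- Languages and structures

-- A symbol is identified with its index. Values of `arity` off the two index
-- sets carry no information.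

record Language : Set where
  field
    isRel isFun      : ℕ → Bool
    arity            : ℕ → ℕ
    disjoint         : ∀ n → T (isRel n) → T (isFun n) → ⊥
    rel-positive     : ∀ n → T (isRel n) → 0 < arity n
    isRel-computable : Computable ∅ (T ∘ isRel)
    isFun-computable : Computable ∅ (T ∘ isFun)
    arity-computable : ComputableFun ∅ arity

  RelSym FunSym : Set
  RelSym = ∃ (T ∘ isRel)
  FunSym = ∃ (T ∘ isFun)

  arityʳ : RelSym → ℕ
  arityʳ = arity ∘ proj₁

  arityᶠ : FunSym → ℕ
  arityᶠ = arity ∘ proj₁

record Interpretation (L : Language) (S : Setoid 0ℓ 0ℓ) : Set₁ where
  open Language L
  open Setoid S
  field
    rel      : (R : RelSym) → Vec Carrier (arityʳ R) → Set
    fun      : (F : FunSym) → Vec Carrier (arityᶠ F) → Carrier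
    rel-resp : ∀ R {xs ys} → Pointwise _≈_ xs ys → rel R xs → rel R ys
    fun-cong : ∀ F {xs ys} → Pointwise _≈_ xs ys → fun F xs ≈ fun F ys

-- The equality of an 𝓛-structure is that of its underlying setoid; the
-- underlying set may be empty.

record Structure (L : Language) : Set₁ where
  field
    setoid′        : Setoid 0ℓ 0ℓ
    interpretation : Interpretation L setoid′
  open Setoid setoid′ public using (Carrier; _≈_)
  open Interpretation interpretation public

open Structure using (setoid′)

-- The subset as a setoid in which membership proofs are irrelevant.

subset : Pred ℕ 0ℓ → Setoid 0ℓ 0ℓ
subset D = On.setoid {B = Σ ℕ D} (setoid ℕ) proj₁

record ωStructure (L : Language) : Set₁ where
  field
    dom            : Pred ℕ 0ℓ
    interpretation : Interpretation L (subset dom)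

⟦_⟧ : ∀ {L} → ωStructure L → Structure L
⟦ 𝓜 ⟧ = record { setoid′ = _ ; interpretation = ωStructure.interpretation 𝓜 }

∣_∣ : ∀ {L} → Structure L → Set
∣ A ∣ = Structure.Carrier A

module _ {L : Language} where
  open Language L

  private
    variable
      n : ℕ

  -- Homomorphisms

  record IsStrongHom (A B : Structure L) (f : ∣ A ∣ → ∣ B ∣) : Set where
    private
      module A = Structure A
      module B = Structure B
    field
      fun-hom : ∀ F xs → f (A.fun F xs) B.≈ B.fun F (map f xs)
      rel-hom : ∀ R xs → A.rel R xs ⇔ B.rel R (map f xs)

  record Embedding (A B : Structure L) : Set where
    field
      injection   : Injection (setoid′ A) (setoid′ B)
      isStrongHom : IsStrongHom A B (Injection.to injection)
    open Injection injection public using (to)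

  record _≅_ (A B : Structure L) : Set where
    field
      bijection   : Bijection (setoid′ A) (setoid′ B)
      isStrongHom : IsStrongHom A B (Bijection.to bijection)

  -- Substructures

  record Substructure (B : Structure L) : Set₁ where
    private
      module B = Structure B
    field
      member : Pred ∣ B ∣ 0ℓ
      resp   : member Respects B._≈_
      closed : ∀ F xs → All member xs → member (B.fun F xs)

  substructure : (B : Structure L) → Substructure B → Structure L
  substructure B S = record
    { setoid′ = On.setoid {B = Σ ∣ B ∣ member} (setoid′ B) proj₁
    ; interpretation = record
      { rel      = λ R xs → B.rel R (map proj₁ xs)
      ; fun      = λ F xs → B.fun F (map proj₁ xs)
                          , closed F _ (All.map⁺ (All.universal proj₂ xs))
      ; rel-resp = λ R xs≈ys → B.rel-resp R (Pointwise.map⁺ (λ p → p) xs≈ys)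
      ; fun-cong = λ F xs≈ys → B.fun-cong F (Pointwise.map⁺ (λ p → p) xs≈ys)
      }
    }
    where
    module B = Structure B
    open Substructure S

  -- The smallest substructure containing a tuple.

  data cl (A : Structure L) (a : Vec ∣ A ∣ n) : Pred ∣ A ∣ 0ℓ where
    cl-gen  : ∀ i → cl A a (lookup a i)
    cl-fun  : ∀ F xs → All (cl A a) xs → cl A a (Structure.fun A F xs)
    cl-resp : ∀ {x y} → Structure._≈_ A x y → cl A a x → cl A a y

  GeneratedBy : (A : Structure L) → Vec ∣ A ∣ n → Set
  GeneratedBy A a = ∀ x → x ∈ cl A a

  FinitelyGenerated : Pred (Structure L) 0ℓ
  FinitelyGenerated A = ∃[ n ] Σ[ a ∈ Vec ∣ A ∣ n ] GeneratedBy A a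

  InClosure : (A : Structure L) {m n : ℕ} → Vec ∣ A ∣ m → Vec ∣ A ∣ n → Set
  InClosure A a b = All (cl A b) a

  -- Atomic formulas in the variables indexed by Fin n

  data Term (n : ℕ) : Set where
    var : Fin n → Term n
    app : (F : FunSym) → Vec (Term n) (arityᶠ F) → Term n

  data Atomic (n : ℕ) : Set where
    _≐_  : Term n → Term n → Atomic n
    relᵃ : (R : RelSym) → Vec (Term n) (arityʳ R) → Atomic n

  module _ (A : Structure L) (a : Vec ∣ A ∣ n) where
    mutual
      value : Term n → ∣ A ∣
      value (var i)    = lookup a i
      value (app F ts) = Structure.fun A F (values ts)

      values : ∀ {k} → Vec (Term n) k → Vec ∣ A ∣ k
      values []       = []
      values (t ∷ ts) = value t ∷ values ts

    Satisfies : Atomic n → Set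
    Satisfies (t ≐ u)     = Structure._≈_ A (value t) (value u)
    Satisfies (relᵃ R ts) = Structure.rel A R (values ts)

  SameAtomicType : (A B : Structure L) → Vec ∣ A ∣ n → Vec ∣ B ∣ n → Set
  SameAtomicType A B a b = ∀ ψ → Satisfies A a ψ ⇔ Satisfies B b ψ

  SameEqualities : (A : Structure L) → Vec ∣ A ∣ n → Vec ∣ A ∣ n → Set
  SameEqualities A a b =
    ∀ i j → (lookup a i ≈ lookup a j) ⇔ (lookup b i ≈ lookup b j)
    where open Structure A using (_≈_)

  -- Computable structures. An index packages an index for the characteristic
  -- function of the domain with c.e. indices for the positive relational
  -- diagram, the negative relational diagram and the graphs of the functions.

  code : (𝓜 : ωStructure L) → Vec ∣ ⟦ 𝓜 ⟧ ∣ n → ℕ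
  code 𝓜 a = codeᵛ (map proj₁ a)

  module _ (𝓜 : ωStructure L) where
    open Structure ⟦ 𝓜 ⟧ using (rel; fun)

    RelDiagram : Pred ℕ 0ℓ
    RelDiagram x = ∃[ R ] ∃[ a ] (x ≡ ⟨ proj₁ R , code 𝓜 a ⟩ × rel R a)

    NegRelDiagram : Pred ℕ 0ℓ
    NegRelDiagram x = ∃[ R ] ∃[ a ] (x ≡ ⟨ proj₁ R , code 𝓜 a ⟩ × ¬ rel R a)

    FunDiagram : Pred ℕ 0ℓ
    FunDiagram x = ∃[ F ] ∃[ a ]
      x ≡ ⟨ proj₁ F , ⟨ code 𝓜 a , proj₁ (fun F a) ⟩ ⟩

  record IsStructureIndex (O : Pred ℕ 0ℓ) (𝓜 : ωStructure L) (e : ℕ) : Set where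
    field
      e-dom e-rel e-neg e-fun : ℕ
      packed          : e ≡ ⟨ e-dom , ⟨ e-rel , ⟨ e-neg , e-fun ⟩ ⟩ ⟩
      dom-decides     : Decides O e-dom (ωStructure.dom 𝓜)
      rel-enumerates  : Enumerates O e-rel (RelDiagram 𝓜)
      neg-enumerates  : Enumerates O e-neg (NegRelDiagram 𝓜)
      fun-enumerates  : Enumerates O e-fun (FunDiagram 𝓜)

  IsComputableStructure : Pred ℕ 0ℓ → Pred (ωStructure L) 0ℓ
  IsComputableStructure O 𝓜 = ∃[ e ] IsStructureIndex O 𝓜 e

  -- Ages

  record IsAge (K : Pred (Structure L) (lsuc 0ℓ)) : Set₁ where
    field
      finitelyGenerated : ∀ {A} → A ∈ K → FinitelyGenerated A
      iso-closed        : ∀ {A B} → A ≅ B → A ∈ K → B ∈ K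

  -- Only finitely generated substructures can belong to an age.

  HP : Pred (Structure L) (lsuc 0ℓ) → Set₁
  HP K = ∀ {B} → B ∈ K → (A : Substructure B) →
         FinitelyGenerated (substructure B A) → substructure B A ∈ K

  JEP : Pred (Structure L) (lsuc 0ℓ) → Set₁
  JEP K = ∀ {A B} → A ∈ K → B ∈ K →
          Σ[ C ∈ Structure L ] (C ∈ K × Embedding A C × Embedding B C)

  record AmalgamationBase (K : Pred (Structure L) (lsuc 0ℓ))
                          (A : Structure L) : Set₁ where
    open Embedding using (to)
    field
      inAge      : A ∈ K
      amalgamate : ∀ {B C} → B ∈ K → C ∈ K →
        (fB : Embedding A B) (fC : Embedding A C) →
        Σ[ D ∈ Structure L ] (D ∈ K ×
        Σ[ αB ∈ Embedding B D ] Σ[ αC ∈ Embedding C D ]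
          (∀ x → Structure._≈_ D (to αB (to fB x)) (to αC (to fC x))))

  CAP : Pred (Structure L) (lsuc 0ℓ) → Set₁
  CAP K = ∀ {A} → A ∈ K →
          Σ[ A′ ∈ Structure L ] (AmalgamationBase K A′ × Embedding A A′)

  Age : Structure L → Pred (Structure L) (lsuc 0ℓ)
  Age M B = Σ[ S ∈ Substructure M ]
    (FinitelyGenerated (substructure M S) × B ≅ substructure M S)

-- The generating tuples and structures of a sequence of triples (aᵢ , 𝓐ᵢ , i).
-- Indices for the 𝓐ᵢ are kept apart, since they depend on the oracle.

record Enumeration (L : Language) : Set₁ where
  field
    struct : ℕ → ωStructure L
    len    : ℕ → ℕ
    gens   : ∀ i → Vec ∣ ⟦ struct i ⟧ ∣ (len i)

module _ {L : Language} (𝕂 : Enumeration L) where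
  open Enumeration 𝕂

  -- The code of the triple 𝕀(i), where ix i is an index of 𝓐ᵢ.

  triple : (ix : ℕ → ℕ) → ℕ → ℕ
  triple ix i = ⟨ code (struct i) (gens i) , ⟨ ix i , i ⟩ ⟩

  -- The triples form an O-computable representation of K.

  record Represents (O : Pred ℕ 0ℓ) (ix : ℕ → ℕ)
                    (K : Pred (Structure L) (lsuc 0ℓ)) : Set₁ where
    field
      triples-ce : CE O (λ x → ∃[ i ] x ≡ triple ix i)
      indexed    : ∀ i → IsStructureIndex O (struct i) (ix i)
      inAge      : ∀ i → ⟦ struct i ⟧ ∈ K
      generated  : ∀ i → GeneratedBy ⟦ struct i ⟧ (gens i)
      exhaustive : ∀ {B} → B ∈ K → ∃[ i ] B ≅ ⟦ struct i ⟧

  EI : (ix : ℕ → ℕ) → Pred ℕ 0ℓ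
  EI ix x = ∃[ k₀ ] ∃[ k₁ ] ∃[ n ]
    Σ[ b₀ ∈ Vec ∣ ⟦ struct k₀ ⟧ ∣ n ] Σ[ b₁ ∈ Vec ∣ ⟦ struct k₁ ⟧ ∣ n ]
      ( x ≡ ⟨ triple ix k₀ , ⟨ code (struct k₀) b₀
            , ⟨ triple ix k₁ , code (struct k₁) b₁ ⟩ ⟩ ⟩
      × SameAtomicType ⟦ struct k₀ ⟧ ⟦ struct k₁ ⟧ b₀ b₁ )

------------------------------------------------------------------------
-- Cofinal Fraïssé limits

module _ {L : Language} where

  record IsCofinal (M : Structure L) (E : ∀ {n} → Pred (Vec ∣ M ∣ n) 0ℓ) : Set where
    field
      cofinal   : ∀ {n} (a : Vec ∣ M ∣ n) →
                 ∃[ m ] Σ[ b ∈ Vec ∣ M ∣ m ] (b ∈ E × InClosure M a b)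
      extend    : ∀ {m n} (b : Vec ∣ M ∣ n) (a : Vec ∣ M ∣ m) →
                 b ∈ E → InClosure M a b → (a ++ b) ∈ E
      invariant : ∀ {n} (a b : Vec ∣ M ∣ n) →
                 a ∈ E → SameAtomicType M M a b → b ∈ E

  module _ (O : Pred ℕ 0ℓ) (𝓜 : ωStructure L) where
    open ωStructure 𝓜 using (dom)
    open Structure ⟦ 𝓜 ⟧ using (_≈_)

    -- e is an index of the O-computable partial function with domain 𝓜 and
    -- graph that of f.

    IsFunctionIndex : (∣ ⟦ 𝓜 ⟧ ∣ → ∣ ⟦ 𝓜 ⟧ ∣) → ℕ → Set
    IsFunctionIndex f e =
      ∀ x y → φ O e x y ⇔ (Σ[ x∈M ∈ dom x ] proj₁ (f (x , x∈M)) ≡ y)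

    -- e is an index of a suitable bijection moving a to b.

    record Moves {n} (a b : Vec ∣ ⟦ 𝓜 ⟧ ∣ n) (e : ℕ) : Set where
      field
        bijection    : Bijection (subset dom) (subset dom)
      open Bijection bijection using (to)
      field
        index        : IsFunctionIndex to e
        moves        : Pointwise _≈_ (map to a) b
        automorphism : SameAtomicType ⟦ 𝓜 ⟧ ⟦ 𝓜 ⟧ a b → IsStrongHom ⟦ 𝓜 ⟧ ⟦ 𝓜 ⟧ to

    -- The field `g` is an index of the function (a , b) ↦ g(a , b).

    record CofinallyUltrahomogeneous : Set₁ where
      field
        E            : ∀ {n} → Pred (Vec ∣ ⟦ 𝓜 ⟧ ∣ n) 0ℓ
        E-cofinal    : IsCofinal ⟦ 𝓜 ⟧ E
        E-computable : Computable O
          (λ x → ∃[ n ] Σ[ a ∈ Vec ∣ ⟦ 𝓜 ⟧ ∣ n ] (x ≡ code 𝓜 a × a ∈ E))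
        g            : ℕ
        g-domain     : Enumerates O g
          (λ x → ∃[ n ] Σ[ a ∈ Vec ∣ ⟦ 𝓜 ⟧ ∣ n ] Σ[ b ∈ Vec ∣ ⟦ 𝓜 ⟧ ∣ n ]
                   ( x ≡ ⟨ code 𝓜 a , code 𝓜 b ⟩
                   × a ∈ E × SameEqualities ⟦ 𝓜 ⟧ a b ))
        g-value      : ∀ {n} (a b : Vec ∣ ⟦ 𝓜 ⟧ ∣ n) →
          a ∈ E → SameEqualities ⟦ 𝓜 ⟧ a b →
          ∀ y → φ O g ⟨ code 𝓜 a , code 𝓜 b ⟩ y → Moves a b y

    -- An oracle-free index of a structure need not be an index of it relative
    -- to O, so the same sequence of structures is given its own O-indices ix.

    record IsCofinalFraïsséLimit (𝕂 : Enumeration L) : Set₁ where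
      field
        computable       : IsComputableStructure O 𝓜
        ultrahomogeneous : CofinallyUltrahomogeneous
        ix               : ℕ → ℕ
        represents       : Represents 𝕂 O ix (Age ⟦ 𝓜 ⟧)

{-# OPTIONS --safe #-}
module Submission where

-- A Fraïssé construction with atomic types of tuples in place of structures. Let
-- 𝔼 = EI(𝕂). Having the same atomic type is 𝔼-decidable for tuples of the 𝓐ₖ, so
-- generating an amalgamation base is a Π₂(𝔼) property of tuples, hence decidable
-- in 𝔼″. With this oracle one builds tuples b₀, b₁, … of structures 𝓐ₖ, without
-- repetitions and generating amalgamation bases, such that b₍ₛ₊₁₎ begins with a
-- tuple of the type of bₛ, and such that whenever a subtuple p of some bₛ generates
-- a base, every extension of the type of p in the age is realized over p later on.
-- Amalgamating and then applying CAP provides the next tuple.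
--
-- The elements of the limit are the positions in the bₛ, and relations and values
-- of functions are read off at any late enough stage; 𝔼′ decides them in the 𝓐ₖ, once
-- oracle-free indices are translated to indices relative to 𝔼. Since JEP makes the
-- empty tuple generate a base, all of the age is realized. The tuples generating
-- bases form the cofinal collection: a back-and-forth along the realized extensions
-- computes an automorphism from a to b if they have the same type, and otherwise a
-- finite product of transpositions moves a to b.

open import Level using (0ℓ; Lift; lift; lower) renaming (suc to lsuc)
open import Axiom.ExcludedMiddle using (ExcludedMiddle)
open import Data.Bool using (if_then_else_)
open import Data.Bool.Properties using (T-irrelevant)
open import Data.Fin using (Fin; toℕ; fromℕ<; _↑ʳ_)
open import Data.Fin.Properties using (toℕ<n; toℕ-fromℕ<)
open import Data.List as List using (List; []; _∷_; length; upTo; applyUpTo; _++_)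
open import Data.List.Properties using (length-map; ∷-injective; length-++; ++-assoc; ++-identityʳ; length-upTo; map-cong)
open import Data.List.Relation.Unary.All as All using (All; []; _∷_)
open import Data.List.Relation.Unary.All.Properties using (++⁺; applyUpTo⁺₁; all-upTo)
open import Data.Nat
open import Data.Nat.Properties
open import Data.Nat.Induction using (<-rec)
open import Data.Product using (Σ; Σ-syntax; ∃; ∃-syntax; _×_; _,_; proj₁; proj₂)
open import Data.Sum using (_⊎_; inj₁; inj₂; [_,_]′)
open import Data.Vec as Vec using (Vec; []; _∷_; lookup; map; tabulate; toList)
open import Data.Vec.Membership.Propositional.Properties using (∈-lookup)
open import Data.Vec.Properties
  using (length-toList; toList-++; lookup-map; lookup∘tabulate; tabulate-∘; tabulate∘lookup; map-lookup-allFin;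
         lookup-++ʳ; map-∘; map-++)
  renaming (map-cong to mapᵛ-cong)
open import Data.Vec.Relation.Binary.Pointwise.Inductive as Pointwise using (Pointwise; []; _∷_)
open import Data.Vec.Relation.Unary.All as Allᵛ using ([]; _∷_)
open import Data.Vec.Relation.Unary.All.Properties using (lookup⁻)
open import Function using (_∘_; id; _⇔_; mk⇔; Equivalence)
open import Function.Bundles using (Injection; Bijection)
import Function.Construct.Composition as Comp
open import Relation.Binary.Bundles using (Setoid)
open import Relation.Binary.Definitions using (tri<; tri≈; tri>)
open import Relation.Binary.PropositionalEquality hiding (setoid)
open import Relation.Nullary using (¬_; Dec; yes; no; does; contradiction)
open import Relation.Nullary.Decidable as Dec using (toSum; ¬?; _×-dec_; _→-dec_; decidable-stable)
open import Relation.Unary using (Pred; ∅; _∈_; _∉_)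
open import Defs

open Equivalence using (to; from)
open Structure using (setoid′)

-- The budget of two jumps shapes the proof. An embedding of a finitely generated substructure into
-- some 𝓐ₗ is an equality of types of tuples, so every quantifier over embeddings becomes one over
-- numbers with an 𝔼-decidable matrix, and recognizing bases already uses both jumps. A quantifier
-- over a relation merely decidable in 𝔼″ can no longer be decided. Hence every choice is a search
-- for a witness of a relation decidable in 𝔼″, whose existence is proved classically (`choose`);
-- relations are made total by hypotheses inside them, so that any number may occur as a state or a
-- request.
--
-- A request is honoured only over a subtuple generating a base, since otherwise its extension need
-- not amalgamate with the tuple built so far. The whole tuple always generates a base, which lets
-- values of functions be added and the back-and-forth continue. As positions serve as elements, the
-- domain is an initial segment of ℕ, hence decidable although it is presented only by an
-- enumeration. HP is what places the finitely generated substructures of the limit in the age.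

private
  variable
    O Y : Pred ℕ 0ℓ
    P Q : ℕ → Set
    Φ Ψ : Set
    f g h : ℕ → ℕ
    F G F′ G′ G″ : ℕ → List ℕ
    c d : Code
    x y z : ℕ

-- Pairing

π₁-pair : ∀ x y → π₁ ⟨ x , y ⟩ ≡ x
π₁-pair x y = cong proj₁ (unpair-pair x y)

π₂-pair : ∀ x y → π₂ ⟨ x , y ⟩ ≡ y
π₂-pair x y = cong proj₂ (unpair-pair x y)

pair-injective : ∀ {a b c d} → ⟨ a , b ⟩ ≡ ⟨ c , d ⟩ → a ≡ c × b ≡ d
pair-injective {a} {b} {c} {d} eq =
  trans (sym (π₁-pair a b)) (trans (cong π₁ eq) (π₁-pair c d)) ,
  trans (sym (π₂-pair a b)) (trans (cong π₂ eq) (π₂-pair c d))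

n≤triangle : ∀ n → n ≤ triangle n
n≤triangle zero    = z≤n
n≤triangle (suc n) = m≤m+n (suc n) (triangle n)

π₁≤ : ∀ n → π₁ n ≤ n
π₁≤ n = subst (π₁ n ≤_) (pair-unpair n) (m≤n+m (π₁ n) _)

π₂≤ : ∀ n → π₂ n ≤ n
π₂≤ n = subst (π₂ n ≤_) (pair-unpair n)
  (≤-trans (m≤n+m (π₂ n) (π₁ n)) (≤-trans (n≤triangle _) (m≤m+n _ _)))

-- Compound Gödel numbers have positive tags, so their arguments are smaller numbers. Recursion over
-- Gödel numbers, as in `translate`, relies on this.
π₂< : ∀ n → 0 < π₁ n → π₂ n < n
π₂< n 0<π₁ = subst (π₂ n <_) (pair-unpair n)
  (≤-trans (m<n+m (π₂ n) 0<π₁) (≤-trans (n≤triangle _) (m≤m+n _ _)))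

-- Determinism and injectivity of the coding of programs

⇓-deterministic : O ⊢ c [ x ]⇓ y → O ⊢ c [ x ]⇓ z → y ≡ z
⇓-deterministic ⇓zero ⇓zero = refl
⇓-deterministic ⇓succ ⇓succ = refl
⇓-deterministic ⇓left ⇓left = refl
⇓-deterministic ⇓right ⇓right = refl
⇓-deterministic (⇓yes p) (⇓yes q) = refl
⇓-deterministic (⇓yes p) (⇓no q) = contradiction p q
⇓-deterministic (⇓no p) (⇓yes q) = contradiction q p
⇓-deterministic (⇓no p) (⇓no q) = refl
⇓-deterministic (⇓pair p q) (⇓pair p′ q′) =
  cong₂ ⟨_,_⟩ (⇓-deterministic p p′) (⇓-deterministic q q′)
⇓-deterministic (⇓comp p q) (⇓comp p′ q′) with refl ← ⇓-deterministic p p′ =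
  ⇓-deterministic q q′
⇓-deterministic (⇓prec-0 e p) (⇓prec-0 e′ p′) with refl ← trans (sym e) e′ =
  ⇓-deterministic p p′
⇓-deterministic (⇓prec-0 e _) (⇓prec-s e′ _ _) with () ← trans (sym e) e′
⇓-deterministic (⇓prec-s e _ _) (⇓prec-0 e′ _) with () ← trans (sym e) e′
⇓-deterministic (⇓prec-s e p q) (⇓prec-s e′ p′ q′) with refl ← trans (sym e) e′
  with refl ← ⇓-deterministic p p′ = ⇓-deterministic q q′
⇓-deterministic {y = m} {z = n} (⇓min p below) (⇓min p′ below′) with <-cmp m n
... | tri≈ _ m≡n _ = m≡n
... | tri< m<n _ _ with () ← ⇓-deterministic p (proj₂ (below′ m m<n))
... | tri> _ _ n<m with () ← ⇓-deterministic p′ (proj₂ (below n n<m))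

private
  depth : Code → ℕ
  depth (pairᶜ c d) = suc (depth c ⊔ depth d)
  depth (compᶜ c d) = suc (depth c ⊔ depth d)
  depth (precᶜ c d) = suc (depth c ⊔ depth d)
  depth (minᶜ c)    = suc (depth c)
  depth _           = 0

  -- A left inverse of the numbering gives its injectivity without comparing all pairs of
  -- constructors. The first argument is fuel, to be at least the depth of the code.
  parse : ℕ → ℕ → Code
  parseTag : ℕ → ℕ → ℕ → Code
  parse n e = parseTag n (π₁ e) (π₂ e)
  parseTag n 0 _ = zeroᶜ
  parseTag n 1 _ = succᶜ
  parseTag n 2 _ = leftᶜ
  parseTag n 3 _ = rightᶜ
  parseTag n 4 _ = oracleᶜ
  parseTag (suc n) 5 a = pairᶜ (parse n (π₁ a)) (parse n (π₂ a))
  parseTag (suc n) 6 a = compᶜ (parse n (π₁ a)) (parse n (π₂ a))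
  parseTag (suc n) 7 a = precᶜ (parse n (π₁ a)) (parse n (π₂ a))
  parseTag (suc n) 8 a = minᶜ (parse n a)
  parseTag _ _ _ = zeroᶜ

  parse-pair : ∀ n t a → parse n ⟨ t , a ⟩ ≡ parseTag n t a
  parse-pair n t a = cong₂ (parseTag n) (π₁-pair t a) (π₂-pair t a)

  parse-⌜⌝ : ∀ n c → depth c ≤ n → parse n ⌜ c ⌝ ≡ c
  parse-⌜⌝₂ : ∀ n c d → depth c ⊔ depth d ≤ n →
    parse n (π₁ ⟨ ⌜ c ⌝ , ⌜ d ⌝ ⟩) ≡ c × parse n (π₂ ⟨ ⌜ c ⌝ , ⌜ d ⌝ ⟩) ≡ d
  parse-⌜⌝ n zeroᶜ _ = parse-pair n 0 0
  parse-⌜⌝ n succᶜ _ = parse-pair n 1 0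
  parse-⌜⌝ n leftᶜ _ = parse-pair n 2 0
  parse-⌜⌝ n rightᶜ _ = parse-pair n 3 0
  parse-⌜⌝ n oracleᶜ _ = parse-pair n 4 0
  parse-⌜⌝ (suc n) (pairᶜ c d) (s≤s le) with eq , eq′ ← parse-⌜⌝₂ n c d le =
    trans (parse-pair (suc n) 5 ⟨ ⌜ c ⌝ , ⌜ d ⌝ ⟩) (cong₂ pairᶜ eq eq′)
  parse-⌜⌝ (suc n) (compᶜ c d) (s≤s le) with eq , eq′ ← parse-⌜⌝₂ n c d le =
    trans (parse-pair (suc n) 6 ⟨ ⌜ c ⌝ , ⌜ d ⌝ ⟩) (cong₂ compᶜ eq eq′)
  parse-⌜⌝ (suc n) (precᶜ c d) (s≤s le) with eq , eq′ ← parse-⌜⌝₂ n c d le =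
    trans (parse-pair (suc n) 7 ⟨ ⌜ c ⌝ , ⌜ d ⌝ ⟩) (cong₂ precᶜ eq eq′)
  parse-⌜⌝ (suc n) (minᶜ c) (s≤s le) =
    trans (parse-pair (suc n) 8 ⌜ c ⌝) (cong minᶜ (parse-⌜⌝ n c le))
  parse-⌜⌝₂ n c d le =
    trans (cong (parse n) (π₁-pair ⌜ c ⌝ ⌜ d ⌝)) (parse-⌜⌝ n c (m⊔n≤o⇒m≤o _ _ le)) ,
    trans (cong (parse n) (π₂-pair ⌜ c ⌝ ⌜ d ⌝)) (parse-⌜⌝ n d (m⊔n≤o⇒n≤o (depth c) _ le))

⌜⌝-injective : ∀ {c d} → ⌜ c ⌝ ≡ ⌜ d ⌝ → c ≡ d
⌜⌝-injective {c} {d} eq =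
  trans (sym (parse-⌜⌝ (depth c ⊔ depth d) c (m≤m⊔n _ _)))
    (trans (cong (parse (depth c ⊔ depth d)) eq) (parse-⌜⌝ _ d (m≤n⊔m (depth c) _)))

-- Total recursive functions

record Rec (O : Pred ℕ 0ℓ) (f : ℕ → ℕ) : Set where
  constructor mkRec
  field
    program : Code
    correct : ∀ x → O ⊢ program [ x ]⇓ f x

record Rec₂ (O : Pred ℕ 0ℓ) (f : ℕ → ℕ → ℕ) : Set where
  constructor mkRec₂
  field
    uncurried : Rec O (λ x → f (π₁ x) (π₂ x))

open Rec
open Rec₂

Rec-≗ : f ≗ g → Rec O f → Rec O g
Rec-≗ {O = O} f≗g (mkRec c ok) = mkRec c (λ x → subst (O ⊢ c [ x ]⇓_) (f≗g x) (ok x))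

Rec₂-≗ : ∀ {f g : ℕ → ℕ → ℕ} → (∀ x y → f x y ≡ g x y) → Rec₂ O f → Rec₂ O g
Rec₂-≗ f≗g r = mkRec₂ (Rec-≗ (λ x → f≗g (π₁ x) (π₂ x)) (uncurried r))

infixr 9 _⊙_
_⊙_ : Rec O f → Rec O g → Rec O (f ∘ g)
_⊙_ {g = g} (mkRec c ok) (mkRec d ok′) = mkRec (compᶜ c d) (λ x → ⇓comp (ok′ x) (ok (g x)))

⟪_,_⟫ : Rec O f → Rec O g → Rec O (λ x → ⟨ f x , g x ⟩)
⟪ mkRec c ok , mkRec d ok′ ⟫ = mkRec (pairᶜ c d) (λ x → ⇓pair (ok x) (ok′ x))

rec-π₁ : Rec O π₁
rec-π₁ = mkRec leftᶜ (λ _ → ⇓left)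

rec-π₂ : Rec O π₂
rec-π₂ = mkRec rightᶜ (λ _ → ⇓right)

rec-suc : Rec O suc
rec-suc = mkRec succᶜ (λ _ → ⇓succ)

rec-id : Rec O (λ x → x)
rec-id = Rec-≗ pair-unpair ⟪ rec-π₁ , rec-π₂ ⟫

constᶜ : ℕ → Code
constᶜ zero    = zeroᶜ
constᶜ (suc n) = compᶜ succᶜ (constᶜ n)

⇓const : ∀ n → O ⊢ constᶜ n [ x ]⇓ n
⇓const zero    = ⇓zero
⇓const (suc n) = ⇓comp (⇓const n) ⇓succ

rec-const : ∀ n → Rec O (λ _ → n)
rec-const n = mkRec (constᶜ n) (λ _ → ⇓const n)

ap₂ : ∀ {f : ℕ → ℕ → ℕ} → Rec₂ O f → Rec O g → Rec O h → Rec O (λ x → f (g x) (h x))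
ap₂ {g = g} {h = h} {f = f} r s t =
  Rec-≗ (λ x → cong₂ f (π₁-pair (g x) (h x)) (π₂-pair (g x) (h x))) (uncurried r ⊙ ⟪ s , t ⟫)

rec-prec : Rec O f → Rec O g → (h : ℕ → ℕ → ℕ) → (∀ a → f a ≡ h a 0) →
  (∀ a n → g ⟨ a , ⟨ n , h a n ⟩ ⟩ ≡ h a (suc n)) → Rec₂ O h
rec-prec {O = O} {f = f} {g = g} (mkRec c ok) (mkRec d ok′) h h-0 h-s =
  mkRec₂ (mkRec (precᶜ c d) λ x → run x (π₁ x) (π₂ x) refl)
  where
  run : ∀ x a n → unpair x ≡ (a , n) → O ⊢ precᶜ c d [ x ]⇓ h a n
  run x a zero eq = ⇓prec-0 eq (subst (O ⊢ c [ a ]⇓_) (h-0 a) (ok a))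
  run x a (suc n) eq = ⇓prec-s eq (run ⟨ a , n ⟩ a n (unpair-pair a n))
    (subst (O ⊢ d [ ⟨ a , ⟨ n , h a n ⟩ ⟩ ]⇓_) (h-s a n) (ok′ _))

rec-natrec : ∀ a → Rec O g → (h : ℕ → ℕ) → a ≡ h 0 → (∀ n → g ⟨ n , h n ⟩ ≡ h (suc n)) → Rec O h
rec-natrec {O = O} {g = g} a r h h-0 h-s = ap₂
  (rec-prec (rec-const a) (r ⊙ rec-π₂) (λ _ → h) (λ _ → h-0)
    (λ b n → trans (cong g (π₂-pair b _)) (h-s n)))
  (rec-const 0) rec-id

private
  third : Rec O (λ x → π₂ (π₂ x))
  third = rec-π₂ ⊙ rec-π₂

  third≡ : ∀ a b c → π₂ (π₂ ⟨ a , ⟨ b , c ⟩ ⟩) ≡ c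
  third≡ a b c = trans (cong π₂ (π₂-pair a _)) (π₂-pair b c)

rec-pred : Rec O pred
rec-pred = rec-natrec 0 rec-π₁ pred refl (λ n → π₁-pair n _)

rec-+ : Rec₂ O _+_
rec-+ = rec-prec rec-id (rec-suc ⊙ third) _+_ (λ a → sym (+-identityʳ a))
  (λ a n → trans (cong suc (third≡ a n _)) (sym (+-suc a n)))

rec-∸ : Rec₂ O _∸_
rec-∸ = rec-prec rec-id (rec-pred ⊙ third) _∸_ (λ _ → refl)
  (λ a n → trans (cong pred (third≡ a n _)) (pred[m∸n]≡m∸[1+n] a n))

rec-* : Rec₂ O _*_
rec-* = rec-prec (rec-const 0) (ap₂ rec-+ rec-π₁ third) _*_ (λ a → sym (*-zeroʳ a))
  (λ a n → trans (cong₂ _+_ (π₁-pair a _) (third≡ a n _)) (sym (*-suc a n)))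

-- Course-of-values recursion

-- Lists are coded as by `codeᵛ`: `0` is the empty list, and `suc ⟨ x , l ⟩` has head `x` and tail
-- `l`.
head₀ tail₀ : ℕ → ℕ
head₀ = π₁ ∘ pred
tail₀ = π₂ ∘ pred

drop₀ : ℕ → ℕ → ℕ
drop₀ l zero    = l
drop₀ l (suc i) = tail₀ (drop₀ l i)

nth₀ : ℕ → ℕ → ℕ
nth₀ l i = head₀ (drop₀ l i)

rec-head₀ : Rec O head₀
rec-head₀ = rec-π₁ ⊙ rec-pred

rec-tail₀ : Rec O tail₀
rec-tail₀ = rec-π₂ ⊙ rec-pred

rec-nth₀ : Rec₂ O nth₀
rec-nth₀ = mkRec₂ (rec-head₀ ⊙ uncurried (rec-prec rec-id (rec-tail₀ ⊙ third) drop₀ (λ _ → refl)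
  (λ a n → cong tail₀ (third≡ a n _))))

-- The argument `x` stands for `⟨ a , ⟨ n , history a n ⟩ ⟩`. A history lists the latest value
-- first, so the value at `i` is found at position `n ∸ suc i`.
previous : ℕ → ℕ → ℕ
previous x i = nth₀ (π₂ (π₂ x)) (π₁ (π₂ x) ∸ suc i)

rec-previous : Rec₂ O previous
rec-previous = mkRec₂ (ap₂ rec-nth₀ (third ⊙ rec-π₁)
  (ap₂ rec-∸ (rec-π₁ ⊙ rec-π₂ ⊙ rec-π₁) (rec-suc ⊙ rec-π₂)))

module CourseOfValues (H : ℕ → ℕ) where

  history : ℕ → ℕ → ℕ
  history a zero    = 0
  history a (suc n) = suc ⟨ H ⟨ a , ⟨ n , history a n ⟩ ⟩ , history a n ⟩

  cov : ℕ → ℕ → ℕ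
  cov a n = H ⟨ a , ⟨ n , history a n ⟩ ⟩

  rec-cov : Rec O H → Rec₂ O cov
  rec-cov r = mkRec₂ (r ⊙ ⟪ rec-π₁ , ⟪ rec-π₂ , uncurried rec-history ⟫ ⟫)
    where
    rec-history = rec-prec (rec-const 0) (rec-suc ⊙ ⟪ r , third ⟫) history (λ _ → refl)
      (λ a n → cong (λ z → suc ⟨ cov a n , z ⟩) (third≡ a n _))

  private
    drop-history : ∀ a i n → drop₀ (history a (i + n)) i ≡ history a n
    drop-history a zero n = refl
    drop-history a (suc i) n = trans
      (cong (λ z → tail₀ (drop₀ (history a z) i)) (sym (+-suc i n)))
      (trans (cong tail₀ (drop-history a i (suc n))) (π₂-pair (cov a n) (history a n)))

  previous-cov : ∀ a {n i} → i < n → previous ⟨ a , ⟨ n , history a n ⟩ ⟩ i ≡ cov a i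
  previous-cov a {n} {i} i<n = trans
    (cong₂ nth₀ (third≡ a n _) (cong (_∸ suc i) (trans (cong π₁ (π₂-pair a _)) (π₁-pair n _))))
    (trans (cong (λ z → head₀ (drop₀ (history a z) (n ∸ suc i))) (sym (m∸n+n≡m i<n)))
      (trans (cong head₀ (drop-history a (n ∸ suc i) (suc i))) (π₁-pair (cov a i) (history a i))))

-- Recursive predicates

bit : ∀ {Φ : Set} → Dec Φ → ℕ
bit Φ? = if does Φ? then 1 else 0

if-yes : (Φ? : Dec Φ) → Φ → (if does Φ? then x else y) ≡ x
if-yes (yes _) _ = refl
if-yes (no ¬a) a = contradiction a ¬a

if-no : (Φ? : Dec Φ) → ¬ Φ → (if does Φ? then x else y) ≡ y
if-no (yes a) ¬a = contradiction a ¬a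
if-no (no _) _ = refl

record RecPred (O : Pred ℕ 0ℓ) (P : ℕ → Set) : Set where
  constructor mkRecPred
  field
    decide         : ∀ x → Dec (P x)
    characteristic : Rec O (λ x → bit (decide x))

open RecPred

private
  bit-¬ : (Φ? : Dec Φ) → 1 ∸ bit Φ? ≡ bit (¬? Φ?)
  bit-¬ (yes _) = refl
  bit-¬ (no _)  = refl

  bit-× : (Φ? : Dec Φ) (Ψ? : Dec Ψ) → bit Φ? * bit Ψ? ≡ bit (Φ? ×-dec Ψ?)
  bit-× (yes _) (yes _) = refl
  bit-× (yes _) (no _)  = refl
  bit-× (no _)  _       = refl

  bit-→ : (Φ? : Dec Φ) (Ψ? : Dec Ψ) → 1 ∸ bit Φ? * (1 ∸ bit Ψ?) ≡ bit (Φ? →-dec Ψ?)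
  bit-→ (yes _) (yes _) = refl
  bit-→ (yes _) (no _)  = refl
  bit-→ (no _)  _       = refl

  bit-yes : (Φ? : Dec Φ) → Φ → 1 ≡ bit Φ?
  bit-yes (yes _) _ = refl
  bit-yes (no ¬a) a = contradiction a ¬a

  bit-no : (Φ? : Dec Φ) → ¬ Φ → 0 ≡ bit Φ?
  bit-no (yes a) ¬a = contradiction a ¬a
  bit-no (no _) _ = refl

  bit-≟ : ∀ m n → 1 ∸ ((m ∸ n) + (n ∸ m)) ≡ bit (m ≟ n)
  bit-≟ m n with <-cmp m n
  ... | tri≈ _ refl _ = trans (cong₂ (λ a b → 1 ∸ (a + b)) (n∸n≡0 m) (n∸n≡0 m)) (bit-yes (m ≟ n) refl)
  ... | tri< m<n m≢n _ = trans (m≤n⇒m∸n≡0 (≤-trans (m<n⇒0<n∸m m<n) (m≤n+m (n ∸ m) (m ∸ n)))) (bit-no (m ≟ n) m≢n)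
  ... | tri> _ m≢n n<m = trans (m≤n⇒m∸n≡0 (≤-trans (m<n⇒0<n∸m n<m) (m≤m+n (m ∸ n) (n ∸ m)))) (bit-no (m ≟ n) m≢n)

  bit-≤ : ∀ m n → 1 ∸ (m ∸ n) ≡ bit (m ≤? n)
  bit-≤ m n with ≤-<-connex m n
  ... | inj₁ m≤n = trans (cong (1 ∸_) (m≤n⇒m∸n≡0 m≤n)) (bit-yes (m ≤? n) m≤n)
  ... | inj₂ n<m = trans (m≤n⇒m∸n≡0 (m<n⇒0<n∸m n<m)) (bit-no (m ≤? n) (<⇒≱ n<m))

  bit-if : (Φ? : Dec Φ) → bit Φ? * x + (1 ∸ bit Φ?) * y ≡ (if does Φ? then x else y)
  bit-if {x = x} (yes _) = trans (+-identityʳ _) (+-identityʳ x)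
  bit-if {y = y} (no _)  = +-identityʳ y

infixr 9 _⊙ᵖ_
infix 8 ¬ᵖ_
infix 7 _≡ᵖ_ _≤ᵖ_ _<ᵖ_
infixr 6 _×ᵖ_
infixr 5 _→ᵖ_

mapᵖ : (∀ x → P x ⇔ Q x) → RecPred O P → RecPred O Q
mapᵖ e p = mkRecPred (λ x → Dec.map (e x) (decide p x)) (characteristic p)

_⊙ᵖ_ : RecPred O P → Rec O f → RecPred O (P ∘ f)
_⊙ᵖ_ {f = f} p s = mkRecPred (λ x → decide p (f x)) (characteristic p ⊙ s)

¬ᵖ_ : RecPred O P → RecPred O (λ x → ¬ P x)
¬ᵖ mkRecPred P? r = mkRecPred (¬? ∘ P?) (Rec-≗ (bit-¬ ∘ P?) (ap₂ rec-∸ (rec-const 1) r))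

_×ᵖ_ : RecPred O P → RecPred O Q → RecPred O (λ x → P x × Q x)
mkRecPred P? r ×ᵖ mkRecPred Q? s =
  mkRecPred (λ x → P? x ×-dec Q? x) (Rec-≗ (λ x → bit-× (P? x) (Q? x)) (ap₂ rec-* r s))

_→ᵖ_ : RecPred O P → RecPred O Q → RecPred O (λ x → P x → Q x)
mkRecPred P? r →ᵖ mkRecPred Q? s = mkRecPred (λ x → P? x →-dec Q? x)
  (Rec-≗ (λ x → bit-→ (P? x) (Q? x))
    (ap₂ rec-∸ (rec-const 1) (ap₂ rec-* r (ap₂ rec-∸ (rec-const 1) s))))

_≡ᵖ_ : Rec O f → Rec O g → RecPred O (λ x → f x ≡ g x)
_≡ᵖ_ {f = f} {g = g} r s = mkRecPred (λ x → f x ≟ g x) (Rec-≗ (λ x → bit-≟ (f x) (g x))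
  (ap₂ rec-∸ (rec-const 1) (ap₂ rec-+ (ap₂ rec-∸ r s) (ap₂ rec-∸ s r))))

_≤ᵖ_ : Rec O f → Rec O g → RecPred O (λ x → f x ≤ g x)
_≤ᵖ_ {f = f} {g = g} r s = mkRecPred (λ x → f x ≤? g x) (Rec-≗ (λ x → bit-≤ (f x) (g x))
  (ap₂ rec-∸ (rec-const 1) (ap₂ rec-∸ r s)))

_<ᵖ_ : Rec O f → Rec O g → RecPred O (λ x → f x < g x)
r <ᵖ s = (rec-suc ⊙ r) ≤ᵖ s

rec-if : (r : RecPred O P) → Rec O f → Rec O g →
  Rec O (λ x → if does (decide r x) then f x else g x)
rec-if p s t = Rec-≗ (λ x → bit-if (decide p x))
  (ap₂ rec-+ (ap₂ rec-* r s) (ap₂ rec-* (ap₂ rec-∸ (rec-const 1) r) t))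
  where r = characteristic p

byCases : RecPred O P → Rec O f → Rec O g →
  Σ[ h ∈ (ℕ → ℕ) ] (Rec O h × (∀ x → P x → h x ≡ f x) × (∀ x → ¬ P x → h x ≡ g x))
byCases p s t = _ , rec-if p s t , (λ x → if-yes (decide p x)) , (λ x → if-no (decide p x))

-- Unbounded search

φ-⌜⌝ : ∀ c → φ O ⌜ c ⌝ x y → O ⊢ c [ x ]⇓ y
φ-⌜⌝ {O = O} {x = x} {y = y} c (d , eq , run) =
  subst (λ c → O ⊢ c [ x ]⇓ y) (⌜⌝-injective eq) run

least : (∀ n → Dec (P n)) → ∃ P → Σ[ n ∈ ℕ ] (P n × (∀ k → k < n → ¬ P k))
least {P = P} P? (n , Pn) = <-rec _ go n Pn
  where
  go : ∀ n → (∀ {m} → m < n → P m → Σ[ k ∈ ℕ ] (P k × (∀ j → j < k → ¬ P j))) →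
       P n → Σ[ k ∈ ℕ ] (P k × (∀ j → j < k → ¬ P j))
  go n rec Pn with anyUpTo? P? n
  ... | yes (m , m<n , Pm) = rec m<n Pm
  ... | no none            = n , Pn , λ k k<n Pk → none (k , k<n , Pk)

-- `minᶜ` looks for a zero, so it is applied to the characteristic function of the complement.
searchᶜ : RecPred O P → Code
searchᶜ r = minᶜ (program (characteristic (¬ᵖ r)))

searchᶜ-halts : (r : RecPred O P) → ∀ x → P ⟨ x , y ⟩ →
  ∃[ n ] (P ⟨ x , n ⟩ × O ⊢ searchᶜ r [ x ]⇓ n)
searchᶜ-halts {O = O} {P = P} {y = y} r x Pxy
  with n , Pxn , below ← least {P = λ n → P ⟨ x , n ⟩} (λ n → decide r ⟨ x , n ⟩) (y , Pxy) =
  n , Pxn , ⇓min (run 0 n (found (decide r ⟨ x , n ⟩) Pxn))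
    (λ k k<n → 0 , run 1 k (missed (decide r ⟨ x , k ⟩) (below k k<n)))
  where
  run : ∀ b n → bit (¬? (decide r ⟨ x , n ⟩)) ≡ b →
        O ⊢ program (characteristic (¬ᵖ r)) [ ⟨ x , n ⟩ ]⇓ b
  run b n eq = subst (O ⊢ _ [ ⟨ x , n ⟩ ]⇓_) eq (correct (characteristic (¬ᵖ r)) ⟨ x , n ⟩)
  found : (Φ? : Dec Φ) → Φ → bit (¬? Φ?) ≡ 0
  found (yes _) _ = refl
  found (no ¬a) a = contradiction a ¬a
  missed : (Φ? : Dec Φ) → ¬ Φ → bit (¬? Φ?) ≡ 1
  missed (yes a) ¬a = contradiction a ¬a
  missed (no _) _ = refl

searchᶜ-sound : (r : RecPred O P) → ∀ x → O ⊢ searchᶜ r [ x ]⇓ y → P ⟨ x , y ⟩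
searchᶜ-sound {y = y} r x (⇓min p _) =
  stable (decide r ⟨ x , y ⟩) (⇓-deterministic p (correct (characteristic (¬ᵖ r)) ⟨ x , y ⟩))
  where
  stable : (Φ? : Dec Φ) → 0 ≡ bit (¬? Φ?) → Φ
  stable (yes a) _ = a

Uncurry : (ℕ → ℕ → Set) → ℕ → Set
Uncurry R x = R (π₁ x) (π₂ x)

uncurried⁺ : ∀ (R : ℕ → ℕ → Set) {x y} → R x y → Uncurry R ⟨ x , y ⟩
uncurried⁺ R {x} {y} = subst₂ R (sym (π₁-pair x y)) (sym (π₂-pair x y))

uncurried⁻ : ∀ (R : ℕ → ℕ → Set) {x y} → Uncurry R ⟨ x , y ⟩ → R x y
uncurried⁻ R {x} {y} = subst₂ R (π₁-pair x y) (π₂-pair x y)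

-- Only the relation has to be decidable. Totality may be proved by any classical argument, since
-- the search halts as soon as a witness exists.
choose : (R : ℕ → ℕ → Set) → RecPred O (Uncurry R) → (∀ x → ∃ (R x)) →
  Σ[ f ∈ (ℕ → ℕ) ] (Rec O f × (∀ x → R x (f x)))
choose R r total = (λ x → proj₁ (halt x)) ,
  mkRec (searchᶜ r) (λ x → proj₂ (proj₂ (halt x))) ,
  λ x → uncurried⁻ R {x} (proj₁ (proj₂ (halt x)))
  where
  halt : ∀ x → ∃[ n ] (Uncurry R ⟨ x , n ⟩ × _ ⊢ searchᶜ r [ x ]⇓ n)
  halt x = searchᶜ-halts r x (uncurried⁺ R {x} (proj₂ (total x)))

-- Relative computability and the jump

module _ (D : Code) where

  interpret : Code → Code
  interpret oracleᶜ     = D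
  interpret (pairᶜ c d) = pairᶜ (interpret c) (interpret d)
  interpret (compᶜ c d) = compᶜ (interpret c) (interpret d)
  interpret (precᶜ c d) = precᶜ (interpret c) (interpret d)
  interpret (minᶜ c)    = minᶜ (interpret c)
  interpret c           = c

  ⇓-interpret : (∀ {x} → x ∈ Y → O ⊢ D [ x ]⇓ 1) → (∀ {x} → x ∉ Y → O ⊢ D [ x ]⇓ 0) →
    Y ⊢ c [ x ]⇓ y → O ⊢ interpret c [ x ]⇓ y
  ⇓-interpret {Y = Y} {O = O} y1 n0 = go
    where
    go : Y ⊢ c [ x ]⇓ y → O ⊢ interpret c [ x ]⇓ y
    go ⇓zero = ⇓zero
    go ⇓succ = ⇓succ
    go ⇓left = ⇓left
    go ⇓right = ⇓right
    go (⇓yes p) = y1 p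
    go (⇓no p) = n0 p
    go (⇓pair p q) = ⇓pair (go p) (go q)
    go (⇓comp p q) = ⇓comp (go p) (go q)
    go (⇓prec-0 e p) = ⇓prec-0 e (go p)
    go (⇓prec-s e p q) = ⇓prec-s e (go p) (go q)
    go (⇓min p below) = ⇓min (go p) (λ k k<n → proj₁ (below k k<n) , go (proj₂ (below k k<n)))

relativize : RecPred O (_∈ Y) → Rec Y f → Rec O f
relativize {O = O} {Y = Y} (mkRecPred X? (mkRec D ok)) (mkRec c ok′) =
  mkRec (interpret D c) (λ x → ⇓-interpret D in1 out0 (ok′ x))
  where
  in1 : ∀ {x} → x ∈ Y → O ⊢ D [ x ]⇓ 1
  in1 {x} p with X? x | ok x
  ... | yes _ | run = run
  ... | no ¬p | _   = contradiction p ¬p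
  out0 : ∀ {x} → x ∉ Y → O ⊢ D [ x ]⇓ 0
  out0 {x} p with X? x | ok x
  ... | yes q | _   = contradiction q p
  ... | no _  | run = run

relativizeᵖ : RecPred O (_∈ Y) → RecPred Y P → RecPred O P
relativizeᵖ o (mkRecPred P? r) = mkRecPred P? (relativize o r)

-- The jump runs a program on its own number. A program with `x` hard-wired ignores that input, so
-- its membership in the jump asks whether `c` halts on `x`.
specialize : Code → ℕ → Code
specialize c x = compᶜ c (constᶜ x)

specialize-correct : ∀ c x → O ⊢ specialize c x [ y ]⇓ z → O ⊢ c [ x ]⇓ z
specialize-correct {O = O} {z = z} c x (⇓comp p q) =
  subst (λ w → O ⊢ c [ w ]⇓ z) (⇓-deterministic p (⇓const x)) q

rec-⌜const⌝ : Rec O (λ n → ⌜ constᶜ n ⌝)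
rec-⌜const⌝ = rec-natrec ⌜ zeroᶜ ⌝ (⟪ rec-const 6 , ⟪ rec-const ⌜ succᶜ ⌝ , rec-π₂ ⟫ ⟫)
  (λ n → ⌜ constᶜ n ⌝) refl (λ n → cong (λ z → ⟨ 6 , ⟨ ⌜ succᶜ ⌝ , z ⟩ ⟩) (π₂-pair n ⌜ constᶜ n ⌝))

rec-⌜specialize⌝ : ∀ c → Rec O (λ x → ⌜ specialize c x ⌝)
rec-⌜specialize⌝ c = ⟪ rec-const 6 , ⟪ rec-const ⌜ c ⌝ , rec-⌜const⌝ ⟫ ⟫

module Classical (em : ExcludedMiddle (lsuc 0ℓ)) where

  em₀ : (Φ : Set) → Dec Φ
  em₀ Φ = Dec.map′ lower lift (em {Lift (lsuc 0ℓ) Φ})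

  oracle : RecPred O (_∈ O)
  oracle {O = O} = mkRecPred (λ x → em₀ (x ∈ O)) (mkRec oracleᶜ run)
    where
    run : ∀ x → O ⊢ oracleᶜ [ x ]⇓ bit (em₀ (x ∈ O))
    run x = [ (λ p → subst (O ⊢ oracleᶜ [ x ]⇓_) (bit-yes (em₀ (x ∈ O)) p) (⇓yes p))
            , (λ ¬p → subst (O ⊢ oracleᶜ [ x ]⇓_) (bit-no (em₀ (x ∈ O)) ¬p) (⇓no ¬p))
            ]′ (toSum (em₀ (x ∈ O)))

  -- The search for a witness, with `x` hard-wired, halts exactly if there is one. One jump thus
  -- pays for one unbounded quantifier.
  ∃ᵖ : {R : ℕ → ℕ → Set} → RecPred O (Uncurry R) → RecPred (O ′) (λ x → ∃ (R x))
  ∃ᵖ {O = O} {R = R} r = mapᵖ (λ x → mk⇔ (sound x) (complete x)) (oracle ⊙ᵖ rec-⌜specialize⌝ (searchᶜ r))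
    where
    sound : ∀ x → (O ′) ⌜ specialize (searchᶜ r) x ⌝ → ∃ (R x)
    sound x (y , p) = y , uncurried⁻ R {x}
      (searchᶜ-sound r x (specialize-correct (searchᶜ r) x (φ-⌜⌝ (specialize (searchᶜ r) x) p)))
    complete : ∀ x → ∃ (R x) → (O ′) ⌜ specialize (searchᶜ r) x ⌝
    complete x (y , Rxy) = halts (searchᶜ-halts r x (uncurried⁺ R {x} Rxy))
      where
      halts : ∃[ n ] (Uncurry R ⟨ x , n ⟩ × O ⊢ searchᶜ r [ x ]⇓ n) → _
      halts (n , _ , run) = n , specialize (searchᶜ r) x , refl , ⇓comp (⇓const x) run

  ∀ᵖ : {R : ℕ → ℕ → Set} → RecPred O (Uncurry R) → RecPred (O ′) (λ x → ∀ y → R x y)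
  ∀ᵖ {R = R} r = mapᵖ (λ x → mk⇔
      (λ none y → decidable-stable (em₀ (R x y)) (λ ¬Rxy → none (y , ¬Rxy)))
      (λ all (y , ¬Rxy) → ¬Rxy (all y)))
    (¬ᵖ ∃ᵖ (¬ᵖ r))

  ≤-jump : RecPred (O ′) (_∈ O)
  -- Membership in `O` is written with a dummy existential quantifier, whose witness may be 0.
  ≤-jump = mapᵖ (λ x → mk⇔ proj₂ (0 ,_)) (∃ᵖ (oracle ⊙ᵖ rec-π₁))

  jump : Rec O f → Rec (O ′) f
  jump = relativize ≤-jump

  jumpᵖ : RecPred O P → RecPred (O ′) P
  jumpᵖ = relativizeᵖ ≤-jump

-- Oracle-free programs relative to an arbitrary oracle

strip : Code → Code
strip = interpret zeroᶜ

⇓-strip : ∅ ⊢ c [ x ]⇓ y → O ⊢ strip c [ x ]⇓ y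
⇓-strip = ⇓-interpret zeroᶜ (λ ()) (λ _ → ⇓zero)

-- A stripped program never consults its oracle, and where `c` does, the empty oracle answers 0, as
-- does the `zeroᶜ` put in its place.
⇓-unstrip : ∀ c → O ⊢ strip c [ x ]⇓ y → ∅ ⊢ c [ x ]⇓ y
⇓-unstrip zeroᶜ ⇓zero = ⇓zero
⇓-unstrip succᶜ ⇓succ = ⇓succ
⇓-unstrip leftᶜ ⇓left = ⇓left
⇓-unstrip rightᶜ ⇓right = ⇓right
⇓-unstrip oracleᶜ ⇓zero = ⇓no (λ ())
⇓-unstrip (pairᶜ c d) (⇓pair p q) = ⇓pair (⇓-unstrip c p) (⇓-unstrip d q)
⇓-unstrip (compᶜ c d) (⇓comp p q) = ⇓comp (⇓-unstrip d p) (⇓-unstrip c q)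
⇓-unstrip (precᶜ c d) (⇓prec-0 e p) = ⇓prec-0 e (⇓-unstrip c p)
⇓-unstrip (precᶜ c d) (⇓prec-s e p q) = ⇓prec-s e (⇓-unstrip (precᶜ c d) p) (⇓-unstrip d q)
⇓-unstrip (minᶜ c) (⇓min p below) =
  ⇓min (⇓-unstrip c p) (λ k k<n → proj₁ (below k k<n) , ⇓-unstrip c (proj₂ (below k k<n)))

private
  binary? : ∀ t → Dec (5 ≤ t × t ≤ 7)
  binary? t = 5 ≤? t ×-dec t ≤? 7

  -- The action of `strip` on Gödel numbers, extended to all numbers. Tag 8 is `minᶜ`, and tags 5 to
  -- 7 are the binary constructors. The oracle instruction is recognized by its whole number and not
  -- by its tag 4, so that the other numbers with this tag, which are no Gödel numbers, stay
  -- unchanged.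
  translateBody : ℕ → (ℕ → ℕ) → ℕ
  translateBody e p =
    if does (π₁ e ≟ 8) then ⟨ 8 , p (π₂ e) ⟩
    else if does (e ≟ ⌜ oracleᶜ ⌝) then ⌜ zeroᶜ ⌝
    else if does (binary? (π₁ e)) then ⟨ π₁ e , ⟨ p (π₁ (π₂ e)) , p (π₂ (π₂ e)) ⟩ ⟩
    else e

  translateStep : ℕ → ℕ
  translateStep x = translateBody (π₁ (π₂ x)) (previous x)

  rec-translateStep : Rec O translateStep
  rec-translateStep =
    rec-if (tag ≡ᵖ rec-const 8) ⟪ rec-const 8 , ap₂ rec-previous rec-id arg ⟫
    (rec-if (e ≡ᵖ rec-const ⌜ oracleᶜ ⌝) (rec-const ⌜ zeroᶜ ⌝)
    (rec-if ((rec-const 5 ≤ᵖ tag) ×ᵖ (tag ≤ᵖ rec-const 7))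
      ⟪ tag , ⟪ ap₂ rec-previous rec-id (rec-π₁ ⊙ arg) , ap₂ rec-previous rec-id (rec-π₂ ⊙ arg) ⟫ ⟫
      e))
    where
    e = rec-π₁ ⊙ rec-π₂
    tag = rec-π₁ ⊙ e
    arg = rec-π₂ ⊙ e

  module T = CourseOfValues translateStep

abstract
  translate : ℕ → ℕ
  translate = T.cov 0

  rec-translate : Rec O translate
  rec-translate = ap₂ (T.rec-cov rec-translateStep) (rec-const 0) rec-id

  private
    earlier : ℕ → ℕ → ℕ
    earlier e = previous ⟨ 0 , ⟨ e , T.history 0 e ⟩ ⟩

    earlier≡ : ∀ e {i} → i < e → earlier e i ≡ translate i
    earlier≡ e = T.previous-cov 0

    translate≡ : ∀ e → translate e ≡ translateBody e (earlier e)
    translate≡ e = cong (λ z → translateBody z (earlier e))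
      (trans (cong π₁ (π₂-pair 0 ⟨ e , T.history 0 e ⟩)) (π₁-pair e (T.history 0 e)))

private
  translate-min : ∀ e → π₁ e ≡ 8 → translate e ≡ ⟨ 8 , translate (π₂ e) ⟩
  translate-min e t≡8 = trans (translate≡ e) (trans (if-yes (π₁ e ≟ 8) t≡8)
    (cong (λ z → ⟨ 8 , z ⟩) (earlier≡ e (π₂< e (subst (0 <_) (sym t≡8) z<s)))))

  not-oracle : ∀ e → 5 ≤ π₁ e → e ≢ ⌜ oracleᶜ ⌝
  not-oracle e 5≤t refl with s≤s (s≤s (s≤s (s≤s ()))) ← 5≤t

  translate-binary : ∀ e → 5 ≤ π₁ e → π₁ e ≤ 7 →
    translate e ≡ ⟨ π₁ e , ⟨ translate (π₁ (π₂ e)) , translate (π₂ (π₂ e)) ⟩ ⟩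
  translate-binary e 5≤t t≤7 = trans (translate≡ e) (trans
    (if-no (π₁ e ≟ 8) (λ t≡8 → <-irrefl t≡8 (s≤s t≤7))) (trans
    (if-no (e ≟ ⌜ oracleᶜ ⌝) (not-oracle e 5≤t)) (trans
    (if-yes (binary? (π₁ e)) (5≤t , t≤7))
    (cong₂ (λ y z → ⟨ π₁ e , ⟨ y , z ⟩ ⟩)
      (earlier≡ e (≤-<-trans (π₁≤ (π₂ e)) arg<e))
      (earlier≡ e (≤-<-trans (π₂≤ (π₂ e)) arg<e))))))
    where
    arg<e : π₂ e < e
    arg<e = π₂< e (<-≤-trans z<s 5≤t)

  translate-else : ∀ e → π₁ e ≢ 8 → e ≢ ⌜ oracleᶜ ⌝ → ¬ (5 ≤ π₁ e × π₁ e ≤ 7) → translate e ≡ e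
  translate-else e ≢8 ≢o ¬b = trans (translate≡ e) (trans
    (if-no (π₁ e ≟ 8) ≢8) (trans
    (if-no (e ≟ ⌜ oracleᶜ ⌝) ≢o)
    (if-no (binary? (π₁ e)) ¬b)))

  translate-oracle : ∀ e → e ≡ ⌜ oracleᶜ ⌝ → translate e ≡ ⌜ zeroᶜ ⌝
  translate-oracle e e≡o = trans (translate≡ e) (trans
    (if-no (π₁ e ≟ 8) (λ t≡8 → contradiction (trans (sym (cong π₁ e≡o)) t≡8) (λ ())))
    (if-yes (e ≟ ⌜ oracleᶜ ⌝) e≡o))

  translate-small : ∀ e → π₁ e ≤ 4 → e ≢ ⌜ oracleᶜ ⌝ → translate e ≡ e
  translate-small e t≤4 ≢o = translate-else e
    (λ t≡8 → <⇒≱ (s≤s (s≤s (s≤s (s≤s (s≤s z≤n))))) (subst (_≤ 4) t≡8 t≤4)) ≢o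
    (λ (5≤t , _) → <⇒≱ {4} {5} ≤-refl (≤-trans 5≤t t≤4))

  translate-pair : ∀ t a b → 5 ≤ t → t ≤ 7 →
    translate ⟨ t , ⟨ a , b ⟩ ⟩ ≡ ⟨ t , ⟨ translate a , translate b ⟩ ⟩
  translate-pair t a b 5≤t t≤7 = trans
    (translate-binary e (subst (5 ≤_) (sym t≡) 5≤t) (subst (_≤ 7) (sym t≡) t≤7))
    (cong₂ ⟨_,_⟩ t≡ (cong₂ (λ y z → ⟨ translate y , translate z ⟩)
      (trans (cong π₁ (π₂-pair t ⟨ a , b ⟩)) (π₁-pair a b))
      (trans (cong π₂ (π₂-pair t ⟨ a , b ⟩)) (π₂-pair a b))))
    where
    e = ⟨ t , ⟨ a , b ⟩ ⟩
    t≡ : π₁ e ≡ t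
    t≡ = π₁-pair t ⟨ a , b ⟩

  translate-⟨8⟩ : ∀ t a → t ≡ 8 → translate ⟨ t , a ⟩ ≡ ⟨ 8 , translate a ⟩
  translate-⟨8⟩ t a t≡8 = trans (translate-min ⟨ t , a ⟩ (trans (π₁-pair t a) t≡8))
    (cong (λ z → ⟨ 8 , translate z ⟩) (π₂-pair t a))

  5≤5 : 5 ≤ 5
  5≤5 = ≤-refl
  5≤6 : 5 ≤ 6
  5≤6 = n≤1+n 5
  5≤7 : 5 ≤ 7
  5≤7 = ≤-trans 5≤6 (n≤1+n 6)
  6≤7 : 6 ≤ 7
  6≤7 = n≤1+n 6

translate-⌜⌝ : ∀ c → translate ⌜ c ⌝ ≡ ⌜ strip c ⌝
translate-⌜⌝ zeroᶜ = translate-small ⌜ zeroᶜ ⌝ (≤ᵇ⇒≤ _ _ _) (λ ())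
translate-⌜⌝ succᶜ = translate-small ⌜ succᶜ ⌝ (≤ᵇ⇒≤ _ _ _) (λ ())
translate-⌜⌝ leftᶜ = translate-small ⌜ leftᶜ ⌝ (≤ᵇ⇒≤ _ _ _) (λ ())
translate-⌜⌝ rightᶜ = translate-small ⌜ rightᶜ ⌝ (≤ᵇ⇒≤ _ _ _) (λ ())
translate-⌜⌝ oracleᶜ = translate-oracle ⌜ oracleᶜ ⌝ refl
translate-⌜⌝ (pairᶜ c d) = trans (translate-pair 5 ⌜ c ⌝ ⌜ d ⌝ 5≤5 5≤7)
  (cong₂ (λ y z → ⟨ 5 , ⟨ y , z ⟩ ⟩) (translate-⌜⌝ c) (translate-⌜⌝ d))
translate-⌜⌝ (compᶜ c d) = trans (translate-pair 6 ⌜ c ⌝ ⌜ d ⌝ 5≤6 6≤7)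
  (cong₂ (λ y z → ⟨ 6 , ⟨ y , z ⟩ ⟩) (translate-⌜⌝ c) (translate-⌜⌝ d))
translate-⌜⌝ (precᶜ c d) = trans (translate-pair 7 ⌜ c ⌝ ⌜ d ⌝ 5≤7 ≤-refl)
  (cong₂ (λ y z → ⟨ 7 , ⟨ y , z ⟩ ⟩) (translate-⌜⌝ c) (translate-⌜⌝ d))
translate-⌜⌝ (minᶜ c) = trans (translate-⟨8⟩ 8 ⌜ c ⌝ refl) (cong (λ y → ⟨ 8 , y ⟩) (translate-⌜⌝ c))

tag : Code → ℕ
tag zeroᶜ       = 0
tag succᶜ       = 1
tag leftᶜ       = 2
tag rightᶜ      = 3
tag oracleᶜ     = 4
tag (pairᶜ _ _) = 5
tag (compᶜ _ _) = 6
tag (precᶜ _ _) = 7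
tag (minᶜ _)    = 8

π₁-⌜⌝ : ∀ c → π₁ ⌜ c ⌝ ≡ tag c
π₁-⌜⌝ zeroᶜ = refl
π₁-⌜⌝ succᶜ = refl
π₁-⌜⌝ leftᶜ = refl
π₁-⌜⌝ rightᶜ = refl
π₁-⌜⌝ oracleᶜ = refl
π₁-⌜⌝ (pairᶜ c d) = π₁-pair 5 ⟨ ⌜ c ⌝ , ⌜ d ⌝ ⟩
π₁-⌜⌝ (compᶜ c d) = π₁-pair 6 ⟨ ⌜ c ⌝ , ⌜ d ⌝ ⟩
π₁-⌜⌝ (precᶜ c d) = π₁-pair 7 ⟨ ⌜ c ⌝ , ⌜ d ⌝ ⟩
π₁-⌜⌝ (minᶜ c) = π₁-pair 8 ⌜ c ⌝

private
  translate-tag : ∀ e → e ≢ ⌜ oracleᶜ ⌝ → π₁ (translate e) ≡ π₁ e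
  translate-tag e ≢o = [ min , (λ ≢8 → [ (λ (p , q) → binary p q) , else ≢8 ]′ (toSum (binary? (π₁ e)))) ]′
    (toSum (π₁ e ≟ 8))
    where
    min : π₁ e ≡ 8 → π₁ (translate e) ≡ π₁ e
    min t≡8 = trans (cong π₁ (translate-min e t≡8)) (trans (π₁-pair 8 (translate (π₂ e))) (sym t≡8))
    binary : 5 ≤ π₁ e → π₁ e ≤ 7 → π₁ (translate e) ≡ π₁ e
    binary p q = trans (cong π₁ (translate-binary e p q))
      (π₁-pair (π₁ e) ⟨ translate (π₁ (π₂ e)) , translate (π₂ (π₂ e)) ⟩)
    else : π₁ e ≢ 8 → ¬ (5 ≤ π₁ e × π₁ e ≤ 7) → π₁ (translate e) ≡ π₁ e
    else ≢8 ¬b = cong π₁ (translate-else e ≢8 ≢o ¬b)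

  Stripped : Code → ℕ → Set
  Stripped c e = ∃[ d ] (⌜ d ⌝ ≡ e × strip d ≡ c)

  leaf : ∀ c e → strip c ≡ c → tag c ≤ 4 → e ≢ ⌜ oracleᶜ ⌝ → π₁ e ≡ tag c → translate e ≡ ⌜ c ⌝ → Stripped c e
  leaf c e fixed t≤4 ≢o t≡ eq =
    c , trans (sym eq) (translate-small e (subst (_≤ 4) (sym t≡) t≤4) ≢o) , fixed

  binary : (op : Code → Code → Code) (t : ℕ) →
    (∀ c d → ⌜ op c d ⌝ ≡ ⟨ t , ⟨ ⌜ c ⌝ , ⌜ d ⌝ ⟩ ⟩) →
    (∀ c d → strip (op c d) ≡ op (strip c) (strip d)) → 5 ≤ t → t ≤ 7 →
    ∀ c d e → (∀ e → translate e ≡ ⌜ c ⌝ → Stripped c e) → (∀ e → translate e ≡ ⌜ d ⌝ → Stripped d e) →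
    π₁ e ≡ t → translate e ≡ ⌜ op c d ⌝ → Stripped (op c d) e
  binary op t ⌜op⌝ strip-op 5≤t t≤7 c d e rec-c rec-d t≡ eq =
    let eqs = proj₂ (pair-injective {π₁ e} {⟨ translate (π₁ (π₂ e)) , translate (π₂ (π₂ e)) ⟩} {t} {⟨ ⌜ c ⌝ , ⌜ d ⌝ ⟩}
                (trans (sym (translate-binary e (subst (5 ≤_) (sym t≡) 5≤t) (subst (_≤ 7) (sym t≡) t≤7)))
                  (trans eq (⌜op⌝ c d))))
        eq-c , eq-d = pair-injective {translate (π₁ (π₂ e))} {translate (π₂ (π₂ e))} {⌜ c ⌝} {⌜ d ⌝} eqs
        c′ , ⌜c′⌝ , strip-c′ = rec-c (π₁ (π₂ e)) eq-c
        d′ , ⌜d′⌝ , strip-d′ = rec-d (π₂ (π₂ e)) eq-d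
    in op c′ d′
     , trans (⌜op⌝ c′ d′) (trans (cong₂ ⟨_,_⟩ (sym t≡) (trans (cong₂ ⟨_,_⟩ ⌜c′⌝ ⌜d′⌝) (pair-unpair (π₂ e)))) (pair-unpair e))
     , trans (strip-op c′ d′) (cong₂ op strip-c′ strip-d′)

-- An index that is no Gödel number denotes the empty function, so `translate` must not turn it into
-- a Gödel number. Apart from the oracle instruction tags are preserved; the outermost constructor
-- of `c` therefore determines the tag of `e`, and the induction descends to the components.
translate-reflects-⌜⌝ : ∀ c e → translate e ≡ ⌜ c ⌝ → Stripped c e
private
  reflects′ : ∀ c e → e ≢ ⌜ oracleᶜ ⌝ → π₁ e ≡ tag c → translate e ≡ ⌜ c ⌝ → Stripped c e
translate-reflects-⌜⌝ c e eq = [ oracle , (λ ≢o → reflects′ c e ≢o (tag≡ ≢o) eq) ]′ (toSum (e ≟ ⌜ oracleᶜ ⌝))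
  where
  oracle : e ≡ ⌜ oracleᶜ ⌝ → Stripped c e
  oracle e≡o = oracleᶜ , sym e≡o ,
    ⌜⌝-injective {zeroᶜ} {c} (trans (sym (translate-oracle e e≡o)) eq)
  tag≡ : e ≢ ⌜ oracleᶜ ⌝ → π₁ e ≡ tag c
  tag≡ ≢o = trans (sym (translate-tag e ≢o)) (trans (cong π₁ eq) (π₁-⌜⌝ c))
reflects′ zeroᶜ e = leaf zeroᶜ e refl (≤ᵇ⇒≤ _ _ _)
reflects′ succᶜ e = leaf succᶜ e refl (≤ᵇ⇒≤ _ _ _)
reflects′ leftᶜ e = leaf leftᶜ e refl (≤ᵇ⇒≤ _ _ _)
reflects′ rightᶜ e = leaf rightᶜ e refl (≤ᵇ⇒≤ _ _ _)
-- No translation is the oracle instruction: with tag 4, `e` would be left unchanged and so be that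
-- instruction itself.
reflects′ oracleᶜ e ≢o t≡ eq = contradiction
  (trans (sym (translate-small e (≤-reflexive t≡) ≢o)) eq) ≢o
reflects′ (pairᶜ c d) e _ = binary pairᶜ 5 (λ _ _ → refl) (λ _ _ → refl) 5≤5 5≤7 c d e
  (translate-reflects-⌜⌝ c) (translate-reflects-⌜⌝ d)
reflects′ (compᶜ c d) e _ = binary compᶜ 6 (λ _ _ → refl) (λ _ _ → refl) 5≤6 6≤7 c d e
  (translate-reflects-⌜⌝ c) (translate-reflects-⌜⌝ d)
reflects′ (precᶜ c d) e _ = binary precᶜ 7 (λ _ _ → refl) (λ _ _ → refl) 5≤7 ≤-refl c d e
  (translate-reflects-⌜⌝ c) (translate-reflects-⌜⌝ d)
reflects′ (minᶜ c) e _ t≡ eq =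
  let eq-c = proj₂ (pair-injective {8} {translate (π₂ e)} {8} {⌜ c ⌝} (trans (sym (translate-min e t≡)) eq))
      c′ , ⌜c′⌝ , strip-c′ = translate-reflects-⌜⌝ c (π₂ e) eq-c
  in minᶜ c′ , trans (cong₂ ⟨_,_⟩ (sym t≡) ⌜c′⌝) (pair-unpair e) , cong minᶜ strip-c′

φ-translate : ∀ e → φ ∅ e x y ⇔ φ O (translate e) x y
φ-translate {x = x} {y = y} {O = O} e = mk⇔
  (λ (c , eq , run) → strip c , trans (sym (translate-⌜⌝ c)) (cong translate eq) , ⇓-strip run)
  (λ (c , eq , run) → let d , ⌜d⌝ , strip-d = translate-reflects-⌜⌝ c e (sym eq) in
    d , ⌜d⌝ , ⇓-unstrip d (subst (λ c → O ⊢ c [ x ]⇓ y) (sym strip-d) run))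

-- Codes of lists

encode : List ℕ → ℕ
encode []       = 0
encode (x ∷ xs) = suc ⟨ x , encode xs ⟩

codeᵛ≡encode : ∀ {n} (v : Vec ℕ n) → codeᵛ v ≡ encode (toList v)
codeᵛ≡encode Vec.[]       = refl
codeᵛ≡encode (x Vec.∷ xs) = cong (λ z → suc ⟨ x , z ⟩) (codeᵛ≡encode xs)

encode-injective : ∀ {xs ys} → encode xs ≡ encode ys → xs ≡ ys
encode-injective {[]} {[]} _ = refl
encode-injective {x ∷ xs} {y ∷ ys} eq =
  let eq₁ , eq₂ = pair-injective {x} {encode xs} {y} {encode ys} (suc-injective eq)
  in cong₂ _∷_ eq₁ (encode-injective eq₂)

private
  decodeFuel : ℕ → ℕ → List ℕ
  decodeFuel (suc fuel) (suc m) = π₁ m ∷ decodeFuel fuel (π₂ m)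
  decodeFuel _          _       = []

  encode-decodeFuel : ∀ fuel m → m ≤ fuel → encode (decodeFuel fuel m) ≡ m
  encode-decodeFuel zero       zero    _         = refl
  encode-decodeFuel (suc fuel) zero    _         = refl
  encode-decodeFuel (suc fuel) (suc m) (s≤s m≤f) = cong suc
    (trans (cong ⟨ π₁ m ,_⟩ (encode-decodeFuel fuel (π₂ m) (≤-trans (π₂≤ m) m≤f))) (pair-unpair m))

abstract
  -- Every number codes a list, so a quantifier over tuples is a quantifier over numbers, without a
  -- test for well-formed codes.
  decode : ℕ → List ℕ
  decode n = decodeFuel n n

  encode-decode : ∀ n → encode (decode n) ≡ n
  encode-decode n = encode-decodeFuel n n ≤-refl

decode-encode : ∀ xs → decode (encode xs) ≡ xs
decode-encode xs = encode-injective (encode-decode (encode xs))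

decode-π₁ : ∀ xs y → decode (π₁ ⟨ encode xs , y ⟩) ≡ xs
decode-π₁ xs y = trans (cong decode (π₁-pair (encode xs) y)) (decode-encode xs)

decode-π₂ : ∀ x ys → decode (π₂ ⟨ x , encode ys ⟩) ≡ ys
decode-π₂ x ys = trans (cong decode (π₂-pair x (encode ys))) (decode-encode ys)

private
  second≡ : ∀ a b c → π₁ (π₂ ⟨ a , ⟨ b , c ⟩ ⟩) ≡ b
  second≡ a b c = trans (cong π₁ (π₂-pair a ⟨ b , c ⟩)) (π₁-pair b c)

-- The code of a tail is smaller than the code of the list, so recursion on lists is
-- course-of-values recursion on codes.
rec-foldr : Rec O f → Rec O g → (F : ℕ → List ℕ → ℕ) → (∀ a → f a ≡ F a []) →
  (∀ a x xs → g ⟨ a , ⟨ x , F a xs ⟩ ⟩ ≡ F a (x ∷ xs)) → Rec₂ O (λ a l → F a (decode l))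
rec-foldr {O = O} {f = f} {g = g} r s F F-[] F-∷ =
  Rec₂-≗ (λ a l → trans (cong (cov a) (sym (encode-decode l))) (cov≡ a (decode l))) (rec-cov rec-H)
  where
  H : ℕ → ℕ
  H x = if does (π₁ (π₂ x) ≟ 0) then f (π₁ x)
        else g ⟨ π₁ x , ⟨ head₀ (π₁ (π₂ x)) , previous x (tail₀ (π₁ (π₂ x))) ⟩ ⟩
  rec-H : Rec O H
  rec-H = rec-if ((rec-π₁ ⊙ rec-π₂) ≡ᵖ rec-const 0) (r ⊙ rec-π₁)
    (s ⊙ ⟪ rec-π₁ , ⟪ rec-head₀ ⊙ rec-π₁ ⊙ rec-π₂
         , ap₂ rec-previous rec-id (rec-tail₀ ⊙ rec-π₁ ⊙ rec-π₂) ⟫ ⟫)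
  open CourseOfValues H
  H-unfold : ∀ a n x → π₁ x ≡ a → π₁ (π₂ x) ≡ n →
    H x ≡ (if does (n ≟ 0) then f a else g ⟨ a , ⟨ head₀ n , previous x (tail₀ n) ⟩ ⟩)
  H-unfold a n x refl refl = refl
  cov≡ : ∀ a xs → cov a (encode xs) ≡ F a xs
  cov≡ a [] = trans (H-unfold a 0 ⟨ a , ⟨ 0 , 0 ⟩ ⟩ (π₁-pair a ⟨ 0 , 0 ⟩) (second≡ a 0 0)) (F-[] a)
  cov≡ a (x ∷ xs) = trans (H-unfold a n e (π₁-pair a ⟨ n , history a n ⟩) (second≡ a n (history a n)))
    (trans (cong₂ (λ u v → g ⟨ a , ⟨ u , v ⟩ ⟩) (π₁-pair x (encode xs))
      (trans (cong (previous e) (π₂-pair x (encode xs)))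
        (trans (previous-cov a (s≤s (subst (_≤ ⟨ x , encode xs ⟩) (π₂-pair x (encode xs)) (π₂≤ ⟨ x , encode xs ⟩))))
          (cov≡ a xs))))
      (F-∷ a x xs))
    where
    n = suc ⟨ x , encode xs ⟩
    e = ⟨ a , ⟨ n , history a n ⟩ ⟩

record RecList (O : Pred ℕ 0ℓ) (F : ℕ → List ℕ) : Set where
  constructor mkRecList
  field
    encoded : Rec O (encode ∘ F)

open RecList

rec-decode : Rec O f → RecList O (decode ∘ f)
rec-decode r = mkRecList (Rec-≗ (λ x → sym (encode-decode _)) r)

infixr 9 _⊙ˡ_
_⊙ˡ_ : RecList O F → Rec O f → RecList O (F ∘ f)
r ⊙ˡ s = mkRecList (encoded r ⊙ s)

private
  ap-list : {H : ℕ → List ℕ → ℕ} → Rec₂ O (λ a l → H a (decode l)) → Rec O f → RecList O F →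
    Rec O (λ x → H (f x) (F x))
  ap-list {f = f} {H = H} r s t = Rec-≗ (λ x → cong (H (f x)) (decode-encode _)) (ap₂ r s (encoded t))

rec-length : RecList O F → Rec O (λ x → length (F x))
rec-length = ap-list {H = λ _ → length} (rec-foldr (rec-const 0) (rec-suc ⊙ rec-π₂ ⊙ rec-π₂) (λ _ → length) (λ _ → refl)
  (λ a x xs → cong suc (third≡ a x (length xs)))) (rec-const 0)

-- Out of range, `nth` returns the junk value 0.

nth : List ℕ → ℕ → ℕ
nth []       _       = 0
nth (x ∷ _)  zero    = x
nth (_ ∷ xs) (suc i) = nth xs i

rec-nth : RecList O F → Rec O g → Rec O (λ x → nth (F x) (g x))
rec-nth {F = F} {g = g} r s = Rec-≗ (λ x → nth₀≡ (F x) (g x)) (ap₂ rec-nth₀ (encoded r) s)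
  where
  drop-0 : ∀ i → drop₀ 0 i ≡ 0
  drop-0 zero    = refl
  drop-0 (suc i) = cong tail₀ (drop-0 i)
  drop-tail : ∀ l i → drop₀ l (suc i) ≡ drop₀ (tail₀ l) i
  drop-tail l zero    = refl
  drop-tail l (suc i) = cong tail₀ (drop-tail l i)
  nth₀≡ : ∀ xs i → nth₀ (encode xs) i ≡ nth xs i
  nth₀≡ []       i       = cong head₀ (drop-0 i)
  nth₀≡ (x ∷ xs) zero    = π₁-pair x (encode xs)
  nth₀≡ (x ∷ xs) (suc i) = trans (cong head₀ (drop-tail (encode (x ∷ xs)) i))
    (trans (cong (λ z → head₀ (drop₀ z i)) (π₂-pair x (encode xs))) (nth₀≡ xs i))

infixl 8 _⟨$⟩_
-- A list of positions acts as a map between finite index sets, and this is composition with it. All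
-- inclusions between tuples are expressed in this way, including those that repeat or reorder
-- entries.
_⟨$⟩_ : List ℕ → List ℕ → List ℕ
xs ⟨$⟩ is = List.map (nth xs) is

rec-⟨$⟩ : RecList O F → RecList O G → RecList O (λ x → F x ⟨$⟩ G x)
rec-⟨$⟩ {F = F} r s = mkRecList (Rec-≗ (λ x → cong (λ l → encode (l ⟨$⟩ _)) (decode-encode (F x)))
  (ap-list {H = H} (rec-foldr (rec-const 0)
    (rec-suc ⊙ ⟪ rec-nth (rec-decode rec-π₁) (rec-π₁ ⊙ rec-π₂) , rec-π₂ ⊙ rec-π₂ ⟫) H (λ _ → refl)
    (λ a x xs → cong₂ (λ u v → suc ⟨ u , v ⟩)
      (cong₂ (λ u v → nth (decode u) v) (π₁-pair a ⟨ x , H a xs ⟩) (second≡ a x (H a xs))) (third≡ a x (H a xs))))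
    (encoded r) s))
  where
  H : ℕ → List ℕ → ℕ
  H a xs = encode (decode a ⟨$⟩ xs)

rec-upTo : Rec O f → RecList O (λ x → upTo (f x))
rec-upTo r = mkRecList (Rec-≗ (λ n → cong encode (trans (segment≡ n n ≤-refl)
    (applyUpTo-cong n (λ i → cong (_+ i) (n∸n≡0 n))))) (ap₂ rec-segment rec-id rec-id) ⊙ r)
  where
  -- `segment n j` lists the last `j` numbers below `n`: primitive recursion on codes prepends
  -- entries, so the list has to grow downwards.
  segment : ℕ → ℕ → List ℕ
  segment n zero    = []
  segment n (suc j) = n ∸ suc j ∷ segment n j
  applyUpTo-cong : ∀ n {f g : ℕ → ℕ} → (∀ i → f i ≡ g i) → applyUpTo f n ≡ applyUpTo g n
  applyUpTo-cong zero    f≗g = refl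
  applyUpTo-cong (suc n) f≗g = cong₂ _∷_ (f≗g 0) (applyUpTo-cong n (λ i → f≗g (suc i)))
  segment≡ : ∀ n j → j ≤ n → segment n j ≡ applyUpTo (λ i → n ∸ j + i) j
  segment≡ n zero    _   = refl
  segment≡ n (suc j) j<n = cong₂ _∷_ (sym (+-identityʳ _)) (trans (segment≡ n j (<⇒≤ j<n))
    (applyUpTo-cong j (λ i → sym (trans (+-suc (n ∸ suc j) i) (cong (_+ i) (sym (+-∸-assoc 1 j<n)))))))
  rec-segment : Rec₂ O (λ n j → encode (segment n j))
  rec-segment = rec-prec (rec-const 0)
    (rec-suc ⊙ ⟪ ap₂ rec-∸ rec-π₁ (rec-suc ⊙ rec-π₁ ⊙ rec-π₂) , rec-π₂ ⊙ rec-π₂ ⟫) _ (λ _ → refl)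
    (λ a n → cong₂ (λ u v → suc ⟨ u , v ⟩)
      (cong₂ (λ u v → u ∸ suc v) (π₁-pair a ⟨ n , encode (segment a n) ⟩) (second≡ a n (encode (segment a n))))
      (third≡ a n (encode (segment a n))))

InRange : ℕ → List ℕ → Set
InRange n = All (_< n)

private
  -- The least `n` with `InRange n xs`. The expression `a + (b ∸ a)` is the maximum of `a` and `b`,
  -- in operations already known to be recursive.
  bound : List ℕ → ℕ
  bound []       = 0
  bound (x ∷ xs) = suc x + (bound xs ∸ suc x)

  bound⇒InRange : ∀ n xs → bound xs ≤ n → InRange n xs
  bound⇒InRange n []       _  = []
  bound⇒InRange n (x ∷ xs) le = ≤-trans (m≤m+n (suc x) _) le ∷ bound⇒InRange n xs (≤-trans (m≤n+m∸n (bound xs) (suc x)) le)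

  InRange⇒bound : ∀ {n xs} → InRange n xs → bound xs ≤ n
  InRange⇒bound []         = z≤n
  InRange⇒bound {n} {x ∷ xs} (x<n ∷ lt) = ≤-trans (+-monoʳ-≤ (suc x) (∸-monoˡ-≤ (suc x) (InRange⇒bound lt)))
    (≤-reflexive (m+[n∸m]≡n x<n))

inRangeᵖ : Rec O f → RecList O F → RecPred O (λ x → InRange (f x) (F x))
inRangeᵖ r s = mapᵖ (λ x → mk⇔ (bound⇒InRange _ _) InRange⇒bound) (rec-bound ≤ᵖ r)
  where
  rec-bound = ap-list {H = λ _ → bound} (rec-foldr (rec-const 0)
    (ap₂ rec-+ (rec-suc ⊙ rec-π₁ ⊙ rec-π₂) (ap₂ rec-∸ (rec-π₂ ⊙ rec-π₂) (rec-suc ⊙ rec-π₁ ⊙ rec-π₂)))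
    (λ _ → bound) (λ _ → refl)
    (λ a x xs → cong₂ (λ u v → suc u + (v ∸ suc u)) (second≡ a x (bound xs)) (third≡ a x (bound xs))))
    (rec-const 0) s

infix 7 _≡ˡ_
_≡ˡ_ : RecList O F → RecList O G → RecPred O (λ x → F x ≡ G x)
r ≡ˡ s = mapᵖ (λ x → mk⇔ encode-injective (cong encode)) (encoded r ≡ᵖ encoded s)

-- Positions in lists

nth-⟨$⟩ : ∀ xs ρ {i} → i < length ρ → nth (xs ⟨$⟩ ρ) i ≡ nth xs (nth ρ i)
nth-⟨$⟩ xs (x ∷ ρ) {zero}  _        = refl
nth-⟨$⟩ xs (x ∷ ρ) {suc i} (s≤s lt) = nth-⟨$⟩ xs ρ lt

-- The range condition matters because of the junk value: at a position beyond `ρ` the left side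
-- reads `nth xs 0` and the right side reads 0.
⟨$⟩-assoc : ∀ xs ρ μ → InRange (length ρ) μ → xs ⟨$⟩ (ρ ⟨$⟩ μ) ≡ xs ⟨$⟩ ρ ⟨$⟩ μ
⟨$⟩-assoc xs ρ []      []        = refl
⟨$⟩-assoc xs ρ (i ∷ μ) (i< ∷ μ<) = cong₂ _∷_ (sym (nth-⟨$⟩ xs ρ i<)) (⟨$⟩-assoc xs ρ μ μ<)

finPositions : ∀ {n} ρ → InRange n ρ → Σ[ ρ′ ∈ Vec (Fin n) (length ρ) ] toList (map toℕ ρ′) ≡ ρ
finPositions []      []         = [] , refl
finPositions (i ∷ ρ) (i< ∷ ρ<) =
  let ρ′ , eq = finPositions ρ ρ< in fromℕ< i< ∷ ρ′ , cong₂ _∷_ (toℕ-fromℕ< i<) eq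

nth-++ˡ : ∀ xs ys {i} → i < length xs → nth (xs ++ ys) i ≡ nth xs i
nth-++ˡ (x ∷ xs) ys {zero}  _        = refl
nth-++ˡ (x ∷ xs) ys {suc i} (s≤s lt) = nth-++ˡ xs ys lt

nth-length : ∀ xs y ys → nth (xs ++ y ∷ ys) (length xs) ≡ y
nth-length []       y ys = refl
nth-length (x ∷ xs) y ys = nth-length xs y ys

nth< : ∀ {n} μ {i} → InRange n μ → i < length μ → nth μ i < n
nth< (x ∷ μ) {zero}  (x< ∷ _)  _        = x<
nth< (x ∷ μ) {suc i} (_ ∷ μ<) (s≤s lt) = nth< μ μ< lt

⟨$⟩-InRange : ∀ {n} μ ρ → InRange n μ → InRange (length μ) ρ → InRange n (μ ⟨$⟩ ρ)
⟨$⟩-InRange μ []      μ< []        = []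
⟨$⟩-InRange μ (i ∷ ρ) μ< (i< ∷ ρ<) = nth< μ μ< i< ∷ ⟨$⟩-InRange μ ρ μ< ρ<

⟨$⟩-++ : ∀ xs ys ρ → InRange (length xs) ρ → (xs ++ ys) ⟨$⟩ ρ ≡ xs ⟨$⟩ ρ
⟨$⟩-++ xs ys []      []        = refl
⟨$⟩-++ xs ys (i ∷ ρ) (i< ∷ ρ<) = cong₂ _∷_ (nth-++ˡ xs ys i<) (⟨$⟩-++ xs ys ρ ρ<)

inRange-≤ : ∀ {m n ρ} → m ≤ n → InRange m ρ → InRange n ρ
inRange-≤ m≤n = All.map (λ i< → <-≤-trans i< m≤n)

⟨$⟩-applyUpTo : ∀ xs {ys f} → (∀ {i} → i < length xs → nth ys (f i) ≡ nth xs i) →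
  ys ⟨$⟩ applyUpTo f (length xs) ≡ xs
⟨$⟩-applyUpTo []       _  = refl
⟨$⟩-applyUpTo (x ∷ xs) {ys} eq = cong₂ _∷_ (eq z<s) (⟨$⟩-applyUpTo xs {ys} (eq ∘ s<s))

⟨$⟩-upTo : ∀ xs → xs ⟨$⟩ upTo (length xs) ≡ xs
⟨$⟩-upTo xs = ⟨$⟩-applyUpTo xs {xs} (λ _ → refl)

++-⟨$⟩-upTo : ∀ xs ys → (xs ++ ys) ⟨$⟩ upTo (length xs) ≡ xs
++-⟨$⟩-upTo xs ys = trans (⟨$⟩-++ xs ys _ (all-upTo _)) (⟨$⟩-upTo xs)

upTo-⟨$⟩ : ∀ {n} ρ → InRange n ρ → upTo n ⟨$⟩ ρ ≡ ρ
upTo-⟨$⟩ []      []        = refl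
upTo-⟨$⟩ {n} (i ∷ ρ) (i< ∷ ρ<) = cong₂ _∷_ (nth-applyUpTo id i<) (upTo-⟨$⟩ ρ ρ<)
  where
  nth-applyUpTo : ∀ f {n i} → i < n → nth (applyUpTo f n) i ≡ f i
  nth-applyUpTo f {suc n} {zero}  _        = refl
  nth-applyUpTo f {suc n} {suc i} (s≤s lt) = nth-applyUpTo (f ∘ suc) lt

infix 4 _∋_
_∋_ : List ℕ → ℕ → Set
xs ∋ x = ∃[ i ] (i < length xs × nth xs i ≡ x)

∋-++ˡ : ∀ {xs ys x} → xs ∋ x → xs ++ ys ∋ x
∋-++ˡ {xs} {ys} (i , i< , eq) = i , ≤-trans i< (≤-trans (m≤m+n _ _) (≤-reflexive (sym (length-++ xs)))) ,
  trans (nth-++ˡ xs ys i<) eq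

∋-++ʳ : ∀ xs {ys x} → ys ∋ x → xs ++ ys ∋ x
∋-++ʳ []       p = p
∋-++ʳ (_ ∷ xs) p = let i , i< , eq = ∋-++ʳ xs p in suc i , s≤s i< , eq

all-∋ : ∀ xs → All (xs ∋_) xs
all-∋ []       = []
all-∋ (x ∷ xs) = (0 , z<s , refl) ∷ All.map (λ (i , i< , eq) → suc i , s≤s i< , eq) (all-∋ xs)

positions : ∀ xs {us} → All (xs ∋_) us → ∃[ ρ ] (InRange (length xs) ρ × xs ⟨$⟩ ρ ≡ us)
positions xs []                    = [] , [] , refl
positions xs ((i , i< , eq) ∷ us∈) =
  let ρ , ρ< , eqs = positions xs us∈ in i ∷ ρ , i< ∷ ρ< , cong₂ _∷_ eq eqs

⟨$⟩-∋ : ∀ xs {ρ} → InRange (length xs) ρ → All (xs ∋_) (xs ⟨$⟩ ρ)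
⟨$⟩-∋ xs []        = []
⟨$⟩-∋ xs (i< ∷ ρ<) = (_ , i< , refl) ∷ ⟨$⟩-∋ xs ρ<

Distinct : List ℕ → Set
Distinct xs = ∀ i j → i < length xs → j < length xs → nth xs i ≡ nth xs j → i ≡ j

distinct-⟨$⟩ : ∀ {xs} → Distinct xs → ∀ {ρ μ} → InRange (length xs) ρ → InRange (length xs) μ →
  xs ⟨$⟩ ρ ≡ xs ⟨$⟩ μ → ρ ≡ μ
distinct-⟨$⟩ d []        []        _  = refl
distinct-⟨$⟩ {xs} d (i< ∷ ρ<) (j< ∷ μ<) eq =
  let eq₁ , eq₂ = ∷-injective eq in cong₂ _∷_ (d _ _ i< j< eq₁) (distinct-⟨$⟩ {xs} d ρ< μ< eq₂)

distinct-∷ʳ : ∀ {xs x} → Distinct xs → ¬ xs ∋ x → Distinct (xs ++ x ∷ [])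
distinct-∷ʳ {xs} {x} d x∉ i j i< j< eq = cases (split i i<) (split j j<)
  where
  split : ∀ i → i < length (xs ++ x ∷ []) → i < length xs ⊎ i ≡ length xs
  split i lt = m≤n⇒m<n∨m≡n (≤-pred (≤-trans lt (≤-reflexive (trans (length-++ xs) (+-comm (length xs) 1)))))
  last : ∀ {i} → i ≡ length xs → nth (xs ++ x ∷ []) i ≡ x
  last refl = nth-length xs x []
  cases : i < length xs ⊎ i ≡ length xs → j < length xs ⊎ j ≡ length xs → i ≡ j
  cases (inj₁ p) (inj₁ q) = d i j p q (trans (sym (nth-++ˡ xs _ p)) (trans eq (nth-++ˡ xs _ q)))
  cases (inj₁ p) (inj₂ q) = contradiction (i , p , trans (sym (nth-++ˡ xs _ p)) (trans eq (last q))) x∉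
  cases (inj₂ p) (inj₁ q) = contradiction (j , q , trans (sym (nth-++ˡ xs _ q)) (trans (sym eq) (last p))) x∉
  cases (inj₂ p) (inj₂ q) = trans p (sym q)

-- Atomic types and embeddings

module _ {L : Language} where
  open Language L

  private
    variable
      n m : ℕ

  sat-refl : {A : Structure L} {a : Vec ∣ A ∣ n} → SameAtomicType A A a a
  sat-refl ψ = mk⇔ (λ s → s) (λ s → s)

  sat-sym : {A B : Structure L} {a : Vec ∣ A ∣ n} {b : Vec ∣ B ∣ n} →
    SameAtomicType A B a b → SameAtomicType B A b a
  sat-sym same ψ = mk⇔ (from (same ψ)) (to (same ψ))

  sat-trans : {A B C : Structure L} {a : Vec ∣ A ∣ n} {b : Vec ∣ B ∣ n} {c : Vec ∣ C ∣ n} →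
    SameAtomicType A B a b → SameAtomicType B C b c → SameAtomicType A C a c
  sat-trans same same′ ψ = mk⇔ (to (same′ ψ) ∘ to (same ψ)) (from (same ψ) ∘ from (same′ ψ))

  module _ (A : Structure L) where
    private
      module A = Structure A
      module S = Setoid (setoid′ A)

    mutual
      value-cong : {a b : Vec ∣ A ∣ n} → Pointwise A._≈_ a b → ∀ τ → value A a τ A.≈ value A b τ
      value-cong a≈b (var i)    = Pointwise.lookup a≈b i
      value-cong a≈b (app F τs) = A.fun-cong F (values-cong a≈b τs)

      values-cong : {a b : Vec ∣ A ∣ n} → Pointwise A._≈_ a b →
        ∀ (τs : Vec (Term n) m) → Pointwise A._≈_ (values A a τs) (values A b τs)
      values-cong a≈b []       = []
      values-cong a≈b (τ ∷ τs) = value-cong a≈b τ ∷ values-cong a≈b τs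

    sat-≈ : {a b : Vec ∣ A ∣ n} → Pointwise A._≈_ a b → SameAtomicType A A a b
    sat-≈ a≈b (τ ≐ υ) = mk⇔
      (λ eq → S.trans (S.sym (value-cong a≈b τ)) (S.trans eq (value-cong a≈b υ)))
      (λ eq → S.trans (value-cong a≈b τ) (S.trans eq (S.sym (value-cong a≈b υ))))
    sat-≈ a≈b (relᵃ R τs) = mk⇔ (A.rel-resp R (values-cong a≈b τs))
      (A.rel-resp R (Pointwise.sym S.sym (values-cong a≈b τs)))

    values-vars : (a : Vec ∣ A ∣ n) (is : Vec (Fin n) m) → values A a (map var is) ≡ map (lookup a) is
    values-vars a []       = refl
    values-vars a (i ∷ is) = cong (lookup a i ∷_) (values-vars a is)

    module _ (a : Vec ∣ A ∣ n) where
      mutual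
        cl⇒term : ∀ {x} → cl A a x → Σ[ τ ∈ Term n ] value A a τ A.≈ x
        cl⇒term (cl-gen i)         = var i , S.refl
        cl⇒term (cl-fun F xs all)  = app F (proj₁ (all⇒terms all)) , A.fun-cong F (proj₂ (all⇒terms all))
        cl⇒term (cl-resp x≈y x∈)   = proj₁ (cl⇒term x∈) , S.trans (proj₂ (cl⇒term x∈)) x≈y

        all⇒terms : {xs : Vec ∣ A ∣ m} → Allᵛ.All (cl A a) xs →
          Σ[ τs ∈ Vec (Term n) m ] Pointwise A._≈_ (values A a τs) xs
        all⇒terms []         = [] , []
        all⇒terms (x∈ ∷ xs∈) = proj₁ (cl⇒term x∈) ∷ proj₁ (all⇒terms xs∈)
                             , proj₂ (cl⇒term x∈) ∷ proj₂ (all⇒terms xs∈)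

      mutual
        term∈cl : ∀ τ → cl A a (value A a τ)
        term∈cl (var i)    = cl-gen i
        term∈cl (app F τs) = cl-fun F _ (terms∈cl τs)

        terms∈cl : (τs : Vec (Term n) m) → Allᵛ.All (cl A a) (values A a τs)
        terms∈cl []       = []
        terms∈cl (τ ∷ τs) = term∈cl τ ∷ terms∈cl τs

    cl-mono : {a : Vec ∣ A ∣ n} {b : Vec ∣ A ∣ m} → Allᵛ.All (cl A b) a → ∀ {x} → cl A a x → cl A b x
    cl-mono* : ∀ {k} {a : Vec ∣ A ∣ n} {b : Vec ∣ A ∣ m} → Allᵛ.All (cl A b) a →
      {xs : Vec ∣ A ∣ k} → Allᵛ.All (cl A a) xs → Allᵛ.All (cl A b) xs
    cl-mono a∈ (cl-gen i)        = Allᵛ.lookup a∈ (∈-lookup i _)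
    cl-mono a∈ (cl-fun F xs xs∈) = cl-fun F xs (cl-mono* a∈ xs∈)
    cl-mono a∈ (cl-resp x≈y x∈)  = cl-resp x≈y (cl-mono a∈ x∈)
    cl-mono* a∈ []         = []
    cl-mono* a∈ (x∈ ∷ xs∈) = cl-mono a∈ x∈ ∷ cl-mono* a∈ xs∈

  module _ (A B : Structure L) (f : ∣ A ∣ → ∣ B ∣)
           (f-cong : ∀ {x y} → Structure._≈_ A x y → Structure._≈_ B (f x) (f y))
           (f-inj : ∀ {x y} → Structure._≈_ B (f x) (f y) → Structure._≈_ A x y)
           (hom : IsStrongHom A B f) (a : Vec ∣ A ∣ n) where
    private
      module A = Structure A
      module B = Structure B
      module S = Setoid (setoid′ B)
    open IsStrongHom hom

    mutual
      hom-value : ∀ τ → f (value A a τ) B.≈ value B (map f a) τ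
      hom-value (var i)    = S.reflexive (sym (lookup-map i f a))
      hom-value (app F τs) = S.trans (fun-hom F _) (B.fun-cong F (hom-values τs))

      hom-values : (τs : Vec (Term n) m) → Pointwise B._≈_ (map f (values A a τs)) (values B (map f a) τs)
      hom-values []       = []
      hom-values (τ ∷ τs) = hom-value τ ∷ hom-values τs

    sat-hom : SameAtomicType A B a (map f a)
    sat-hom (τ ≐ υ) = mk⇔
      (λ eq → S.trans (S.sym (hom-value τ)) (S.trans (f-cong eq) (hom-value υ)))
      (λ eq → f-inj (S.trans (hom-value τ) (S.trans eq (S.sym (hom-value υ)))))
    sat-hom (relᵃ R τs) = mk⇔
      (B.rel-resp R (hom-values τs) ∘ to (rel-hom R _))
      (from (rel-hom R _) ∘ B.rel-resp R (Pointwise.sym S.sym (hom-values τs)))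

  sat-embedding : {A B : Structure L} (f : Embedding A B) (a : Vec ∣ A ∣ n) →
    SameAtomicType A B a (map (Embedding.to f) a)
  sat-embedding {A = A} {B} f = sat-hom A B (Embedding.to f)
    (Injection.cong (Embedding.injection f)) (Injection.injective (Embedding.injection f)) (Embedding.isStrongHom f)

  -- A tuple of the same atomic type as a generating tuple determines an
  -- embedding, mapping the value of a term to the value of the same term.

  module _ {A B : Structure L} {a : Vec ∣ A ∣ n} {b : Vec ∣ B ∣ n}
           (gen : GeneratedBy A a) (same : SameAtomicType A B a b) where
    private
      module A = Structure A
      module B = Structure B
      module SA = Setoid (setoid′ A)
      module SB = Setoid (setoid′ B)

      term : ∀ x → Σ[ τ ∈ Term n ] value A a τ A.≈ x
      term x = cl⇒term A a (gen x)

      extend : ∣ A ∣ → ∣ B ∣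
      extend x = value B b (proj₁ (term x))

      extend-value : ∀ {x} τ → value A a τ A.≈ x → extend x B.≈ value B b τ
      extend-value {x} τ eq = to (same (proj₁ (term x) ≐ τ)) (SA.trans (proj₂ (term x)) (SA.sym eq))

      extend-values : ∀ {xs : Vec ∣ A ∣ m} (τs : Vec (Term n) m) → Pointwise A._≈_ (values A a τs) xs →
        Pointwise B._≈_ (map extend xs) (values B b τs)
      extend-values []       []         = []
      extend-values (τ ∷ τs) (eq ∷ eqs) = extend-value τ eq ∷ extend-values τs eqs

      terms : (xs : Vec ∣ A ∣ m) → Σ[ τs ∈ Vec (Term n) m ] Pointwise A._≈_ (values A a τs) xs
      terms []       = [] , []
      terms (x ∷ xs) = proj₁ (term x) ∷ proj₁ (terms xs) , proj₂ (term x) ∷ proj₂ (terms xs)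

      extend-cong : ∀ {x y} → x A.≈ y → extend x B.≈ extend y
      extend-cong {x} {y} x≈y = extend-value (proj₁ (term y)) (SA.trans (proj₂ (term y)) (SA.sym x≈y))

      extend-injective : ∀ {x y} → extend x B.≈ extend y → x A.≈ y
      extend-injective {x} {y} eq = SA.trans (SA.sym (proj₂ (term x)))
        (SA.trans (from (same (proj₁ (term x) ≐ proj₁ (term y))) eq) (proj₂ (term y)))

      extend-hom : IsStrongHom A B extend
      extend-hom = record
        { fun-hom = λ F xs → let τs , eqs = terms xs in
            SB.trans (extend-value (app F τs) (A.fun-cong F eqs)) (SB.sym (B.fun-cong F (extend-values τs eqs)))
        ; rel-hom = λ R xs → let τs , eqs = terms xs in mk⇔
            (λ r → B.rel-resp R (Pointwise.sym SB.sym (extend-values τs eqs))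
              (to (same (relᵃ R τs)) (A.rel-resp R (Pointwise.sym SA.sym eqs) r)))
            (λ r → A.rel-resp R eqs
              (from (same (relᵃ R τs)) (B.rel-resp R (extend-values τs eqs) r)))
        }

    generated-embedding : Embedding A B
    generated-embedding = record
      { injection = record { to = extend ; cong = extend-cong ; injective = extend-injective }
      ; isStrongHom = extend-hom
      }

    generated-embedding-gens : ∀ i → Embedding.to generated-embedding (lookup a i) B.≈ lookup b i
    generated-embedding-gens i = extend-value (var i) SA.refl

    generated-iso : GeneratedBy B b → A ≅ B
    generated-iso gen′ = record
      { bijection = record
        { to = extend ; cong = extend-cong
        ; bijective = extend-injective , λ y → let τ , eq = cl⇒term B b (gen′ y) in
            value A a τ , λ z≈ → SB.trans (extend-value τ (SA.sym z≈)) eq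
        }
      ; isStrongHom = extend-hom
      }

  strongHom-∘ : {A B C : Structure L} {f : ∣ A ∣ → ∣ B ∣} {g : ∣ B ∣ → ∣ C ∣} →
    (∀ {x y} → Structure._≈_ B x y → Structure._≈_ C (g x) (g y)) →
    IsStrongHom A B f → IsStrongHom B C g → IsStrongHom A C (g ∘ f)
  strongHom-∘ {A} {B} {C} {f} {g} g-cong hf hg = record
    { fun-hom = λ F xs → S.trans (g-cong (fun-hom hf F xs))
        (S.trans (fun-hom hg F (map f xs)) (S.reflexive (cong (Structure.fun C F) (map-∘′ xs))))
    ; rel-hom = λ R xs → mk⇔
        (subst (Structure.rel C R) (map-∘′ xs) ∘ to (rel-hom hg R (map f xs)) ∘ to (rel-hom hf R xs))
        (from (rel-hom hf R xs) ∘ from (rel-hom hg R (map f xs)) ∘ subst (Structure.rel C R) (sym (map-∘′ xs)))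
    }
    where
    open IsStrongHom
    module S = Setoid (setoid′ C)
    map-∘′ : (xs : Vec ∣ A ∣ m) → map g (map f xs) ≡ map (g ∘ f) xs
    map-∘′ xs = sym (map-∘ g f xs)

  infixr 9 _∘ₑ_
  _∘ₑ_ : {A B C : Structure L} → Embedding B C → Embedding A B → Embedding A C
  g ∘ₑ f = record
    { injection   = Comp.injection (Embedding.injection f) (Embedding.injection g)
    ; isStrongHom = strongHom-∘ (Injection.cong (Embedding.injection g))
        (Embedding.isStrongHom f) (Embedding.isStrongHom g)
    }

  ≅-trans : {A B C : Structure L} → A ≅ B → B ≅ C → A ≅ C
  ≅-trans f g = record
    { bijection   = Comp.bijection (_≅_.bijection f) (_≅_.bijection g)
    ; isStrongHom = strongHom-∘ (Bijection.cong (_≅_.bijection g)) (_≅_.isStrongHom f) (_≅_.isStrongHom g)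
    }

  ≅⇒embedding : {A B : Structure L} → A ≅ B → Embedding A B
  ≅⇒embedding f = record
    { injection   = Bijection.injection (_≅_.bijection f)
    ; isStrongHom = _≅_.isStrongHom f
    }

  module _ (ρ : Vec (Fin n) m) where
    rename : Term {L} m → Term {L} n
    renames : ∀ {k} → Vec (Term {L} m) k → Vec (Term {L} n) k
    rename (var i)    = var (lookup ρ i)
    rename (app F τs) = app F (renames τs)
    renames []        = []
    renames (τ ∷ τs)  = rename τ ∷ renames τs

    value-rename : ∀ (C : Structure L) (c : Vec ∣ C ∣ n) τ → value C (map (lookup c) ρ) τ ≡ value C c (rename τ)
    values-rename : ∀ (C : Structure L) (c : Vec ∣ C ∣ n) {k} (τs : Vec (Term {L} m) k) →
      values C (map (lookup c) ρ) τs ≡ values C c (renames τs)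
    value-rename C c (var i)     = lookup-map i (lookup c) ρ
    value-rename C c (app F τs)  = cong (Structure.fun C F) (values-rename C c τs)
    values-rename C c []         = refl
    values-rename C c (τ ∷ τs)   = cong₂ _∷_ (value-rename C c τ) (values-rename C c τs)

    renameᵃ : Atomic {L} m → Atomic {L} n
    renameᵃ (τ ≐ υ)     = rename τ ≐ rename υ
    renameᵃ (relᵃ R τs) = relᵃ R (renames τs)

    satisfies-rename : ∀ (C : Structure L) (c : Vec ∣ C ∣ n) ψ →
      Satisfies C (map (lookup c) ρ) ψ ≡ Satisfies C c (renameᵃ ψ)
    satisfies-rename C c (τ ≐ υ)     = cong₂ (Structure._≈_ C) (value-rename C c τ) (value-rename C c υ)
    satisfies-rename C c (relᵃ R τs) = cong (Structure.rel C R) (values-rename C c τs)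

    -- An atomic formula about the reindexed tuple is the formula with renamed variables about the
    -- original one.
    sat-reindex : {A B : Structure L} {a : Vec ∣ A ∣ n} {b : Vec ∣ B ∣ n} →
      SameAtomicType A B a b → SameAtomicType A B (map (lookup a) ρ) (map (lookup b) ρ)
    sat-reindex {A} {B} {a} {b} same ψ rewrite satisfies-rename A a ψ | satisfies-rename B b ψ =
      same (renameᵃ ψ)

  module _ (A : Structure L) {n} (a : Vec ∣ A ∣ n) where

    generatedBy : Substructure A
    generatedBy = record { member = cl A a ; resp = cl-resp ; closed = cl-fun }

  module _ {A : Structure L} (S : Substructure A) where

    inclusion : Embedding (substructure A S) A
    inclusion = record
      { injection = record { to = proj₁ ; cong = λ eq → eq ; injective = λ eq → eq }
      ; isStrongHom = record { fun-hom = λ F xs → Setoid.refl (setoid′ A) ; rel-hom = λ R xs → mk⇔ (λ r → r) (λ r → r) }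
      }

  module _ (A : Structure L) {n} (a : Vec ∣ A ∣ n) where
    private
      module A = Structure A
      module S = Setoid (setoid′ A)
      B = substructure A (generatedBy A a)

    generators : Vec ∣ B ∣ n
    generators = tabulate (λ i → lookup a i , cl-gen i)

    private
      pack : {xs : Vec ∣ A ∣ m} → Allᵛ.All (cl A a) xs → Σ[ ys ∈ Vec ∣ B ∣ m ] map proj₁ ys ≡ xs
      pack []         = [] , refl
      pack (x∈ ∷ xs∈) = (_ , x∈) ∷ proj₁ (pack xs∈) , cong (_ ∷_) (proj₂ (pack xs∈))

      pack∈ : ∀ {x} (x∈ : cl A a x) → cl B generators (x , x∈)
      packs∈ : {xs : Vec ∣ A ∣ m} (xs∈ : Allᵛ.All (cl A a) xs) → Allᵛ.All (cl B generators) (proj₁ (pack xs∈))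
      pack∈ (cl-gen i) = cl-resp (S.reflexive (cong proj₁ (lookup∘tabulate (λ i → lookup a i , cl-gen i) i)))
        (cl-gen i)
      pack∈ (cl-fun F xs xs∈) = cl-resp (S.reflexive (cong (A.fun F) (proj₂ (pack xs∈))))
        (cl-fun F (proj₁ (pack xs∈)) (packs∈ xs∈))
      pack∈ (cl-resp x≈y x∈) = cl-resp x≈y (pack∈ x∈)
      packs∈ []         = []
      packs∈ (x∈ ∷ xs∈) = pack∈ x∈ ∷ packs∈ xs∈

    generators-generate : GeneratedBy B generators
    generators-generate (x , x∈) = pack∈ x∈

    generated-fg : FinitelyGenerated B
    generated-fg = n , generators , generators-generate

    sat-generators : SameAtomicType B A generators a
    sat-generators = subst (SameAtomicType B A generators)
      (trans (sym (tabulate-∘ proj₁ (λ i → lookup a i , cl-gen i))) (tabulate∘lookup a))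
      (sat-embedding (inclusion (generatedBy A a)) generators)

-- Atomic types of tuples given as lists of numbers

module _ {L : Language} where
  open Language L

  raw : (𝓜 : ωStructure L) {n : ℕ} → Vec ∣ ⟦ 𝓜 ⟧ ∣ n → List ℕ
  raw 𝓜 a = toList (map proj₁ a)

  module _ (𝓜 : ωStructure L) where
    private
      variable
        n m : ℕ

    code≡encode : (a : Vec ∣ ⟦ 𝓜 ⟧ ∣ n) → code 𝓜 a ≡ encode (raw 𝓜 a)
    code≡encode a = codeᵛ≡encode (map proj₁ a)

    length-raw : (a : Vec ∣ ⟦ 𝓜 ⟧ ∣ n) → length (raw 𝓜 a) ≡ n
    length-raw a = length-toList (map proj₁ a)

    raw⁻ : (a b : Vec ∣ ⟦ 𝓜 ⟧ ∣ n) → raw 𝓜 a ≡ raw 𝓜 b → Pointwise (Structure._≈_ ⟦ 𝓜 ⟧) a b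
    raw⁻ []      []      _  = []
    raw⁻ (x ∷ a) (y ∷ b) eq =
      let eq₁ , eq₂ = ∷-injective eq in eq₁ ∷ raw⁻ a b eq₂

    raw⁺ : {a b : Vec ∣ ⟦ 𝓜 ⟧ ∣ n} → Pointwise (Structure._≈_ ⟦ 𝓜 ⟧) a b → raw 𝓜 a ≡ raw 𝓜 b
    raw⁺ []         = refl
    raw⁺ (eq ∷ eqs) = cong₂ _∷_ eq (raw⁺ eqs)

    nth-raw : (a : Vec ∣ ⟦ 𝓜 ⟧ ∣ n) (i : Fin n) → nth (raw 𝓜 a) (toℕ i) ≡ proj₁ (lookup a i)
    nth-raw (x ∷ a) Fin.zero    = refl
    nth-raw (x ∷ a) (Fin.suc i) = nth-raw a i

    raw-reindex : (a : Vec ∣ ⟦ 𝓜 ⟧ ∣ n) (ρ : Vec (Fin n) m) →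
      raw 𝓜 (map (lookup a) ρ) ≡ raw 𝓜 a ⟨$⟩ toList (map toℕ ρ)
    raw-reindex a []      = refl
    raw-reindex a (i ∷ ρ) = cong₂ _∷_ (sym (nth-raw a i)) (raw-reindex a ρ)

  -- Tuples are lists of numbers here, so that membership proofs play no role.

  record SameType (𝓐 𝓑 : ωStructure L) (xs ys : List ℕ) : Set where
    constructor mkSameType
    field
      {size} : ℕ
      tuple₁ : Vec ∣ ⟦ 𝓐 ⟧ ∣ size
      tuple₂ : Vec ∣ ⟦ 𝓑 ⟧ ∣ size
      raw₁   : raw 𝓐 tuple₁ ≡ xs
      raw₂   : raw 𝓑 tuple₂ ≡ ys
      same   : SameAtomicType ⟦ 𝓐 ⟧ ⟦ 𝓑 ⟧ tuple₁ tuple₂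

  private
    variable
      𝓐 𝓑 𝓒 : ωStructure L
      xs ys zs : List ℕ

  ≃-sym : SameType 𝓐 𝓑 xs ys → SameType 𝓑 𝓐 ys xs
  ≃-sym {𝓐} {𝓑} (mkSameType a b eqa eqb s) = mkSameType b a eqb eqa (sat-sym {A = ⟦ 𝓐 ⟧} {⟦ 𝓑 ⟧} s)

  -- The two middle tuples list the same numbers but may carry different membership proofs. They are
  -- equal in the setoid, and `sat-≈` bridges the difference.
  ≃-trans : SameType 𝓐 𝓑 xs ys → SameType 𝓑 𝓒 ys zs → SameType 𝓐 𝓒 xs zs
  ≃-trans {𝓐 = 𝓐} {𝓑 = 𝓑} {𝓒 = C} (mkSameType a b eqa eqb s) (mkSameType b′ c eqb′ eqc s′)
    with refl ← trans (sym (length-raw 𝓑 b)) (trans (cong length (trans eqb (sym eqb′))) (length-raw 𝓑 b′)) =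
    mkSameType a c eqa eqc (sat-trans {A = ⟦ 𝓐 ⟧} {⟦ 𝓑 ⟧} {⟦ C ⟧} s
      (sat-trans {A = ⟦ 𝓑 ⟧} {⟦ 𝓑 ⟧} {⟦ C ⟧} (sat-≈ ⟦ 𝓑 ⟧ (raw⁻ 𝓑 b b′ (trans eqb (sym eqb′)))) s′))

  ≃-refl : {n : ℕ} (a : Vec ∣ ⟦ 𝓐 ⟧ ∣ n) → SameType 𝓐 𝓐 (raw 𝓐 a) (raw 𝓐 a)
  ≃-refl {𝓐} a = mkSameType a a refl refl (sat-refl {A = ⟦ 𝓐 ⟧})

  -- A list having its own type in a structure means that its entries belong to the domain. Validity
  -- of tuples is expressed in this way throughout.
  ≃-valid₂ : SameType 𝓐 𝓑 xs ys → SameType 𝓑 𝓑 ys ys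
  ≃-valid₂ s = ≃-trans (≃-sym s) s

  ≃-length : SameType 𝓐 𝓑 xs ys → length xs ≡ length ys
  ≃-length {𝓐} {𝓑} (mkSameType a b refl refl _) = trans (length-raw 𝓐 a) (sym (length-raw 𝓑 b))

  ≃-reindex : SameType 𝓐 𝓑 xs ys → ∀ ρ → InRange (length xs) ρ → SameType 𝓐 𝓑 (xs ⟨$⟩ ρ) (ys ⟨$⟩ ρ)
  ≃-reindex {𝓐} {𝓑} (mkSameType a b refl refl s) ρ ρ<
    with ρ′ , eq ← finPositions ρ (subst (λ n → InRange n ρ) (length-raw 𝓐 a) ρ<) =
    mkSameType (map (lookup a) ρ′) (map (lookup b) ρ′)
      (trans (raw-reindex 𝓐 a ρ′) (cong (raw 𝓐 a ⟨$⟩_) eq))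
      (trans (raw-reindex 𝓑 b ρ′) (cong (raw 𝓑 b ⟨$⟩_) eq))
      (sat-reindex ρ′ {⟦ 𝓐 ⟧} {⟦ 𝓑 ⟧} s)

  ≃-nth : SameType 𝓐 𝓑 xs ys → ∀ {i j} → i < length xs → j < length xs →
    nth xs i ≡ nth xs j → nth ys i ≡ nth ys j
  ≃-nth {𝓐} {𝓑} (mkSameType {n} a b refl refl s) {i} {j} i< j< eq =
    trans (sym (at 𝓑 b i i<n)) (trans (to (s (var (fromℕ< i<n) ≐ var (fromℕ< j<n)))
      (trans (at 𝓐 a i i<n) (trans eq (sym (at 𝓐 a j j<n))))) (at 𝓑 b j j<n))
    where
    i<n = subst (i <_) (length-raw 𝓐 a) i<
    j<n = subst (j <_) (length-raw 𝓐 a) j<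
    at : ∀ (𝓒 : ωStructure L) (c : Vec ∣ ⟦ 𝓒 ⟧ ∣ n) i (i< : i < n) → proj₁ (lookup c (fromℕ< i<)) ≡ nth (raw 𝓒 c) i
    at 𝓒 c i i< = trans (sym (nth-raw 𝓒 c (fromℕ< i<))) (cong (nth (raw 𝓒 c)) (toℕ-fromℕ< i<))

  private
    vars : ∀ {n} → Vec (Term {L} n) n
    vars {n} = map var (Vec.allFin n)

    values-allVars : ∀ {n} (A : Structure L) (a : Vec ∣ A ∣ n) → values A a vars ≡ a
    values-allVars {n} A a = trans (values-vars A a (Vec.allFin n)) (map-lookup-allFin a)

    sat-rel : ∀ {A B : Structure L} R {a b} → SameAtomicType A B a b → Structure.rel A R a ⇔ Structure.rel B R b
    sat-rel {A} {B} R {a} {b} s = mk⇔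
      (subst (Structure.rel B R) (values-allVars B b) ∘ to (s (relᵃ R vars)) ∘
       subst (Structure.rel A R) (sym (values-allVars A a)))
      (subst (Structure.rel A R) (values-allVars A a) ∘ from (s (relᵃ R vars)) ∘
       subst (Structure.rel B R) (sym (values-allVars B b)))

  retype : (s : SameType 𝓐 𝓑 xs ys) → ∀ {n} (a : Vec ∣ ⟦ 𝓐 ⟧ ∣ n) → raw 𝓐 a ≡ xs →
    Σ[ b ∈ Vec ∣ ⟦ 𝓑 ⟧ ∣ n ] (raw 𝓑 b ≡ ys × SameAtomicType ⟦ 𝓐 ⟧ ⟦ 𝓑 ⟧ a b)
  retype {𝓐} {𝓑} (mkSameType a′ b eqa eqb s) a eq
    with refl ← trans (sym (length-raw 𝓐 a)) (trans (cong length (trans eq (sym eqa))) (length-raw 𝓐 a′)) =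
    b , eqb , sat-trans {A = ⟦ 𝓐 ⟧} {⟦ 𝓐 ⟧} {⟦ 𝓑 ⟧} (sat-≈ ⟦ 𝓐 ⟧ (raw⁻ 𝓐 a a′ (trans eq (sym eqa)))) s

  ≃-same : ∀ {n} (a : Vec ∣ ⟦ 𝓐 ⟧ ∣ n) (b : Vec ∣ ⟦ 𝓑 ⟧ ∣ n) →
    SameType 𝓐 𝓑 (raw 𝓐 a) (raw 𝓑 b) → SameAtomicType ⟦ 𝓐 ⟧ ⟦ 𝓑 ⟧ a b
  ≃-same {𝓐} {𝓑} a b s = let b′ , eq , s′ = retype s a refl in
    sat-trans {A = ⟦ 𝓐 ⟧} {⟦ 𝓑 ⟧} {⟦ 𝓑 ⟧} s′ (sat-≈ ⟦ 𝓑 ⟧ (raw⁻ 𝓑 b′ b eq))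

  ≃-rel : ∀ {r} → SameType 𝓐 𝓑 xs ys → RelDiagram 𝓐 ⟨ r , encode xs ⟩ → RelDiagram 𝓑 ⟨ r , encode ys ⟩
  ≃-rel {𝓐} {𝓑} {xs} {ys} {r} s (R , a , eq , ra) =
    let eq-r , eq-a = pair-injective {r} {encode xs} {proj₁ R} {code 𝓐 a} eq
        b , eq-b , s′ = retype s a (encode-injective (trans (sym (code≡encode 𝓐 a)) (sym eq-a)))
    in R , b , cong₂ ⟨_,_⟩ eq-r (trans (cong encode (sym eq-b)) (sym (code≡encode 𝓑 b)))
     , to (sat-rel R s′) ra

  ≃-neg : ∀ {r} → SameType 𝓐 𝓑 xs ys → NegRelDiagram 𝓐 ⟨ r , encode xs ⟩ → NegRelDiagram 𝓑 ⟨ r , encode ys ⟩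
  ≃-neg {𝓐} {𝓑} {xs} {ys} {r} s (R , a , eq , ¬ra) =
    let eq-r , eq-a = pair-injective {r} {encode xs} {proj₁ R} {code 𝓐 a} eq
        b , eq-b , s′ = retype s a (encode-injective (trans (sym (code≡encode 𝓐 a)) (sym eq-a)))
    in R , b , cong₂ ⟨_,_⟩ eq-r (trans (cong encode (sym eq-b)) (sym (code≡encode 𝓑 b)))
     , ¬ra ∘ from (sat-rel R s′)

  -- With the value placed in front of the arguments, the graph of a function is the atomic
  -- condition `var Fin.zero ≐ app F later`, where `later` lists the remaining variables.
  ≃-fun : ∀ {r x y} → SameType 𝓐 𝓑 (x ∷ xs) (y ∷ ys) →
    FunDiagram 𝓐 ⟨ r , ⟨ encode xs , x ⟩ ⟩ → FunDiagram 𝓑 ⟨ r , ⟨ encode ys , y ⟩ ⟩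
  ≃-fun {𝓐} {𝓑} {xs} {ys} {r} {x} {y} s (F , a , eq) =
    let eq-r , eq′ = pair-injective {r} {⟨ encode xs , x ⟩} {proj₁ F} {⟨ code 𝓐 a , proj₁ (Structure.fun ⟦ 𝓐 ⟧ F a) ⟩} eq
        eq-a , eq-x = pair-injective {encode xs} {x} {code 𝓐 a} {proj₁ (Structure.fun ⟦ 𝓐 ⟧ F a)} eq′
        b , eq-b , s′ = retype s (Structure.fun ⟦ 𝓐 ⟧ F a ∷ a)
          (cong₂ _∷_ (sym eq-x) (encode-injective (trans (sym (code≡encode 𝓐 a)) (sym eq-a))))
    in finish eq-r b eq-b s′
    where
    finish : ∀ {F a} → r ≡ proj₁ F → (b : Vec ∣ ⟦ 𝓑 ⟧ ∣ (suc (arityᶠ F))) → raw 𝓑 b ≡ y ∷ ys →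
      SameAtomicType ⟦ 𝓐 ⟧ ⟦ 𝓑 ⟧ (Structure.fun ⟦ 𝓐 ⟧ F a ∷ a) b → FunDiagram 𝓑 ⟨ r , ⟨ encode ys , y ⟩ ⟩
    finish {F} {a} eq-r (z ∷ b) refl s′ = F , b , cong₂ ⟨_,_⟩ eq-r (cong₂ ⟨_,_⟩ (sym (code≡encode 𝓑 b)) z≡)
      where
      later = map (λ i → var {n = suc (arityᶠ F)} (Fin.suc i)) (Vec.allFin (arityᶠ F))
      values-later : ∀ (A : Structure L) (z : ∣ A ∣) (b : Vec ∣ A ∣ (arityᶠ F)) → values A (z ∷ b) later ≡ b
      values-later A z b = trans (go (Vec.allFin _)) (map-lookup-allFin b)
        where
        go : ∀ {m} (is : Vec (Fin (arityᶠ F)) m) → values A (z ∷ b) (map (λ i → var (Fin.suc i)) is) ≡ map (lookup b) is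
        go []       = refl
        go (i ∷ is) = cong (lookup b i ∷_) (go is)
      z≡ : proj₁ z ≡ proj₁ (Structure.fun ⟦ 𝓑 ⟧ F b)
      z≡ = trans (to (s′ (var Fin.zero ≐ app F later))
          (cong (λ v → proj₁ (Structure.fun ⟦ 𝓐 ⟧ F v)) (sym (values-later ⟦ 𝓐 ⟧ _ a))))
        (cong (λ v → proj₁ (Structure.fun ⟦ 𝓑 ⟧ F v)) (values-later ⟦ 𝓑 ⟧ z b))

  ≃-embedding : (f : Embedding ⟦ 𝓐 ⟧ ⟦ 𝓑 ⟧) {n : ℕ} (a : Vec ∣ ⟦ 𝓐 ⟧ ∣ n) →
    SameType 𝓐 𝓑 (raw 𝓐 a) (raw 𝓑 (map (Embedding.to f) a))
  ≃-embedding f a = mkSameType a (map (Embedding.to f) a) refl refl (sat-embedding f a)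

module _ {L : Language} {𝓐 𝓑 : ωStructure L} where

  ≃-⟨$⟩-≡ : ∀ {xs ys} → SameType 𝓐 𝓑 xs ys → ∀ {ρ μ} → InRange (length xs) ρ → InRange (length xs) μ →
    xs ⟨$⟩ ρ ≡ xs ⟨$⟩ μ → ys ⟨$⟩ ρ ≡ ys ⟨$⟩ μ
  ≃-⟨$⟩-≡ s []        []        _  = refl
  ≃-⟨$⟩-≡ s (i< ∷ ρ<) (j< ∷ μ<) eq =
    let eq₁ , eq₂ = ∷-injective eq in cong₂ _∷_ (≃-nth s i< j< eq₁) (≃-⟨$⟩-≡ s ρ< μ< eq₂)

  ≃-distinct : ∀ {xs ys} → SameType 𝓐 𝓑 xs ys → Distinct xs → Distinct ys
  ≃-distinct s d i j i< j< eq = d i j (subst (i <_) (sym (≃-length s)) i<) (subst (j <_) (sym (≃-length s)) j<)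
    (≃-nth (≃-sym s) i< j< eq)

module _ {L : Language} {𝓐 : ωStructure L} where

  ++-valid : ∀ {xs ys} → SameType 𝓐 𝓐 xs xs → SameType 𝓐 𝓐 ys ys → SameType 𝓐 𝓐 (xs ++ ys) (xs ++ ys)
  ++-valid (mkSameType a _ refl _ _) (mkSameType b _ refl _ _) =
    subst (λ z → SameType 𝓐 𝓐 z z)
      (trans (cong Vec.toList (map-++ proj₁ a b)) (toList-++ (Vec.map proj₁ a) _)) (≃-refl (a Vec.++ b))

-- Extensions, amalgams and amalgamation bases in terms of tuples

module Types {L : Language} (𝕂 : Enumeration L) where
  open Enumeration 𝕂

  infix 4 _∶_≃_∶_
  _∶_≃_∶_ : ℕ → List ℕ → ℕ → List ℕ → Set
  k ∶ xs ≃ l ∶ ys = SameType (struct k) (struct l) xs ys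

  -- This encodes an embedding into 𝓐ₗ of the structure generated by `b`, together with a tuple `c`
  -- of 𝓐ₗ in which the image of `b` occupies the positions `ρ`.
  Over : ℕ → List ℕ → ℕ → List ℕ → List ℕ → Set
  Over k b l c ρ = InRange (length c) ρ × l ∶ c ≃ l ∶ c × k ∶ b ≃ l ∶ c ⟨$⟩ ρ

  -- Copies `u` of `c` and `v` of `d` inside one structure of the age, glued along the common
  -- subtuple.
  Amalgam : ℕ → List ℕ → List ℕ → ℕ → List ℕ → List ℕ → Set
  Amalgam l c ρ m d μ = ∃[ n ] ∃[ u ] ∃[ v ] (l ∶ c ≃ n ∶ u × m ∶ d ≃ n ∶ v × u ⟨$⟩ ρ ≡ v ⟨$⟩ μ)

  -- The tuple b of 𝓐ₖ generates an amalgamation base. Speaking of tuples only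
  -- makes this Π₂ in the embedding information.

  Base : ℕ → List ℕ → Set
  Base k b = ∀ l c ρ m d μ → Over k b l c ρ → Over k b m d μ → Amalgam l c ρ m d μ

  over-≃ : ∀ {k b k′ b′ l c ρ} → k ∶ b ≃ k′ ∶ b′ → Over k b l c ρ → Over k′ b′ l c ρ
  over-≃ s (ρ< , valid , s′) = ρ< , valid , ≃-trans (≃-sym s) s′

  base-≃ : ∀ {k b l c} → k ∶ b ≃ l ∶ c → Base k b → Base l c
  base-≃ s base l c ρ m d μ o o′ = base l c ρ m d μ (over-≃ (≃-sym s) o) (over-≃ (≃-sym s) o′)

  -- This holds whenever `b` lies in the closure of its subtuple at `ρ`, since terms then fix the
  -- remaining entries of any copy. The formulation by types also covers mere rearrangements without
  -- mentioning terms.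
  Determined : ℕ → List ℕ → List ℕ → Set
  Determined k b ρ = ∀ {n u v} → k ∶ b ≃ n ∶ u → k ∶ b ≃ n ∶ v → u ⟨$⟩ ρ ≡ v ⟨$⟩ ρ → u ≡ v

  -- Two extensions of `b` are extensions of its subtuple, over which they amalgamate. In the
  -- amalgam both copies of `b` agree at `ρ`, hence everywhere.
  base-determined : ∀ {k b} ρ → InRange (length b) ρ → Determined k b ρ → Base k (b ⟨$⟩ ρ) → Base k b
  base-determined {k} {b} ρ ρ< det base l c μ m d ν o o′ =
    let n , u , v , cu , dv , eq = base l c (μ ⟨$⟩ ρ) m d (ν ⟨$⟩ ρ) (restrict o) (restrict o′)
    in n , u , v , cu , dv ,
      det (≃-trans (proj₂ (proj₂ o)) (≃-reindex cu μ (proj₁ o)))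
          (≃-trans (proj₂ (proj₂ o′)) (≃-reindex dv ν (proj₁ o′)))
          (trans (sym (⟨$⟩-assoc u μ ρ (ρ<′ o))) (trans eq (⟨$⟩-assoc v ν ρ (ρ<′ o′))))
    where
    ρ<′ : ∀ {l c μ} → Over k b l c μ → InRange (length μ) ρ
    ρ<′ {l} {c} {μ} (_ , _ , s) = subst (λ n → InRange n ρ) (trans (≃-length s) (length-map (nth c) μ)) ρ<
    restrict : ∀ {l c μ} → Over k b l c μ → Over k (b ⟨$⟩ ρ) l c (μ ⟨$⟩ ρ)
    restrict {l} {c} {μ} o@(μ< , valid , s) = ⟨$⟩-InRange μ ρ μ< (ρ<′ o) , valid ,
      subst (λ z → k ∶ b ⟨$⟩ ρ ≃ l ∶ z) (sym (⟨$⟩-assoc c μ ρ (ρ<′ o))) (≃-reindex s ρ ρ<)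

  over⇒tuple : ∀ {k b l c ρ} → Over k b l c ρ → ∀ {p} (a : Vec ∣ ⟦ struct k ⟧ ∣ p) → raw (struct k) a ≡ b →
    ∃[ n ] Σ[ d ∈ Vec ∣ ⟦ struct l ⟧ ∣ n ] Σ[ ρ′ ∈ Vec (Fin n) p ]
      (raw (struct l) d ≡ c × toList (map toℕ ρ′) ≡ ρ × SameAtomicType ⟦ struct k ⟧ ⟦ struct l ⟧ a (map (lookup d) ρ′))
  over⇒tuple {k} {b} {l} {c} {ρ} (ρ< , mkSameType {n} d _ refl _ _ , s) {p} a refl
    with refl ← trans (sym (length-map (nth c) ρ)) (trans (sym (≃-length s)) (length-raw (struct k) a))
    with ρ′ , eq ← finPositions ρ (subst (λ n → InRange n ρ) (length-raw (struct l) d) ρ<) =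
    n , d , ρ′ , refl , eq , ≃-same a (map (lookup d) ρ′)
      (subst (λ z → k ∶ b ≃ l ∶ z) (sym (trans (raw-reindex (struct l) d ρ′) (cong (raw (struct l) d ⟨$⟩_) eq))) s)

-- Amalgamation properties of the age in terms of tuples

module Amalgamation {L : Language} {K : Pred (Structure L) (lsuc 0ℓ)} (𝕂 : Enumeration L) {ix : ℕ → ℕ}
                    (rep : Represents 𝕂 ∅ ix K) where
  open Enumeration 𝕂
  open Types 𝕂
  open Represents rep

  private
    image-reindex : ∀ {k l} (g : ∣ ⟦ struct k ⟧ ∣ → ∣ ⟦ struct l ⟧ ∣) {n m} (d : Vec ∣ ⟦ struct k ⟧ ∣ n) (ρ : Vec (Fin n) m) →
      raw (struct l) (map g (map (lookup d) ρ)) ≡ raw (struct l) (map g d) ⟨$⟩ toList (map toℕ ρ)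
    image-reindex {l = l} g d ρ = trans
      (cong (raw (struct l)) (trans (sym (map-∘ g (lookup d) ρ)) (mapᵛ-cong (λ i → sym (lookup-map i g d)) ρ)))
      (raw-reindex (struct l) (map g d) ρ)

  base-[] : JEP K → ∀ k → Base k []
  base-[] jep k l c ρ m d μ (_ , mkSameType c′ _ refl _ _ , sc) (_ , mkSameType d′ _ refl _ _ , sd) =
    let C , C∈K , f , g = jep (inAge l) (inAge m)
        n , iso = exhaustive C∈K
        e = ≅⇒embedding iso
        u = raw (struct n) (map (Embedding.to (e ∘ₑ f)) c′)
        v = raw (struct n) (map (Embedding.to (e ∘ₑ g)) d′)
    in n , u , v , ≃-embedding (e ∘ₑ f) c′ , ≃-embedding (e ∘ₑ g) d′
     , trans (cong (u ⟨$⟩_) (empty c ρ (≃-length sc))) (sym (cong (v ⟨$⟩_) (empty d μ (≃-length sd))))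
    where
    empty : ∀ c ρ → 0 ≡ length (c ⟨$⟩ ρ) → ρ ≡ []
    empty c [] _ = refl

  module _ (l : ℕ) (A : Structure L) (base : AmalgamationBase K A) (iso : A ≅ ⟦ struct l ⟧) where
    private
      module A = AmalgamationBase base
      i : Embedding A ⟦ struct l ⟧
      i = ≅⇒embedding iso

    -- Since `a` generates 𝓐ₗ, an equality of types with `a` is an embedding of 𝓐ₗ. Two extensions
    -- over `a` become two embeddings of the base `A`, which amalgamate.
    base-generating : ∀ {n} (a : Vec ∣ ⟦ struct l ⟧ ∣ n) → GeneratedBy ⟦ struct l ⟧ a → Base l (raw (struct l) a)
    base-generating a gen p c ρ q d μ o o′ with over⇒tuple o a refl | over⇒tuple o′ a refl
    ... | _ , c′ , ρ′ , refl , refl , sc | _ , d′ , μ′ , refl , refl , sd =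
      N , _ , _ , ≃-embedding α c′ , ≃-embedding β d′ ,
      trans (sym (image-reindex {p} {N} (Embedding.to α) c′ ρ′))
        (trans (raw⁺ (struct N) (pointwise (map (lookup c′) ρ′) (map (lookup d′) μ′)
          (generated-embedding-gens gen sc) (generated-embedding-gens gen sd)))
          (image-reindex {q} {N} (Embedding.to β) d′ μ′))
      where
      i₁ : Embedding ⟦ struct l ⟧ ⟦ struct p ⟧
      i₁ = generated-embedding gen sc
      i₂ : Embedding ⟦ struct l ⟧ ⟦ struct q ⟧
      i₂ = generated-embedding gen sd
      amalgam = A.amalgamate (inAge p) (inAge q) (i₁ ∘ₑ i) (i₂ ∘ₑ i)
      D = proj₁ amalgam
      N = proj₁ (exhaustive (proj₁ (proj₂ amalgam)))
      e : Embedding D ⟦ struct N ⟧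
      e = ≅⇒embedding (proj₂ (exhaustive (proj₁ (proj₂ amalgam))))
      α : Embedding ⟦ struct p ⟧ ⟦ struct N ⟧
      α = e ∘ₑ proj₁ (proj₂ (proj₂ amalgam))
      β : Embedding ⟦ struct q ⟧ ⟦ struct N ⟧
      β = e ∘ₑ proj₁ (proj₂ (proj₂ (proj₂ amalgam)))
      module α = Injection (Embedding.injection α)
      module β = Injection (Embedding.injection β)
      module i₁ = Injection (Embedding.injection i₁)
      module i₂ = Injection (Embedding.injection i₂)
      agree : ∀ x → proj₁ (α.to (i₁.to x)) ≡ proj₁ (β.to (i₂.to x))
      -- The amalgam commutes on `A`; surjectivity of the isomorphism carries this over to 𝓐ₗ.
      agree x = let y , y↦ = Bijection.surjective (_≅_.bijection iso) x in
        trans (α.cong (i₁.cong (sym (y↦ (Setoid.refl (Structure.setoid′ A))))))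
          (trans (Injection.cong (Embedding.injection e) (proj₂ (proj₂ (proj₂ (proj₂ amalgam))) y))
            (β.cong (i₂.cong (y↦ (Setoid.refl (Structure.setoid′ A))))))
      pointwise : ∀ (v : Vec ∣ ⟦ struct p ⟧ ∣ _) (w : Vec ∣ ⟦ struct q ⟧ ∣ _) →
        (∀ j → proj₁ (i₁.to (lookup a j)) ≡ proj₁ (lookup v j)) →
        (∀ j → proj₁ (i₂.to (lookup a j)) ≡ proj₁ (lookup w j)) →
        Pointwise (Structure._≈_ ⟦ struct N ⟧) (map α.to v) (map β.to w)
      pointwise = go a
        where
        go : ∀ {n} (a : Vec ∣ ⟦ struct l ⟧ ∣ n) v w →
          (∀ j → proj₁ (i₁.to (lookup a j)) ≡ proj₁ (lookup v j)) →
          (∀ j → proj₁ (i₂.to (lookup a j)) ≡ proj₁ (lookup w j)) →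
          Pointwise (Structure._≈_ ⟦ struct N ⟧) (map α.to v) (map β.to w)
        go []      []      []      _  _   = []
        go (x ∷ a) (y ∷ v) (z ∷ w) eq eq′ =
          trans (sym (α.cong (eq Fin.zero))) (trans (agree x) (β.cong (eq′ Fin.zero)))
          ∷ go a v w (eq ∘ Fin.suc) (eq′ ∘ Fin.suc)

  -- CAP embeds 𝓐ₖ into a base, represented by some 𝓐ₗ. Appending the generators of 𝓐ₗ to the image
  -- of `b` yields a tuple that generates all of it, as `base-generating` requires.
  extendToBase : CAP K → ∀ {k b} → k ∶ b ≃ k ∶ b →
    ∃[ l ] ∃[ b′ ] ∃[ c ] (k ∶ b ≃ l ∶ b′ × l ∶ (b′ ++ c) ≃ l ∶ (b′ ++ c) × Base l (b′ ++ c))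
  extendToBase cap {k} (mkSameType a _ refl _ _) =
    l , raw (struct l) (map i₁.to a) , raw (struct l) (gens l) , ≃-embedding i₁ a
    , subst (λ z → l ∶ z ≃ l ∶ z) raw-++ (≃-refl gs)
    , subst (Base l) raw-++ (base-generating l A base iso gs gen)
    where
    A = proj₁ (cap (inAge k))
    base = proj₁ (proj₂ (cap (inAge k)))
    l = proj₁ (exhaustive (AmalgamationBase.inAge base))
    iso = proj₂ (exhaustive (AmalgamationBase.inAge base))
    i₁ = ≅⇒embedding iso ∘ₑ proj₂ (proj₂ (cap (inAge k)))
    module i₁ = Embedding i₁
    gs : Vec ∣ ⟦ struct l ⟧ ∣ _
    gs = map i₁.to a Vec.++ gens l
    gen : GeneratedBy ⟦ struct l ⟧ gs
    gen x = cl-mono ⟦ struct l ⟧ (lookup⁻ {xs = gens l} λ j →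
      cl-resp (cong proj₁ (lookup-++ʳ (map i₁.to a) (gens l) j)) (cl-gen (_ ↑ʳ j))) (generated l x)
    raw-++ : raw (struct l) gs ≡ raw (struct l) (map i₁.to a) ++ raw (struct l) (gens l)
    raw-++ = trans (cong toList (map-++ proj₁ (map i₁.to a) (gens l))) (toList-++ (map proj₁ (map i₁.to a)) _)

-- Halting, decided uniformly in the index

apᵖ : {R : ℕ → ℕ → Set} → RecPred O (Uncurry R) → Rec O f → Rec O g → RecPred O (λ x → R (f x) (g x))
apᵖ {f = f} {g = g} {R = R} p r s = mapᵖ (λ x → mk⇔ (uncurried⁻ R {f x} {g x}) (uncurried⁺ R {f x} {g x})) (p ⊙ᵖ ⟪ r , s ⟫)

⌜⌝-comp : ∀ c e f → ⌜ c ⌝ ≡ ⟨ 6 , ⟨ e , f ⟩ ⟩ → ∃[ d ] ∃[ d′ ] (c ≡ compᶜ d d′ × ⌜ d ⌝ ≡ e × ⌜ d′ ⌝ ≡ f)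
⌜⌝-comp c e f eq = go c (trans (sym (π₁-⌜⌝ c)) (trans (cong π₁ eq) (π₁-pair 6 ⟨ e , f ⟩))) eq
  where
  go : ∀ c → tag c ≡ 6 → ⌜ c ⌝ ≡ ⟨ 6 , ⟨ e , f ⟩ ⟩ → ∃[ d ] ∃[ d′ ] (c ≡ compᶜ d d′ × ⌜ d ⌝ ≡ e × ⌜ d′ ⌝ ≡ f)
  go (compᶜ d d′) _ eq = d , d′ , refl , pair-injective {⌜ d ⌝} {⌜ d′ ⌝} {e} {f}
    (proj₂ (pair-injective {6} {⟨ ⌜ d ⌝ , ⌜ d′ ⌝ ⟩} {6} {⟨ e , f ⟩} eq))

module Halting (em : ExcludedMiddle (lsuc 0ℓ)) where
  open Classical em

  -- The number handed to the jump is that of `compᶜ` of the program `e` with a constant if `e` is a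
  -- Gödel number. Otherwise it is no Gödel number at all and hence lies outside the jump, in
  -- accordance with `e` denoting the empty function.
  haltsᵖ : RecPred (O ′) (Uncurry (Halts O))
  haltsᵖ {O = O} = mapᵖ (λ p → mk⇔ (sound (π₁ p) (π₂ p)) (complete (π₁ p) (π₂ p)))
    (oracle ⊙ᵖ ⟪ rec-const 6 , ⟪ rec-π₁ , rec-⌜const⌝ ⊙ rec-π₂ ⟫ ⟫)
    where
    sound : ∀ e x → (O ′) ⟨ 6 , ⟨ e , ⌜ constᶜ x ⌝ ⟩ ⟩ → Halts O e x
    sound e x (y , c , eq , run) = finish (⌜⌝-comp c e ⌜ constᶜ x ⌝ eq) run
      where
      finish : ∀ {c z} → ∃[ d ] ∃[ d′ ] (c ≡ compᶜ d d′ × ⌜ d ⌝ ≡ e × ⌜ d′ ⌝ ≡ ⌜ constᶜ x ⌝) →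
        O ⊢ c [ z ]⇓ y → Halts O e x
      finish (d , d′ , refl , eq , eq′) run =
        y , d , eq , specialize-correct d x (subst (λ d′ → O ⊢ compᶜ d d′ [ _ ]⇓ y) (⌜⌝-injective eq′) run)
    complete : ∀ e x → Halts O e x → (O ′) ⟨ 6 , ⟨ e , ⌜ constᶜ x ⌝ ⟩ ⟩
    complete e x (y , c , eq , run) = y , compᶜ c (constᶜ x) ,
      cong (λ e → ⟨ 6 , ⟨ e , ⌜ constᶜ x ⌝ ⟩ ⟩) eq , ⇓comp (⇓const x) run

-- What the embedding information and its jumps decide

module Decidability (em : ExcludedMiddle (lsuc 0ℓ)) {L : Language} {K : Pred (Structure L) (lsuc 0ℓ)}
                    (𝕂 : Enumeration L) (ix : ℕ → ℕ) (rep : Represents 𝕂 ∅ ix K) where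
  open Classical em
  open Halting em
  open Enumeration 𝕂
  open Types 𝕂
  open Represents rep

  𝔼 : Pred ℕ 0ℓ
  𝔼 = EI 𝕂 ix

  -- The empty tuple has the same atomic type as itself, which makes the set
  -- of triples recursive in the embedding information.

  private
    IsTriple : ℕ → Set
    IsTriple t = 𝔼 ⟨ t , ⟨ 0 , ⟨ t , 0 ⟩ ⟩ ⟩

    triple-IsTriple : ∀ k → IsTriple (triple 𝕂 ix k)
    triple-IsTriple k = k , k , 0 , [] , [] , refl , sat-refl {A = ⟦ struct k ⟧} {a = []}

    IsTriple⇒triple : ∀ t → IsTriple t → ∃[ k ] t ≡ triple 𝕂 ix k
    IsTriple⇒triple t (k , l , _ , b , c , eq , _) =
      k , proj₁ (pair-injective {t} {⟨ 0 , ⟨ t , 0 ⟩ ⟩} {triple 𝕂 ix k}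
        {⟨ code (struct k) b , ⟨ triple 𝕂 ix l , code (struct l) c ⟩ ⟩} eq)

    last-triple : ∀ k → π₂ (π₂ (triple 𝕂 ix k)) ≡ k
    last-triple k = trans (cong π₂ (π₂-pair (code (struct k) (gens k)) ⟨ ix k , k ⟩)) (π₂-pair (ix k) k)

    triple-injective : ∀ {k l} → triple 𝕂 ix k ≡ triple 𝕂 ix l → k ≡ l
    triple-injective {k} {l} eq = trans (sym (last-triple k)) (trans (cong (π₂ ∘ π₂) eq) (last-triple l))

  -- The last component of a triple determines it, so a search for a triple ending in `k` can only
  -- return that of `k`. In this way 𝔼 also computes `ix`.
  rec-triple : Rec 𝔼 (triple 𝕂 ix)
  rec-triple =
    let t , rec-t , t✓ = choose (λ k t → IsTriple t × π₂ (π₂ t) ≡ k)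
          ((oracle ⊙ᵖ ⟪ rec-π₂ , ⟪ rec-const 0 , ⟪ rec-π₂ , rec-const 0 ⟫ ⟫ ⟫) ×ᵖ
            ((rec-π₂ ⊙ rec-π₂ ⊙ rec-π₂) ≡ᵖ rec-π₁))
          (λ k → triple 𝕂 ix k , triple-IsTriple k , last-triple k)
    in Rec-≗ (λ k → unique k (t k) (t✓ k)) rec-t
    where
    unique : ∀ k t → IsTriple t × π₂ (π₂ t) ≡ k → t ≡ triple 𝕂 ix k
    unique k t (p , eq) = let l , t≡ = IsTriple⇒triple t p in
      trans t≡ (cong (triple 𝕂 ix) (trans (sym (last-triple l)) (trans (cong (π₂ ∘ π₂) (sym t≡)) eq)))

  rec-ix : Rec 𝔼 ix
  rec-ix = Rec-≗ (λ k → trans (cong π₁ (π₂-pair (code (struct k) (gens k)) ⟨ ix k , k ⟩)) (π₁-pair (ix k) k))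
    (rec-π₁ ⊙ rec-π₂ ⊙ rec-triple)

  private
    same⇔ : ∀ k b l c → 𝔼 ⟨ triple 𝕂 ix k , ⟨ b , ⟨ triple 𝕂 ix l , c ⟩ ⟩ ⟩ ⇔ (k ∶ decode b ≃ l ∶ decode c)
    same⇔ k b l c = mk⇔ sound complete
      where
      sound : 𝔼 ⟨ triple 𝕂 ix k , ⟨ b , ⟨ triple 𝕂 ix l , c ⟩ ⟩ ⟩ → k ∶ decode b ≃ l ∶ decode c
      sound (k′ , l′ , n , b′ , c′ , eq , s) =
        let eq-k , eq₁ = pair-injective {triple 𝕂 ix k} {⟨ b , ⟨ triple 𝕂 ix l , c ⟩ ⟩}
              {triple 𝕂 ix k′} {⟨ code (struct k′) b′ , ⟨ triple 𝕂 ix l′ , code (struct l′) c′ ⟩ ⟩} eq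
            eq-b , eq₂ = pair-injective {b} {⟨ triple 𝕂 ix l , c ⟩}
              {code (struct k′) b′} {⟨ triple 𝕂 ix l′ , code (struct l′) c′ ⟩} eq₁
            eq-l , eq-c = pair-injective {triple 𝕂 ix l} {c} {triple 𝕂 ix l′} {code (struct l′) c′} eq₂
        in subst₂ (λ k l → k ∶ decode b ≃ l ∶ decode c) (sym (triple-injective eq-k)) (sym (triple-injective eq-l))
             (mkSameType b′ c′ (raw≡ (struct k′) b′ eq-b) (raw≡ (struct l′) c′ eq-c) s)
        where
        raw≡ : ∀ (𝓜 : ωStructure L) (a : Vec ∣ ⟦ 𝓜 ⟧ ∣ n) {b} → b ≡ code 𝓜 a → raw 𝓜 a ≡ decode b
        raw≡ 𝓜 a eq = encode-injective (trans (sym (code≡encode 𝓜 a)) (trans (sym eq) (sym (encode-decode _))))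
      complete : k ∶ decode b ≃ l ∶ decode c → 𝔼 ⟨ triple 𝕂 ix k , ⟨ b , ⟨ triple 𝕂 ix l , c ⟩ ⟩ ⟩
      complete (mkSameType {n} b′ c′ eq-b eq-c s) = k , l , n , b′ , c′ ,
        cong₂ (λ u v → ⟨ triple 𝕂 ix k , ⟨ u , ⟨ triple 𝕂 ix l , v ⟩ ⟩ ⟩)
          (code≡ (struct k) b′ eq-b) (code≡ (struct l) c′ eq-c) , s
        where
        code≡ : ∀ (𝓜 : ωStructure L) (a : Vec ∣ ⟦ 𝓜 ⟧ ∣ n) {b} → raw 𝓜 a ≡ decode b → b ≡ code 𝓜 a
        code≡ 𝓜 a eq = sym (trans (code≡encode 𝓜 a) (trans (cong encode eq) (encode-decode _)))

  module _ (𝔼≤O : RecPred O (_∈ 𝔼)) where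

    sameᵖ : Rec O f → RecList O F → Rec O g → RecList O G → RecPred O (λ x → f x ∶ F x ≃ g x ∶ G x)
    sameᵖ {f = f} {F = F} {g = g} {G = G} r s t u = mapᵖ
      (λ x → subst₂ (λ b c → 𝔼 ⟨ triple 𝕂 ix (f x) , ⟨ encode (F x) , ⟨ triple 𝕂 ix (g x) , encode (G x) ⟩ ⟩ ⟩ ⇔
          (f x ∶ b ≃ g x ∶ c))
        (decode-encode (F x)) (decode-encode (G x)) (same⇔ (f x) (encode (F x)) (g x) (encode (G x))))
      (𝔼≤O ⊙ᵖ ⟪ T ⊙ r , ⟪ encoded s , ⟪ T ⊙ t , encoded u ⟫ ⟫ ⟫)
      where T = relativize 𝔼≤O rec-triple

    overᵖ : Rec O f → RecList O F → Rec O g → RecList O G → RecList O G″ →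
      RecPred O (λ x → Over (f x) (F x) (g x) (G x) (G″ x))
    overᵖ r s t u v = inRangeᵖ (rec-length u) v ×ᵖ sameᵖ t u t u ×ᵖ sameᵖ r s t (rec-⟨$⟩ u v)

  private
    amalgamᵖ : Rec 𝔼 f → RecList 𝔼 F → RecList 𝔼 G → Rec 𝔼 g → RecList 𝔼 F′ → RecList 𝔼 G′ →
      RecPred (𝔼 ′) (λ x → Amalgam (f x) (F x) (G x) (g x) (F′ x) (G′ x))
    amalgamᵖ {f = f} {F = F} {G = G} {g = g} {F′ = F′} {G′ = G′} rf rF rG rg rF′ rG′ =
      mapᵖ {P = λ x → ∃ (Match x)} (λ x → mk⇔
          (λ (z , cu , dv , eq) → π₁ z , decode (π₁ (π₂ z)) , decode (π₂ (π₂ z)) , cu , dv , eq)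
          (λ (n , u , v , cu , dv , eq) → ⟨ n , ⟨ encode u , encode v ⟩ ⟩ , complete x n u v cu dv eq))
        (∃ᵖ {R = Match}
          (sameᵖ oracle (rf ⊙ rec-π₁) (rF ⊙ˡ rec-π₁) n u ×ᵖ
           sameᵖ oracle (rg ⊙ rec-π₁) (rF′ ⊙ˡ rec-π₁) n v ×ᵖ
           rec-⟨$⟩ u (rG ⊙ˡ rec-π₁) ≡ˡ rec-⟨$⟩ v (rG′ ⊙ˡ rec-π₁)))
      where
      Match : ℕ → ℕ → Set
      Match x z = f x ∶ F x ≃ π₁ z ∶ decode (π₁ (π₂ z)) ×
        g x ∶ F′ x ≃ π₁ z ∶ decode (π₂ (π₂ z)) ×
        decode (π₁ (π₂ z)) ⟨$⟩ G x ≡ decode (π₂ (π₂ z)) ⟨$⟩ G′ x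
      n = rec-π₁ ⊙ rec-π₂
      u = rec-decode (rec-π₁ ⊙ rec-π₂ ⊙ rec-π₂)
      v = rec-decode (rec-π₂ ⊙ rec-π₂ ⊙ rec-π₂)
      complete : ∀ x n u v → f x ∶ F x ≃ n ∶ u → g x ∶ F′ x ≃ n ∶ v → u ⟨$⟩ G x ≡ v ⟨$⟩ G′ x →
        Match x ⟨ n , ⟨ encode u , encode v ⟩ ⟩
      complete x n u v cu dv eq = subst₂ (λ n u → f x ∶ F x ≃ n ∶ u) (sym n≡) (sym u≡) cu
        , subst₂ (λ n v → g x ∶ F′ x ≃ n ∶ v) (sym n≡) (sym v≡) dv
        , subst₂ (λ u v → u ⟨$⟩ G x ≡ v ⟨$⟩ G′ x) (sym u≡) (sym v≡) eq
        where
        nuv = ⟨ n , ⟨ encode u , encode v ⟩ ⟩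
        n≡ : π₁ nuv ≡ n
        n≡ = π₁-pair n ⟨ encode u , encode v ⟩
        u≡ : decode (π₁ (π₂ nuv)) ≡ u
        u≡ = trans (cong (decode ∘ π₁) (π₂-pair n ⟨ encode u , encode v ⟩)) (decode-π₁ u (encode v))
        v≡ : decode (π₂ (π₂ nuv)) ≡ v
        v≡ = trans (cong (decode ∘ π₂) (π₂-pair n ⟨ encode u , encode v ⟩)) (decode-π₂ (encode u) v)

  -- Both extensions are coded by one number, so the universal quantifiers together cost one jump;
  -- the other is spent on the existential quantifier in `amalgamᵖ`.
  baseᵖ₀ : RecPred (𝔼 ′ ′) (Uncurry (λ k b → Base k (decode b)))
  baseᵖ₀ = mapᵖ (λ x → mk⇔
      (λ all l c ρ m d μ → every x (all ⟨ ⟨ l , ⟨ encode c , encode ρ ⟩ ⟩ , ⟨ m , ⟨ encode d , encode μ ⟩ ⟩ ⟩))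
      (λ base y → base _ _ _ _ _ _))
    (∀ᵖ {R = λ x y → Matrix (π₁ x) (decode (π₂ x)) (π₁ y) (π₂ y)}
      (jumpᵖ (overᵖ oracle rec-k rec-b rec-l rec-c rec-ρ) →ᵖ
       jumpᵖ (overᵖ oracle rec-k rec-b rec-m rec-d rec-μ) →ᵖ
       amalgamᵖ rec-l rec-c rec-ρ rec-m rec-d rec-μ))
    where
    Matrix : ℕ → List ℕ → ℕ → ℕ → Set
    Matrix k b y z = Over k b (π₁ y) (decode (π₁ (π₂ y))) (decode (π₂ (π₂ y))) →
      Over k b (π₁ z) (decode (π₁ (π₂ z))) (decode (π₂ (π₂ z))) →
      Amalgam (π₁ y) (decode (π₁ (π₂ y))) (decode (π₂ (π₂ y))) (π₁ z) (decode (π₁ (π₂ z))) (decode (π₂ (π₂ z)))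
    rec-k = rec-π₁ ⊙ rec-π₁
    rec-b = rec-decode (rec-π₂ ⊙ rec-π₁)
    rec-l = rec-π₁ ⊙ rec-π₁ ⊙ rec-π₂
    rec-c = rec-decode (rec-π₁ ⊙ rec-π₂ ⊙ rec-π₁ ⊙ rec-π₂)
    rec-ρ = rec-decode (rec-π₂ ⊙ rec-π₂ ⊙ rec-π₁ ⊙ rec-π₂)
    rec-m = rec-π₁ ⊙ rec-π₂ ⊙ rec-π₂
    rec-d = rec-decode (rec-π₁ ⊙ rec-π₂ ⊙ rec-π₂ ⊙ rec-π₂)
    rec-μ = rec-decode (rec-π₂ ⊙ rec-π₂ ⊙ rec-π₂ ⊙ rec-π₂)
    every : ∀ x {l c ρ m d μ} → Matrix (π₁ x) (decode (π₂ x))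
      (π₁ ⟨ ⟨ l , ⟨ encode c , encode ρ ⟩ ⟩ , ⟨ m , ⟨ encode d , encode μ ⟩ ⟩ ⟩)
      (π₂ ⟨ ⟨ l , ⟨ encode c , encode ρ ⟩ ⟩ , ⟨ m , ⟨ encode d , encode μ ⟩ ⟩ ⟩) →
      Over (π₁ x) (decode (π₂ x)) l c ρ → Over (π₁ x) (decode (π₂ x)) m d μ → Amalgam l c ρ m d μ
    every x {l} {c} {ρ} {m} {d} {μ} h rewrite π₁-pair ⟨ l , ⟨ encode c , encode ρ ⟩ ⟩ ⟨ m , ⟨ encode d , encode μ ⟩ ⟩
      | π₂-pair ⟨ l , ⟨ encode c , encode ρ ⟩ ⟩ ⟨ m , ⟨ encode d , encode μ ⟩ ⟩
      | π₁-pair l ⟨ encode c , encode ρ ⟩ | π₂-pair l ⟨ encode c , encode ρ ⟩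
      | π₁-pair m ⟨ encode d , encode μ ⟩ | π₂-pair m ⟨ encode d , encode μ ⟩
      | π₁-pair (encode c) (encode ρ) | π₂-pair (encode c) (encode ρ)
      | π₁-pair (encode d) (encode μ) | π₂-pair (encode d) (encode μ)
      | decode-encode c | decode-encode ρ | decode-encode d | decode-encode μ = h

  baseᵖ : Rec (𝔼 ′ ′) f → RecList (𝔼 ′ ′) F → RecPred (𝔼 ′ ′) (λ x → Base (f x) (F x))
  baseᵖ {f = f} r s = mapᵖ (λ x → mk⇔ (subst (Base (f x)) (decode-encode _)) (subst (Base (f x)) (sym (decode-encode _))))
    (apᵖ {R = λ k b → Base k (decode b)} baseᵖ₀ r (encoded s))

  -- Halting for the oracle-free indices of the 𝓐ₖ is decided after
  -- translating them to indices relative to 𝔼.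

  private
    diagramᵖ : (index : ℕ → ℕ) → Rec 𝔼 index → (D : ℕ → Pred ℕ 0ℓ) → (∀ k → Enumerates ∅ (index (ix k)) (D k)) →
      RecPred (𝔼 ′) (Uncurry D)
    diagramᵖ index r D enum = mapᵖ (λ x → mk⇔
        (λ (y , p) → from (enum (π₁ x) (π₂ x)) (y , from (φ-translate (index (ix (π₁ x)))) p))
        (λ p → let y , p′ = to (enum (π₁ x) (π₂ x)) p in y , to (φ-translate (index (ix (π₁ x)))) p′))
      (apᵖ {R = Halts 𝔼} haltsᵖ (jump (rec-translate ⊙ r ⊙ rec-ix ⊙ rec-π₁)) rec-π₂)

  module Index k = IsStructureIndex (indexed k)

  e-dom≡ : ∀ k → π₁ (ix k) ≡ Index.e-dom k
  e-dom≡ k = trans (cong π₁ (Index.packed k)) (π₁-pair (Index.e-dom k) _)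

  private
    rest≡ : ∀ k → π₂ (ix k) ≡ ⟨ Index.e-rel k , ⟨ Index.e-neg k , Index.e-fun k ⟩ ⟩
    rest≡ k = trans (cong π₂ (Index.packed k)) (π₂-pair (Index.e-dom k) ⟨ Index.e-rel k , ⟨ Index.e-neg k , Index.e-fun k ⟩ ⟩)

    rest≡′ : ∀ k → π₂ (π₂ (ix k)) ≡ ⟨ Index.e-neg k , Index.e-fun k ⟩
    rest≡′ k = trans (cong π₂ (rest≡ k)) (π₂-pair (Index.e-rel k) ⟨ Index.e-neg k , Index.e-fun k ⟩)

  e-rel≡ : ∀ k → π₁ (π₂ (ix k)) ≡ Index.e-rel k
  e-rel≡ k = trans (cong π₁ (rest≡ k)) (π₁-pair (Index.e-rel k) ⟨ Index.e-neg k , Index.e-fun k ⟩)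

  e-neg≡ : ∀ k → π₁ (π₂ (π₂ (ix k))) ≡ Index.e-neg k
  e-neg≡ k = trans (cong π₁ (rest≡′ k)) (π₁-pair (Index.e-neg k) (Index.e-fun k))

  e-fun≡ : ∀ k → π₂ (π₂ (π₂ (ix k))) ≡ Index.e-fun k
  e-fun≡ k = trans (cong π₂ (rest≡′ k)) (π₂-pair (Index.e-neg k) (Index.e-fun k))

  relDiagramᵖ : RecPred (𝔼 ′) (Uncurry (λ k → RelDiagram (struct k)))
  relDiagramᵖ = diagramᵖ (π₁ ∘ π₂) (rec-π₁ ⊙ rec-π₂) (λ k → RelDiagram (struct k))
    (λ k → subst (λ e → Enumerates ∅ e (RelDiagram (struct k))) (sym (e-rel≡ k)) (Index.rel-enumerates k))

  negDiagramᵖ : RecPred (𝔼 ′) (Uncurry (λ k → NegRelDiagram (struct k)))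
  negDiagramᵖ = diagramᵖ (π₁ ∘ π₂ ∘ π₂) (rec-π₁ ⊙ rec-π₂ ⊙ rec-π₂) (λ k → NegRelDiagram (struct k))
    (λ k → subst (λ e → Enumerates ∅ e (NegRelDiagram (struct k))) (sym (e-neg≡ k)) (Index.neg-enumerates k))

  funDiagramᵖ : RecPred (𝔼 ′) (Uncurry (λ k → FunDiagram (struct k)))
  funDiagramᵖ = diagramᵖ (π₂ ∘ π₂ ∘ π₂) (rec-π₂ ⊙ rec-π₂ ⊙ rec-π₂) (λ k → FunDiagram (struct k))
    (λ k → subst (λ e → Enumerates ∅ e (FunDiagram (struct k))) (sym (e-fun≡ k)) (Index.fun-enumerates k))

-- Enlarging tuples to repetition-free ones that generate bases

module Chain (em : ExcludedMiddle (lsuc 0ℓ)) {L : Language} {K : Pred (Structure L) (lsuc 0ℓ)}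
             (𝕂 : Enumeration L) (ix : ℕ → ℕ) (rep : Represents 𝕂 ∅ ix K) (jep : JEP K) (cap : CAP K) where
  open Classical em
  open Enumeration 𝕂
  open Types 𝕂
  open Amalgamation 𝕂 rep
  open Decidability em 𝕂 ix rep

  𝔼″ : Pred ℕ 0ℓ
  𝔼″ = 𝔼 ′ ′

  𝔼≤𝔼″ : RecPred 𝔼″ 𝔼
  𝔼≤𝔼″ = jumpᵖ ≤-jump

  Good : ℕ → List ℕ → Set
  Good k b = k ∶ b ≃ k ∶ b × Distinct b × Base k b

  private
    -- The last component records that no foreign element is added; `grow` needs it to locate the
    -- new tuple inside the old one.
    distinctExtension : ∀ acc us → Distinct acc →
      ∃[ e ] (Distinct (acc ++ e) × All (acc ++ e ∋_) us × All (λ x → acc ∋ x ⊎ us ∋ x) e)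
    distinctExtension acc [] d = [] , subst Distinct (sym (++-identityʳ acc)) d , [] , []
    distinctExtension acc (u ∷ us) d with em₀ (acc ∋ u)
    ... | yes u∈ =
      let e , d′ , us∈ , e∈ = distinctExtension acc us d
      in e , d′ , ∋-++ˡ {acc} {e} u∈ ∷ us∈ , All.map [ inj₁ , inj₂ ∘ (λ (i , i< , eq) → suc i , s≤s i< , eq) ]′ e∈
    ... | no u∉ =
      let e , d′ , us∈ , e∈ = distinctExtension (acc ++ u ∷ []) us (distinct-∷ʳ {acc} d u∉)
          assoc = ++-assoc acc (u ∷ []) e
      in u ∷ e , subst Distinct assoc d′
       , (∋-++ʳ acc (0 , z<s , refl)) ∷ subst (λ z → All (z ∋_) us) assoc us∈
       , inj₂ (0 , z<s , refl) ∷ All.map [ old , inj₂ ∘ (λ (i , i< , eq) → suc i , s≤s i< , eq) ]′ e∈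
      where
      old : ∀ {x} → acc ++ u ∷ [] ∋ x → acc ∋ x ⊎ u ∷ us ∋ x
      old (i , i< , eq) with m≤n⇒m<n∨m≡n (≤-pred (≤-trans i< (≤-reflexive (trans (length-++ acc) (+-comm (length acc) 1)))))
      ... | inj₁ lt   = inj₁ (i , lt , trans (sym (nth-++ˡ acc _ lt)) eq)
      ... | inj₂ refl = inj₂ (0 , z<s , trans (sym (nth-length acc u [])) eq)

  -- An extension of t generating an amalgamation base, listed without repetitions
  -- beginning with t ⟨$⟩ ν; dropping repetitions keeps the generated structure.

  grow : ∀ {k t ν} → k ∶ t ≃ k ∶ t → InRange (length t) ν → Distinct (t ⟨$⟩ ν) →
    ∃[ l ] ∃[ b ] ∃[ r ] (Good l b × length ν ≤ length b × InRange (length b) r ×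
      k ∶ t ≃ l ∶ b ⟨$⟩ r × b ⟨$⟩ r ⟨$⟩ ν ≡ b ⟨$⟩ upTo (length ν))
  grow {k} {t} {ν} valid ν< d =
    let l , t′ , c , s , valid′ , base = extendToBase cap valid
        ν<′ = subst (λ n → InRange n ν) (≃-length s) ν<
        t⁺ = t′ ++ c
        acc = t′ ⟨$⟩ ν
        |acc| = length-map (nth t′) ν
        ν<⁺ = inRange-≤ (≤-trans (m≤m+n _ _) (≤-reflexive (sym (length-++ t′)))) ν<′
        acc∈ = subst (All (t⁺ ∋_)) (⟨$⟩-++ t′ c ν ν<′) (⟨$⟩-∋ t⁺ ν<⁺)
        e , d′ , t∈ , e∈ = distinctExtension acc t⁺ (≃-distinct (≃-reindex s ν ν<) d)
        b = acc ++ e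
        r , r< , t≡ = positions b t∈
        b∈ = ++⁺ acc∈ (All.map [ (λ (i , i< , eq) → subst (t⁺ ∋_) eq (All-nth acc∈ i<)) , id ]′ e∈)
        μ , μ< , b≡ = positions t⁺ b∈
        validᵇ = subst (λ z → l ∶ z ≃ l ∶ z) b≡ (≃-reindex valid′ μ μ<)
        |r| = trans (sym (length-map (nth b) r)) (cong length t≡)
        μ<r = subst (λ n → InRange n μ) (sym |r|) μ<
        rμ< = ⟨$⟩-InRange r μ r< μ<r
        -- The tuples `b` and `t⁺` list the same elements: `b ⟨$⟩ r ≡ t⁺` and `t⁺ ⟨$⟩ μ ≡ b`. Every
        -- copy of `b` is thus recovered from its entries at `r`, so the base property passes from
        -- `t⁺` to `b`.
        det : Determined l b r
        det {n} {u} {v} su sv eq = trans (determine r μ rμ< μ<r (trans (cong (_⟨$⟩ μ) t≡) b≡) su)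
          (trans (cong (_⟨$⟩ μ) eq) (sym (determine r μ rμ< μ<r (trans (cong (_⟨$⟩ μ) t≡) b≡) sv)))
        -- The caller knows only `t`, so the positions `r` of all of `t⁺` are cut down to those of
        -- the copy `t′` of `t`.
        α = upTo (length t′)
        α< = subst (λ n → InRange n α) (sym (trans |r| (length-++ t′)))
          (inRange-≤ (m≤m+n (length t′) (length c)) (all-upTo (length t′)))
        r′ = r ⟨$⟩ α
        br′≡ : b ⟨$⟩ r′ ≡ t′
        br′≡ = trans (⟨$⟩-assoc b r α α<) (trans (cong (_⟨$⟩ α) t≡) (++-⟨$⟩-upTo t′ c))
    in l , b , r′
     , (validᵇ , d′ , base-determined r r< det (subst (Base l) (sym t≡) base))
     , ≤-trans (≤-reflexive (sym |acc|)) (≤-trans (m≤m+n (length acc) (length e)) (≤-reflexive (sym (length-++ acc))))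
     , ⟨$⟩-InRange r α r< α<
     , subst (λ z → k ∶ t ≃ l ∶ z) (sym br′≡) s
     , trans (cong (_⟨$⟩ ν) br′≡) (sym (trans (cong (λ n → b ⟨$⟩ upTo n) (sym |acc|)) (++-⟨$⟩-upTo acc e)))
    where
    All-nth : ∀ {P : ℕ → Set} {xs i} → All P xs → i < length xs → P (nth xs i)
    All-nth {i = zero}  (px ∷ _)  _        = px
    All-nth {i = suc i} (_ ∷ pxs) (s≤s lt) = All-nth pxs lt
    determine : ∀ {l b n u} r μ → InRange (length b) (r ⟨$⟩ μ) → InRange (length r) μ → b ⟨$⟩ r ⟨$⟩ μ ≡ b →
      l ∶ b ≃ n ∶ u → u ≡ u ⟨$⟩ r ⟨$⟩ μ
    determine {l} {b} {n} {u} r μ rμ< μ< eq s = trans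
      (sym (trans (cong (λ n → u ⟨$⟩ upTo n) (≃-length s)) (⟨$⟩-upTo u)))
      (trans (≃-⟨$⟩-≡ s (all-upTo (length b)) rμ<
        (trans (⟨$⟩-upTo b) (sym (trans (⟨$⟩-assoc b r μ μ<) eq)))) (⟨$⟩-assoc u r μ μ<))

-- The chain of tuples and the realization of requests

module Limit (em : ExcludedMiddle (lsuc 0ℓ)) {L : Language} {K : Pred (Structure L) (lsuc 0ℓ)}
             (𝕂 : Enumeration L) (ix : ℕ → ℕ) (rep : Represents 𝕂 ∅ ix K) (jep : JEP K) (cap : CAP K) where
  open Classical em
  open Types 𝕂
  open Decidability em 𝕂 ix rep
  open Chain em 𝕂 ix rep jep cap

  -- The two quantifiers are bounded, but 𝔼″ can afford to treat them as unbounded ones at a jump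
  -- each.
  distinctᵖ : RecList 𝔼″ F → RecPred 𝔼″ (λ x → Distinct (F x))
  distinctᵖ {F = F} r = mapᵖ (λ x → mk⇔ (subst Distinct (decode-encode (F x))) (subst Distinct (sym (decode-encode (F x)))))
    (distinct₀ ⊙ᵖ encoded r)
    where
    distinct₀ : RecPred 𝔼″ (λ x → Distinct (decode x))
    distinct₀ = ∀ᵖ (∀ᵖ {R = λ e j → π₂ e < length (decode (π₁ e)) → j < length (decode (π₁ e)) →
        nth (decode (π₁ e)) (π₂ e) ≡ nth (decode (π₁ e)) j → π₂ e ≡ j}
      ((i <ᵖ rec-length xs) →ᵖ (rec-π₂ <ᵖ rec-length xs) →ᵖ (rec-nth xs i ≡ᵖ rec-nth xs rec-π₂) →ᵖ (i ≡ᵖ rec-π₂)))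
      where
      xs = rec-decode (rec-π₁ ⊙ rec-π₁)
      i = rec-π₂ ⊙ rec-π₁

  Requested : ℕ → List ℕ → ℕ → List ℕ → List ℕ → List ℕ → Set
  Requested k b l c ρ p = InRange (length b) p × Over k (b ⟨$⟩ p) l c ρ × Base k (b ⟨$⟩ p)

  -- The equation `q ⟨$⟩ ρ ≡ p` is between positions, which are the future elements of the limit:
  -- the copy of `c` extends the very subtuple at `p`.
  Realized : ℕ → List ℕ → ℕ → List ℕ → List ℕ → List ℕ → Set
  Realized k b l c ρ p = ∃[ q ] (InRange (length b) q × k ∶ b ⟨$⟩ q ≃ l ∶ c × q ⟨$⟩ ρ ≡ p)

  Next : ℕ → List ℕ → ℕ → List ℕ → List ℕ → List ℕ → ℕ → List ℕ → Set
  Next k b l c ρ p k′ b′ = Good k′ b′ × length b ≤ length b′ × k ∶ b ≃ k′ ∶ b′ ⟨$⟩ upTo (length b) ×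
    (Requested k b l c ρ p → Realized k′ b′ l c ρ p)

  -- A request that is not admissible leaves the state alone. Otherwise `b` is itself an extension
  -- of its subtuple at `p`, which generates a base, so it amalgamates with `c`; then `grow`
  -- enlarges the amalgam.
  next-state : ∀ {k b} → Good k b → ∀ l c ρ p → ∃[ k′ ] ∃[ b′ ] Next k b l c ρ p k′ b′
  next-state {k} {b} good@(valid , d , _) l c ρ p with em₀ (Requested k b l c ρ p)
  ... | no ¬req = k , b , good , ≤-refl , subst (λ z → k ∶ b ≃ k ∶ z) (sym (⟨$⟩-upTo b)) valid ,
    λ req → contradiction req ¬req
  ... | yes (p< , over , base) =
    let n , u , v , cu , bv , eq = base l c ρ k b p over (p< , valid , ≃-reindex valid p p<)
        -- The copy `v` of the old tuple comes in front, so that its positions `α` can be kept as an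
        -- initial segment of the next tuple.
        t = v ++ u
        t✓ = ++-valid (≃-valid₂ bv) (≃-valid₂ cu)
        |v| = sym (≃-length bv)
        α = upTo (length v)
        |α| = length-upTo (length v)
        t⟨α⟩≡v = ++-⟨$⟩-upTo v u
        |v|≤|t| = ≤-trans (m≤m+n (length v) (length u)) (≤-reflexive (sym (length-++ v)))
        α<t = inRange-≤ |v|≤|t| (all-upTo (length v))
        β , β<t , t⟨β⟩≡u = positions t (All.map (∋-++ʳ v) (all-∋ u))
        k′ , b′ , r , good′ , |α|≤ , r< , s , prefix = grow t✓ α<t (subst Distinct (sym t⟨α⟩≡v) (≃-distinct bv d))
        |t|≡|r| = trans (≃-length s) (length-map (nth b′) r)
        inR = λ {μ} → subst (λ n → InRange n μ) |t|≡|r|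
        |v|≤|b′| = subst (_≤ length b′) |α| |α|≤
        |β|≡|u| = trans (sym (length-map (nth t) β)) (cong length t⟨β⟩≡u)
        |ρ|<β = subst (λ n → InRange n ρ) (trans (≃-length cu) (sym |β|≡|u|)) (proj₁ over)
        q = r ⟨$⟩ β
        q< = ⟨$⟩-InRange r β r< (inR β<t)
        p<v = subst (λ n → InRange n p) (sym |v|) p<
        p<α = subst (λ n → InRange n p) (sym |α|) p<v
        |q|≡|β| = length-map (nth r) β
        ρ<q = subst (λ n → InRange n ρ) (sym |q|≡|β|) |ρ|<β
        p<b′ = inRange-≤ |v|≤|b′| p<v
        b′⟨p⟩≡ : b′ ⟨$⟩ p ≡ b′ ⟨$⟩ r ⟨$⟩ (α ⟨$⟩ p)
        b′⟨p⟩≡ = trans (cong (b′ ⟨$⟩_) (sym (upTo-⟨$⟩ p p<v)))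
          (trans (⟨$⟩-assoc b′ α p p<α)
            (trans (cong (_⟨$⟩ p) (trans (cong (λ n → b′ ⟨$⟩ upTo n) (sym |α|)) (sym prefix)))
              (sym (⟨$⟩-assoc (b′ ⟨$⟩ r) α p p<α))))
        b′⟨q⟩ : b′ ⟨$⟩ q ≡ b′ ⟨$⟩ r ⟨$⟩ β
        b′⟨q⟩ = ⟨$⟩-assoc b′ r β (inR β<t)
        -- This is the gluing equation of the amalgam, read in `t`; it says that `c` at `ρ` and `b`
        -- at `p` have the same image there.
        in-t : t ⟨$⟩ (β ⟨$⟩ ρ) ≡ t ⟨$⟩ (α ⟨$⟩ p)
        in-t = trans (⟨$⟩-assoc t β ρ |ρ|<β) (trans (cong (_⟨$⟩ ρ) t⟨β⟩≡u)
          (trans eq (trans (cong (_⟨$⟩ p) (sym t⟨α⟩≡v)) (sym (⟨$⟩-assoc t α p p<α)))))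
        b′⟨qρ⟩≡b′⟨p⟩ : b′ ⟨$⟩ (q ⟨$⟩ ρ) ≡ b′ ⟨$⟩ p
        b′⟨qρ⟩≡b′⟨p⟩ = trans (⟨$⟩-assoc b′ q ρ ρ<q) (trans (cong (_⟨$⟩ ρ) b′⟨q⟩)
          (trans (sym (⟨$⟩-assoc (b′ ⟨$⟩ r) β ρ |ρ|<β))
            (trans (≃-⟨$⟩-≡ s (⟨$⟩-InRange β ρ β<t |ρ|<β) (⟨$⟩-InRange α p α<t p<α) in-t) (sym b′⟨p⟩≡))))
    in k′ , b′ , good′ , subst (_≤ length b′) |v| |v|≤|b′|
     , ≃-trans bv (subst₂ (λ y z → n ∶ y ≃ k′ ∶ z) t⟨α⟩≡v
         (trans prefix (cong (λ n → b′ ⟨$⟩ upTo n) (trans |α| |v|))) (≃-reindex s α α<t))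
     , λ _ → q , q<
     , ≃-sym (≃-trans cu (subst₂ (λ y z → n ∶ y ≃ k′ ∶ z) t⟨β⟩≡u (sym b′⟨q⟩) (≃-reindex s β β<t)))
     -- Equal entries of the repetition-free tuple `b′` have equal positions.
     , distinct-⟨$⟩ {b′} (proj₁ (proj₂ good′)) (⟨$⟩-InRange q ρ q< ρ<q) p<b′ b′⟨qρ⟩≡b′⟨p⟩

  goodᵖ : Rec 𝔼″ f → RecList 𝔼″ F → RecPred 𝔼″ (λ x → Good (f x) (F x))
  goodᵖ r s = sameᵖ 𝔼≤𝔼″ r s r s ×ᵖ distinctᵖ s ×ᵖ baseᵖ r s

  private
    -- At stage s of the construction, the request is π₁ s, so that every
    -- request is dealt with at arbitrarily late stages.

    Step : ℕ → ℕ → Set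
    Step x y = Good (π₁ σ) (decode (π₂ σ)) →
      Next (π₁ σ) (decode (π₂ σ)) (π₁ (π₁ r)) (decode (π₂ (π₁ r))) (decode (π₁ (π₂ r))) (decode (π₂ (π₂ r)))
        (π₁ y) (decode (π₂ y))
      where
      σ = π₂ x
      r = π₁ (π₁ x)

    module _ {O : Pred ℕ 0ℓ} where
      rec-k : Rec O (λ e → π₁ (π₂ (π₁ e)))
      rec-k = rec-π₁ ⊙ rec-π₂ ⊙ rec-π₁
      rec-b : RecList O (λ e → decode (π₂ (π₂ (π₁ e))))
      rec-b = rec-decode (rec-π₂ ⊙ rec-π₂ ⊙ rec-π₁)
      rec-k′ : Rec O (λ e → π₁ (π₂ e))
      rec-k′ = rec-π₁ ⊙ rec-π₂
      rec-b′ : RecList O (λ e → decode (π₂ (π₂ e)))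
      rec-b′ = rec-decode (rec-π₂ ⊙ rec-π₂)
      rec-r : Rec O (λ e → π₁ (π₁ (π₁ e)))
      rec-r = rec-π₁ ⊙ rec-π₁ ⊙ rec-π₁
      rec-l : Rec O (λ e → π₁ (π₁ (π₁ (π₁ (π₁ e)))))
      rec-l = rec-π₁ ⊙ rec-π₁ ⊙ rec-r
      rec-c : RecList O (λ e → decode (π₂ (π₁ (π₁ (π₁ (π₁ e))))))
      rec-c = rec-decode (rec-π₂ ⊙ rec-π₁ ⊙ rec-r)
      rec-ρ : RecList O (λ e → decode (π₁ (π₂ (π₁ (π₁ (π₁ e))))))
      rec-ρ = rec-decode (rec-π₁ ⊙ rec-π₂ ⊙ rec-r)
      rec-p : RecList O (λ e → decode (π₂ (π₂ (π₁ (π₁ (π₁ e))))))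
      rec-p = rec-decode (rec-π₂ ⊙ rec-π₂ ⊙ rec-r)

    stepᵖ : RecPred 𝔼″ (Uncurry Step)
    stepᵖ = goodᵖ rec-k rec-b →ᵖ goodᵖ rec-k′ rec-b′ ×ᵖ (rec-length rec-b ≤ᵖ rec-length rec-b′) ×ᵖ
      sameᵖ 𝔼≤𝔼″ rec-k rec-b rec-k′ (rec-⟨$⟩ rec-b′ (rec-upTo (rec-length rec-b))) ×ᵖ
      (inRangeᵖ (rec-length rec-b) rec-p ×ᵖ
       overᵖ 𝔼≤𝔼″ rec-k (rec-⟨$⟩ rec-b rec-p) rec-l rec-c rec-ρ ×ᵖ
       baseᵖ rec-k (rec-⟨$⟩ rec-b rec-p) →ᵖ
       jumpᵖ (mapᵖ {P = λ e → ∃ (λ z → Realizes e (decode z))} (λ e → mk⇔ (λ (z , h) → decode z , h)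
          (λ (q , h) → encode q , subst (Realizes e) (sym (decode-encode q)) h))
         (∃ᵖ {R = λ e z → Realizes e (decode z)}
           (inRangeᵖ (rec-length (rec-b′ ⊙ˡ rec-π₁)) (rec-decode rec-π₂) ×ᵖ
            sameᵖ oracle (rec-k′ ⊙ rec-π₁) (rec-⟨$⟩ (rec-b′ ⊙ˡ rec-π₁) (rec-decode rec-π₂)) (rec-l ⊙ rec-π₁) (rec-c ⊙ˡ rec-π₁) ×ᵖ
            rec-⟨$⟩ (rec-decode rec-π₂) (rec-ρ ⊙ˡ rec-π₁) ≡ˡ rec-p ⊙ˡ rec-π₁))))
      where
      Realizes : ℕ → List ℕ → Set
      Realizes e q = InRange (length (decode (π₂ (π₂ e)))) q ×
        π₁ (π₂ e) ∶ decode (π₂ (π₂ e)) ⟨$⟩ q ≃ π₁ (π₁ (π₁ (π₁ (π₁ e)))) ∶ decode (π₂ (π₁ (π₁ (π₁ (π₁ e))))) ×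
        q ⟨$⟩ decode (π₁ (π₂ (π₁ (π₁ (π₁ e))))) ≡ decode (π₂ (π₂ (π₁ (π₁ (π₁ e)))))

    step-total : ∀ x → ∃ (Step x)
    step-total x with em₀ (Good (π₁ (π₂ x)) (decode (π₂ (π₂ x))))
    -- Numbers that are no good states satisfy `Step` vacuously, which makes the relation total and
    -- the search always succeed.
    ... | no ¬good = 0 , λ good → contradiction good ¬good
    ... | yes good = let k′ , b′ , nxt = next-state good _ _ _ _ in ⟨ k′ , encode b′ ⟩ , λ _ →
      subst₂ (Next _ _ _ _ _ _) (sym (π₁-pair k′ (encode b′)))
        (sym (trans (cong decode (π₂-pair k′ (encode b′))) (decode-encode b′))) nxt

    chosen : Σ[ f ∈ (ℕ → ℕ) ] (Rec 𝔼″ f × (∀ x → Step x (f x)))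
    chosen = choose Step stepᵖ step-total

    first : ∃[ k ] ∃[ b ] Good k b
    first = let k , b , _ , good , _ = grow {0} {[]} {[]} (≃-refl []) [] (λ _ _ ()) in k , b , good

  abstract
    chain : ℕ → ℕ
    chain zero    = ⟨ proj₁ first , encode (proj₁ (proj₂ first)) ⟩
    chain (suc s) = proj₁ chosen ⟨ s , chain s ⟩

    rec-chain : Rec 𝔼″ chain
    rec-chain = rec-natrec (chain 0) (proj₁ (proj₂ chosen)) chain refl (λ _ → refl)

  𝕜 : ℕ → ℕ
  𝕜 s = π₁ (chain s)

  𝕓 : ℕ → List ℕ
  𝕓 s = decode (π₂ (chain s))

  size : ℕ → ℕ
  size s = length (𝕓 s)

  rec-𝕜 : Rec 𝔼″ 𝕜
  rec-𝕜 = rec-π₁ ⊙ rec-chain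

  rec-𝕓 : RecList 𝔼″ 𝕓
  rec-𝕓 = rec-decode (rec-π₂ ⊙ rec-chain)

  rec-size : Rec 𝔼″ size
  rec-size = rec-length rec-𝕓

  abstract
    private
      good-0 : Good (𝕜 0) (𝕓 0)
      good-0 = subst₂ Good (sym (π₁-pair (proj₁ first) (encode (proj₁ (proj₂ first)))))
        (sym (trans (cong decode (π₂-pair (proj₁ first) (encode (proj₁ (proj₂ first))))) (decode-encode (proj₁ (proj₂ first)))))
        (proj₂ (proj₂ first))

      next-suc : ∀ s → Good (𝕜 s) (𝕓 s) → let r = π₁ s in
        Next (𝕜 s) (𝕓 s) (π₁ (π₁ r)) (decode (π₂ (π₁ r))) (decode (π₁ (π₂ r))) (decode (π₂ (π₂ r))) (𝕜 (suc s)) (𝕓 (suc s))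
      next-suc s = subst₂ (λ t σ → let r = π₁ t in Good (π₁ σ) (decode (π₂ σ)) →
          Next (π₁ σ) (decode (π₂ σ)) (π₁ (π₁ r)) (decode (π₂ (π₁ r))) (decode (π₁ (π₂ r))) (decode (π₂ (π₂ r)))
            (𝕜 (suc s)) (𝕓 (suc s)))
        (π₁-pair s (chain s)) (π₂-pair s (chain s)) (proj₂ (proj₂ chosen) ⟨ s , chain s ⟩)

    good : ∀ s → Good (𝕜 s) (𝕓 s)
    good zero    = good-0
    good (suc s) = proj₁ (next-suc s (good s))

    size-suc : ∀ s → size s ≤ size (suc s)
    size-suc s = proj₁ (proj₂ (next-suc s (good s)))

    coherent-suc : ∀ s → 𝕜 s ∶ 𝕓 s ≃ 𝕜 (suc s) ∶ 𝕓 (suc s) ⟨$⟩ upTo (size s)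
    coherent-suc s = proj₁ (proj₂ (proj₂ (next-suc s (good s))))

    realized-suc : ∀ s {l c ρ p} → π₁ s ≡ ⟨ ⟨ l , encode c ⟩ , ⟨ encode ρ , encode p ⟩ ⟩ →
      Requested (𝕜 s) (𝕓 s) l c ρ p → Realized (𝕜 (suc s)) (𝕓 (suc s)) l c ρ p
    realized-suc s {l} {c} {ρ} {p} eq = subst (λ f → f)
      (cong₄ (λ l c ρ p → Requested (𝕜 s) (𝕓 s) l c ρ p → Realized (𝕜 (suc s)) (𝕓 (suc s)) l c ρ p)
        (trans (cong π₁ r₁) (π₁-pair l (encode c)))
        (trans (cong decode (trans (cong π₂ r₁) (π₂-pair l (encode c)))) (decode-encode c))
        (trans (cong decode (trans (cong π₁ r₂) (π₁-pair (encode ρ) (encode p)))) (decode-encode ρ))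
        (trans (cong decode (trans (cong π₂ r₂) (π₂-pair (encode ρ) (encode p)))) (decode-encode p)))
      (proj₂ (proj₂ (proj₂ (next-suc s (good s)))))
      where
      r₁ : π₁ (π₁ s) ≡ ⟨ l , encode c ⟩
      r₁ = trans (cong π₁ eq) (π₁-pair ⟨ l , encode c ⟩ ⟨ encode ρ , encode p ⟩)
      r₂ : π₂ (π₁ s) ≡ ⟨ encode ρ , encode p ⟩
      r₂ = trans (cong π₂ eq) (π₂-pair ⟨ l , encode c ⟩ ⟨ encode ρ , encode p ⟩)
      cong₄ : ∀ {A B C D : Set} {E : Set₁} (f : A → B → C → D → E) {a a′ b b′ c c′ d d′} →
        a ≡ a′ → b ≡ b′ → c ≡ c′ → d ≡ d′ → f a b c d ≡ f a′ b′ c′ d′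
      cong₄ f refl refl refl refl = refl

  size-mono : ∀ {s t} → s ≤ t → size s ≤ size t
  size-mono {s} s≤t = go (≤⇒≤′ s≤t)
    where
    go : ∀ {t} → s ≤′ t → size s ≤ size t
    go ≤′-refl        = ≤-refl
    go (≤′-step s≤′t) = ≤-trans (go s≤′t) (size-suc _)

  valid : ∀ s → 𝕜 s ∶ 𝕓 s ≃ 𝕜 s ∶ 𝕓 s
  valid s = proj₁ (good s)

  coherent : ∀ {s t} → s ≤ t → ∀ {p} → InRange (size s) p → 𝕜 s ∶ 𝕓 s ⟨$⟩ p ≃ 𝕜 t ∶ 𝕓 t ⟨$⟩ p
  coherent {s} s≤t = go (≤⇒≤′ s≤t)
    where
    one : ∀ t {p} → InRange (size t) p → 𝕜 t ∶ 𝕓 t ⟨$⟩ p ≃ 𝕜 (suc t) ∶ 𝕓 (suc t) ⟨$⟩ p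
    one t {p} p< = subst (λ z → 𝕜 t ∶ 𝕓 t ⟨$⟩ p ≃ 𝕜 (suc t) ∶ z)
      (trans (sym (⟨$⟩-assoc (𝕓 (suc t)) (upTo (size t)) p (subst (λ n → InRange n p) (sym (length-upTo (size t))) p<)))
        (cong (𝕓 (suc t) ⟨$⟩_) (upTo-⟨$⟩ p p<)))
      (≃-reindex (coherent-suc t) p p<)
    go : ∀ {t} → s ≤′ t → ∀ {p} → InRange (size s) p → 𝕜 s ∶ 𝕓 s ⟨$⟩ p ≃ 𝕜 t ∶ 𝕓 t ⟨$⟩ p
    go ≤′-refl p< = ≃-reindex (valid s) _ p<
    go (≤′-step {t} s≤′t) p< = ≃-trans (go s≤′t p<) (one t (inRange-≤ (size-mono (≤′⇒≤ s≤′t)) p<))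

  realize : ∀ s {p l c ρ} → InRange (size s) p → Over (𝕜 s) (𝕓 s ⟨$⟩ p) l c ρ → Base (𝕜 s) (𝕓 s ⟨$⟩ p) →
    ∃[ t ] ∃[ q ] (s ≤ t × InRange (size t) q × 𝕜 t ∶ 𝕓 t ⟨$⟩ q ≃ l ∶ c × q ⟨$⟩ ρ ≡ p)
  realize s {p} {l} {c} {ρ} p< over base =
    -- Pairing the request with `s` gives a stage not before `s` that handles it; coherence keeps
    -- the request admissible until then.
    let t = ⟨ ⟨ ⟨ l , encode c ⟩ , ⟨ encode ρ , encode p ⟩ ⟩ , s ⟩
        s≤t = subst (_≤ t) (π₂-pair ⟨ ⟨ l , encode c ⟩ , ⟨ encode ρ , encode p ⟩ ⟩ s) (π₂≤ t)
        same = coherent s≤t p<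
        q , q< , s′ , eq = realized-suc t (π₁-pair ⟨ ⟨ l , encode c ⟩ , ⟨ encode ρ , encode p ⟩ ⟩ s)
          (inRange-≤ (size-mono s≤t) p< , over-≃ same over , base-≃ same base)
    in suc t , q , m≤n⇒m≤1+n s≤t , q< , s′ , eq

-- Membership in the diagrams of a structure

module _ {L : Language} (𝓐 : ωStructure L) where
  open Language L
  private
    module A = Structure ⟦ 𝓐 ⟧

    symbol≡ : ∀ {p : ℕ → Set} → (∀ {n} (x y : p n) → x ≡ y) → {F G : ∃ p} → proj₁ F ≡ proj₁ G → F ≡ G
    symbol≡ irr {n , x} {.n , y} refl = cong (n ,_) (irr x y)

  fun-diagram : ∀ F a → FunDiagram 𝓐 ⟨ proj₁ F , ⟨ encode (raw 𝓐 a) , proj₁ (A.fun F a) ⟩ ⟩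
  fun-diagram F a = F , a , cong (λ z → ⟨ proj₁ F , ⟨ z , proj₁ (A.fun F a) ⟩ ⟩) (sym (code≡encode 𝓐 a))

  fun-diagram-functional : ∀ {r xs y y′} → FunDiagram 𝓐 ⟨ r , ⟨ encode xs , y ⟩ ⟩ →
    FunDiagram 𝓐 ⟨ r , ⟨ encode xs , y′ ⟩ ⟩ → y ≡ y′
  fun-diagram-functional {r} {xs} {y} {y′} (F , a , eq) (G , b , eq′) =
    let eq-F , eqs = pair-injective {r} {⟨ encode xs , y ⟩} {proj₁ F} {⟨ code 𝓐 a , proj₁ (A.fun F a) ⟩} eq
        eq-a , eq-y = pair-injective {encode xs} {y} {code 𝓐 a} {proj₁ (A.fun F a)} eqs
        eq-G , eqs′ = pair-injective {r} {⟨ encode xs , y′ ⟩} {proj₁ G} {⟨ code 𝓐 b , proj₁ (A.fun G b) ⟩} eq′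
        eq-b , eq-y′ = pair-injective {encode xs} {y′} {code 𝓐 b} {proj₁ (A.fun G b)} eqs′
    in trans eq-y (trans (same-value (symbol≡ T-irrelevant (trans (sym eq-F) eq-G)) a b
         (encode-injective (trans (sym (code≡encode 𝓐 a)) (trans (sym eq-a) (trans eq-b (code≡encode 𝓐 b)))))) (sym eq-y′))
    where
    same-value : ∀ {F G} → F ≡ G → (a : Vec A.Carrier (arityᶠ F)) (b : Vec A.Carrier (arityᶠ G)) →
      raw 𝓐 a ≡ raw 𝓐 b → proj₁ (A.fun F a) ≡ proj₁ (A.fun G b)
    same-value {F} refl a b eq = A.fun-cong F (raw⁻ 𝓐 a b eq)

  rel-diagram : ∀ R a → RelDiagram 𝓐 ⟨ proj₁ R , encode (raw 𝓐 a) ⟩ ⇔ A.rel R a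
  rel-diagram R a = mk⇔ sound (λ r → R , a , cong ⟨ proj₁ R ,_⟩ (sym (code≡encode 𝓐 a)) , r)
    where
    same-rel : ∀ {Q} → Q ≡ R → (b : Vec A.Carrier (arityʳ Q)) → raw 𝓐 b ≡ raw 𝓐 a → A.rel Q b → A.rel R a
    same-rel refl b eq = A.rel-resp R (raw⁻ 𝓐 b a eq)
    sound : RelDiagram 𝓐 ⟨ proj₁ R , encode (raw 𝓐 a) ⟩ → A.rel R a
    sound (Q , b , eq , r) =
      let eq-Q , eq-b = pair-injective {proj₁ R} {encode (raw 𝓐 a)} {proj₁ Q} {code 𝓐 b} eq
      in same-rel (symbol≡ T-irrelevant (sym eq-Q)) b (encode-injective (trans (sym (code≡encode 𝓐 b)) (sym eq-b))) r

  typed : ∀ {xs n} → SameType 𝓐 𝓐 xs xs → length xs ≡ n → Σ[ a ∈ Vec A.Carrier n ] raw 𝓐 a ≡ xs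
  typed (mkSameType a _ refl _ _) eq with refl ← trans (sym (length-raw 𝓐 a)) eq = a , refl

-- The limit structure and its types

module Model (em : ExcludedMiddle (lsuc 0ℓ)) {L : Language} {K : Pred (Structure L) (lsuc 0ℓ)}
             (𝕂 : Enumeration L) (ix : ℕ → ℕ) (rep : Represents 𝕂 ∅ ix K) (jep : JEP K) (cap : CAP K) where
  open Enumeration 𝕂
  open Types 𝕂
  open Limit em 𝕂 ix rep jep cap public
  open Language L

  -- The elements of the limit are the positions in the tuples 𝕓 s. As these have
  -- no repetitions, equality of elements is equality of positions.

  Domain : Pred ℕ 0ℓ
  Domain i = ∃[ s ] i < size s

  private
    Elem = Σ ℕ Domain

    rawᴹ : ∀ {n} → Vec Elem n → List ℕ
    rawᴹ a = toList (map proj₁ a)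

  live : ∀ {n} (a : Vec Elem n) → ∃[ s ] InRange (size s) (rawᴹ a)
  live []                 = 0 , []
  live ((i , s , i<) ∷ a) = let t , a< = live a in
    s ⊔ t , <-≤-trans i< (size-mono (m≤m⊔n s t)) ∷ inRange-≤ (size-mono (m≤n⊔m s t)) a<

  coherent₂ : ∀ {s t p} → InRange (size s) p → InRange (size t) p → 𝕜 s ∶ 𝕓 s ⟨$⟩ p ≃ 𝕜 t ∶ 𝕓 t ⟨$⟩ p
  coherent₂ {s} {t} p<s p<t = ≃-trans (coherent (m≤m⊔n s t) p<s) (≃-sym (coherent (m≤n⊔m s t) p<t))

  distinct : ∀ s → Distinct (𝕓 s)
  distinct s = proj₁ (proj₂ (good s))

  FunValue : ℕ → List ℕ → ℕ → Set
  FunValue F xs y = ∃[ s ] (InRange (size s) (y ∷ xs) × FunDiagram (struct (𝕜 s)) ⟨ F , ⟨ encode (𝕓 s ⟨$⟩ xs) , nth (𝕓 s) y ⟩ ⟩)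

  RelHolds : ℕ → List ℕ → Set
  RelHolds R xs = ∃[ s ] (InRange (size s) xs × RelDiagram (struct (𝕜 s)) ⟨ R , encode (𝕓 s ⟨$⟩ xs) ⟩)

  funValue-at : ∀ {F xs y} → FunValue F xs y → ∀ {t} → InRange (size t) (y ∷ xs) →
    FunDiagram (struct (𝕜 t)) ⟨ F , ⟨ encode (𝕓 t ⟨$⟩ xs) , nth (𝕓 t) y ⟩ ⟩
  funValue-at {F} {xs} {y} (s , p<s , d) p<t = ≃-fun {r = F} (coherent₂ {p = y ∷ xs} p<s p<t) d

  relHolds-at : ∀ {R xs} → RelHolds R xs → ∀ {t} → InRange (size t) xs → RelDiagram (struct (𝕜 t)) ⟨ R , encode (𝕓 t ⟨$⟩ xs) ⟩
  relHolds-at {R} (s , p<s , d) p<t = ≃-rel {r = R} (coherent₂ p<s p<t) d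

  funValue-unique : ∀ {F xs y y′} → FunValue F xs y → FunValue F xs y′ → y ≡ y′
  funValue-unique {F} {xs} {y} {y′} v@(s , y< ∷ xs< , _) v′@(t , y′< ∷ _ , _) =
    distinct u y y′ y<u y′<u (fun-diagram-functional (struct (𝕜 u)) {F} {𝕓 u ⟨$⟩ xs}
      (funValue-at {F} {xs} {y} v (y<u ∷ xs<u)) (funValue-at {F} {xs} {y′} v′ (y′<u ∷ xs<u)))
    where
    u = s ⊔ t
    xs<u = inRange-≤ (size-mono (m≤m⊔n s t)) xs<
    y<u = <-≤-trans y< (size-mono (m≤m⊔n s t))
    y′<u = <-≤-trans y′< (size-mono (m≤n⊔m s t))

  private
    -- The value `v` exists in the structure at stage `s` but need not be an entry of `𝕓 s`. As
    -- `𝕓 s` generates a base, appending `v` to it is an admissible request. Its realization keeps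
    -- the positions below `size s`, and `nth q (size s)` is the position of the value.
    module AddValue (F : FunSym) {n} (a : Vec Elem n) (n≡ : n ≡ arityᶠ F) where
      s : ℕ
      s = proj₁ (live a)
      xs : List ℕ
      xs = rawᴹ a
      xs< : InRange (size s) xs
      xs< = proj₂ (live a)
      ĥ : Σ[ b ∈ Vec ∣ ⟦ struct (𝕜 s) ⟧ ∣ (arityᶠ F) ] raw (struct (𝕜 s)) b ≡ 𝕓 s ⟨$⟩ xs
      ĥ = typed (struct (𝕜 s)) (≃-reindex (valid s) xs xs<)
        (trans (length-map (nth (𝕓 s)) xs) (trans (length-toList (map proj₁ a)) n≡))
      v : ∣ ⟦ struct (𝕜 s) ⟧ ∣
      v = Structure.fun ⟦ struct (𝕜 s) ⟧ F (proj₁ ĥ)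
      𝕓⁺ : List ℕ
      𝕓⁺ = 𝕓 s ++ proj₁ v ∷ []
      |𝕓⁺| : length 𝕓⁺ ≡ size s + 1
      |𝕓⁺| = length-++ (𝕓 s)
      s<𝕓⁺ : size s < length 𝕓⁺
      s<𝕓⁺ = ≤-reflexive (trans (+-comm 1 (size s)) (sym |𝕓⁺|))
      over : Over (𝕜 s) (𝕓 s ⟨$⟩ upTo (size s)) (𝕜 s) 𝕓⁺ (upTo (size s))
      over = inRange-≤ (<⇒≤ s<𝕓⁺) (all-upTo (size s)) , ++-valid (valid s) (≃-refl {𝓐 = struct (𝕜 s)} (v ∷ [])) ,
        subst₂ (λ y z → 𝕜 s ∶ y ≃ 𝕜 s ∶ z) (sym (⟨$⟩-upTo (𝕓 s))) (sym (++-⟨$⟩-upTo (𝕓 s) (proj₁ v ∷ []))) (valid s)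
      realized : ∃[ t ] ∃[ q ] (s ≤ t × InRange (size t) q × 𝕜 t ∶ 𝕓 t ⟨$⟩ q ≃ 𝕜 s ∶ 𝕓⁺ × q ⟨$⟩ upTo (size s) ≡ upTo (size s))
      realized = realize s (all-upTo (size s)) over (subst (Base (𝕜 s)) (sym (⟨$⟩-upTo (𝕓 s))) (proj₂ (proj₂ (good s))))
      moved : ∀ {t} q → 𝕜 t ∶ 𝕓 t ⟨$⟩ q ≃ 𝕜 s ∶ 𝕓⁺ → q ⟨$⟩ upTo (size s) ≡ upTo (size s) →
        size s < length q × 𝕜 s ∶ proj₁ v ∷ 𝕓 s ⟨$⟩ xs ≃ 𝕜 t ∶ 𝕓 t ⟨$⟩ (nth q (size s) ∷ xs)
      moved {t} q same eq = inQ s<𝕓⁺ , subst₂ (λ y z → 𝕜 s ∶ y ≃ 𝕜 t ∶ z)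
          (cong₂ _∷_ (nth-length (𝕓 s) (proj₁ v) []) (⟨$⟩-++ (𝕓 s) _ xs xs<))
          (trans (sym (⟨$⟩-assoc (𝕓 t) q (size s ∷ xs) (All.map inQ τ<𝕓⁺))) (cong (λ z → 𝕓 t ⟨$⟩ (nth q (size s) ∷ z)) q⟨xs⟩))
          (≃-reindex (≃-sym same) (size s ∷ xs) τ<𝕓⁺)
        where
        inQ : ∀ {i} → i < length 𝕓⁺ → i < length q
        inQ {i} = subst (i <_) (sym (trans (sym (length-map (nth (𝕓 t)) q)) (≃-length same)))
        τ<𝕓⁺ : InRange (length 𝕓⁺) (size s ∷ xs)
        τ<𝕓⁺ = s<𝕓⁺ ∷ inRange-≤ (<⇒≤ s<𝕓⁺) xs<
        q⟨xs⟩ : q ⟨$⟩ xs ≡ xs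
        q⟨xs⟩ = trans (cong (q ⟨$⟩_) (sym (upTo-⟨$⟩ xs xs<))) (trans (⟨$⟩-assoc q (upTo (size s)) xs
          (subst (λ n → InRange n xs) (sym (length-upTo (size s))) xs<)) (trans (cong (_⟨$⟩ xs) eq) (upTo-⟨$⟩ xs xs<)))

      value-exists : ∃[ y ] (Domain y × FunValue (proj₁ F) xs y)
      value-exists = finish realized
        where
        finish : (∃[ t ] ∃[ q ] (s ≤ t × InRange (size t) q × 𝕜 t ∶ 𝕓 t ⟨$⟩ q ≃ 𝕜 s ∶ 𝕓⁺ × q ⟨$⟩ upTo (size s) ≡ upTo (size s))) →
          ∃[ y ] (Domain y × FunValue (proj₁ F) xs y)
        finish (t , q , s≤t , q< , same , eq) = nth q (size s) , (t , y<) , t , y< ∷ inRange-≤ (size-mono s≤t) xs< ,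
          ≃-fun {r = proj₁ F} (proj₂ (moved q same eq))
            (subst (λ z → FunDiagram (struct (𝕜 s)) ⟨ proj₁ F , ⟨ encode z , proj₁ v ⟩ ⟩) (proj₂ ĥ)
              (fun-diagram (struct (𝕜 s)) F (proj₁ ĥ)))
          where
          y< : nth q (size s) < size t
          y< = nth< q q< (proj₁ (moved q same eq))

  abstract
    funValue-exists : ∀ F (a : Vec Elem (arityᶠ F)) → ∃[ y ] (Domain y × FunValue (proj₁ F) (rawᴹ a) y)
    funValue-exists F a = AddValue.value-exists F a refl

  𝓜 : ωStructure L
  𝓜 = record
    { dom = Domain
    ; interpretation = record
      { rel      = λ R a → RelHolds (proj₁ R) (rawᴹ a)
      ; fun      = λ F a → let y , y∈ , _ = funValue-exists F a in y , y∈
      ; rel-resp = λ R {a} {b} a≈b → subst (RelHolds (proj₁ R)) (raw-cong a≈b)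
      ; fun-cong = λ F {a} {b} a≈b → funValue-unique {proj₁ F} {rawᴹ b}
          (subst (λ xs → FunValue (proj₁ F) xs (proj₁ (funValue-exists F a))) (raw-cong a≈b)
            (proj₂ (proj₂ (funValue-exists F a))))
          (proj₂ (proj₂ (funValue-exists F b)))
      }
    }
    where
    raw-cong : ∀ {n} {a b : Vec Elem n} → Pointwise (λ x y → proj₁ x ≡ proj₁ y) a b → rawᴹ a ≡ rawᴹ b
    raw-cong []         = refl
    raw-cong (eq ∷ eqs) = cong₂ _∷_ eq (raw-cong eqs)

  𝐌 : Structure L
  𝐌 = ⟦ 𝓜 ⟧

  private
    module M = Structure 𝐌

    Evaluates : ∀ {n} (a : Vec Elem n) (τ : Term {L} n) → ℕ → Set
    Evaluates {n} a τ t = ∀ (c : Vec ∣ ⟦ struct (𝕜 t) ⟧ ∣ n) → raw (struct (𝕜 t)) c ≡ 𝕓 t ⟨$⟩ rawᴹ a →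
      proj₁ (value 𝐌 a τ) < size t × nth (𝕓 t) (proj₁ (value 𝐌 a τ)) ≡ proj₁ (value ⟦ struct (𝕜 t) ⟧ c τ)

    Evaluates* : ∀ {n m} (a : Vec Elem n) (τs : Vec (Term {L} n) m) → ℕ → Set
    Evaluates* {n} a τs t = ∀ (c : Vec ∣ ⟦ struct (𝕜 t) ⟧ ∣ n) → raw (struct (𝕜 t)) c ≡ 𝕓 t ⟨$⟩ rawᴹ a →
      InRange (size t) (rawᴹ (values 𝐌 a τs)) ×
      𝕓 t ⟨$⟩ rawᴹ (values 𝐌 a τs) ≡ raw (struct (𝕜 t)) (values ⟦ struct (𝕜 t) ⟧ c τs)

    -- The values of all subterms must have become entries of the tuple before the evaluation in the
    -- limit can be compared with that at a stage, so the threshold depends on the term.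
    evaluates : ∀ {n} (a : Vec Elem n) τ → ∃[ s ] (∀ t → s ≤ t → Evaluates a τ t)
    evaluates* : ∀ {n m} (a : Vec Elem n) (τs : Vec (Term n) m) → ∃[ s ] (∀ t → s ≤ t → Evaluates* a τs t)
    evaluates a (var i) = let s , i< = proj₂ (lookup a i) in s , λ t s≤t c c≡ →
      <-≤-trans i< (size-mono s≤t) , at t c a i c≡
      where
      at : ∀ t {n} (c : Vec ∣ ⟦ struct (𝕜 t) ⟧ ∣ n) (a : Vec Elem n) i → raw (struct (𝕜 t)) c ≡ 𝕓 t ⟨$⟩ rawᴹ a →
        nth (𝕓 t) (proj₁ (lookup a i)) ≡ proj₁ (lookup c i)
      at t (x ∷ c) (y ∷ a) Fin.zero    eq = sym (proj₁ (∷-injective eq))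
      at t (x ∷ c) (y ∷ a) (Fin.suc i) eq = at t c a i (proj₂ (∷-injective eq))
    evaluates a (app F τs) = let s , ev = evaluates* a τs
                                 vs = values 𝐌 a τs
                                 v , (u , v<) , val = funValue-exists F vs
      in s ⊔ u , λ t s⊔u≤t c c≡ →
        let vs< , vs≡ = ev t (≤-trans (m≤m⊔n s u) s⊔u≤t) c c≡
            v<t = <-≤-trans v< (size-mono (≤-trans (m≤n⊔m s u) s⊔u≤t))
        in v<t , fun-diagram-functional (struct (𝕜 t)) {proj₁ F} {𝕓 t ⟨$⟩ rawᴹ vs}
             (funValue-at {proj₁ F} {rawᴹ vs} {v} val (v<t ∷ vs<))
             (subst (λ z → FunDiagram (struct (𝕜 t)) ⟨ proj₁ F , ⟨ encode z , _ ⟩ ⟩) (sym vs≡)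
               (fun-diagram (struct (𝕜 t)) F (values ⟦ struct (𝕜 t) ⟧ c τs)))
    evaluates* a []       = 0 , λ t _ c c≡ → [] , refl
    evaluates* a (τ ∷ τs) = let s , ev = evaluates a τ
                                u , evs = evaluates* a τs
      in s ⊔ u , λ t s⊔u≤t c c≡ →
        let y< , y≡ = ev t (≤-trans (m≤m⊔n s u) s⊔u≤t) c c≡
            ys< , ys≡ = evs t (≤-trans (m≤n⊔m s u) s⊔u≤t) c c≡
        in y< ∷ ys< , cong₂ _∷_ y≡ ys≡

    satisfies : ∀ {n} (a : Vec Elem n) ψ → ∃[ s ] (∀ t → s ≤ t →
      ∀ (c : Vec ∣ ⟦ struct (𝕜 t) ⟧ ∣ n) → raw (struct (𝕜 t)) c ≡ 𝕓 t ⟨$⟩ rawᴹ a →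
      Satisfies 𝐌 a ψ ⇔ Satisfies ⟦ struct (𝕜 t) ⟧ c ψ)
    satisfies a (τ ≐ υ) = let s , ev = evaluates a τ
                              u , ev′ = evaluates a υ
      in s ⊔ u , λ t s⊔u≤t c c≡ →
        let y< , y≡ = ev t (≤-trans (m≤m⊔n s u) s⊔u≤t) c c≡
            z< , z≡ = ev′ t (≤-trans (m≤n⊔m s u) s⊔u≤t) c c≡
        in mk⇔ (λ eq → trans (sym y≡) (trans (cong (nth (𝕓 t)) eq) z≡))
               (λ eq → distinct t _ _ y< z< (trans y≡ (trans eq (sym z≡))))
    satisfies a (relᵃ R τs) = let s , ev = evaluates* a τs in s , λ t s≤t c c≡ →
      let ys< , ys≡ = ev t s≤t c c≡
          e = rel-diagram (struct (𝕜 t)) R (values ⟦ struct (𝕜 t) ⟧ c τs)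
      in mk⇔ (λ r → to e (subst (λ z → RelDiagram (struct (𝕜 t)) ⟨ proj₁ R , encode z ⟩) ys≡ (relHolds-at {proj₁ R} r ys<)))
             (λ r → t , ys< , subst (λ z → RelDiagram (struct (𝕜 t)) ⟨ proj₁ R , encode z ⟩) (sym ys≡) (from e r))

  elements : ∀ {s xs} → InRange (size s) xs → Σ[ a ∈ Vec Elem (length xs) ] raw 𝓜 a ≡ xs
  elements []         = [] , refl
  elements (x< ∷ xs<) = let a , a≡ = elements xs< in (_ , _ , x<) ∷ a , cong (_ ∷_) a≡

  -- The comparison in `satisfies` is available only from a stage depending on the formula. Passing
  -- to such a stage and back by coherence shows that the type at stage `s` is already the one in
  -- the limit.
  at-stage : ∀ {s xs} → InRange (size s) xs → SameType 𝓜 (struct (𝕜 s)) xs (𝕓 s ⟨$⟩ xs)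
  at-stage {s} {xs} xs< =
    let a , a≡ = elements xs<
        â , â≡ = typed (struct (𝕜 s)) (≃-reindex (valid s) xs xs<) (length-map (nth (𝕓 s)) xs)
    in mkSameType a â a≡ â≡ λ ψ →
      let u , sat = satisfies a ψ
          t = s ⊔ u
          xs<t = inRange-≤ (size-mono (m≤m⊔n s u)) xs<
          s≃t = coherent (m≤m⊔n s u) xs<
          â′ , â′≡ , same = retype s≃t â â≡
          e = sat t (m≤n⊔m s u) â′ (trans â′≡ (cong (𝕓 t ⟨$⟩_) (sym a≡)))
      in mk⇔ (from (same ψ) ∘ to e) (from e ∘ to (same ψ))

-- Computability of the limit and its cofinal collection

enumerates : {R : ℕ → ℕ → Set} (r : RecPred O (Uncurry R)) → Enumerates O ⌜ searchᶜ r ⌝ (λ x → ∃ (R x))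
enumerates {O} {R} r x = mk⇔
  (λ (y , Rxy) → let n , _ , run = searchᶜ-halts r x (uncurried⁺ R {x} {y} Rxy) in n , searchᶜ r , refl , run)
  (λ (y , p) → y , uncurried⁻ R {x} {y} (searchᶜ-sound r x (φ-⌜⌝ (searchᶜ r) p)))

enumerates-⇔ : ∀ {A B : Pred ℕ 0ℓ} {e} → (∀ x → A x ⇔ B x) → Enumerates O e A → Enumerates O e B
enumerates-⇔ A⇔B enum x = mk⇔ (to (enum x) ∘ from (A⇔B x)) (to (A⇔B x) ∘ from (enum x))

decides : ∀ {P : Pred ℕ 0ℓ} (r : RecPred O P) → Decides O ⌜ program (RecPred.characteristic r) ⌝ P
decides {O} {P} r x =
  (λ p → _ , refl , subst (O ⊢ _ [ x ]⇓_) (yes-1 (RecPred.decide r x) p) (correct (RecPred.characteristic r) x)) ,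
  (λ ¬p → _ , refl , subst (O ⊢ _ [ x ]⇓_) (no-0 (RecPred.decide r x) ¬p) (correct (RecPred.characteristic r) x))
  where
  yes-1 : ∀ {A : Set} (d : Dec A) → A → bit d ≡ 1
  yes-1 (yes _) _ = refl
  yes-1 (no ¬a) a = contradiction a ¬a
  no-0 : ∀ {A : Set} (d : Dec A) → ¬ A → bit d ≡ 0
  no-0 (yes a) ¬a = contradiction a ¬a
  no-0 (no _) _ = refl

module LimitStructure (em : ExcludedMiddle (lsuc 0ℓ)) {L : Language} {K : Pred (Structure L) (lsuc 0ℓ)}
             (𝕂 : Enumeration L) (ix : ℕ → ℕ) (rep : Represents 𝕂 ∅ ix K) (jep : JEP K) (cap : CAP K) where
  open Classical em
  open Enumeration 𝕂
  open Types 𝕂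
  open Decidability em 𝕂 ix rep
  open Chain em 𝕂 ix rep jep cap
  open Model em 𝕂 ix rep jep cap public

  private
    Elem = ∣ 𝐌 ∣

  -- The domain is an initial segment of ℕ; which one is not found effectively.

  domain-segment : (∀ i → Domain i) ⊎ ∃[ n ] (∀ i → Domain i ⇔ i < n)
  domain-segment with em₀ (∃[ i ] ¬ Domain i)
  ... | no none = inj₁ (λ i → decidable-stable (em₀ (Domain i)) (λ ¬i → none (i , ¬i)))
  ... | yes some = let n , n∉ , below = least (λ i → em₀ (¬ Domain i)) some in
    inj₂ (n , λ i → mk⇔ (λ (s , i<) → ≰⇒> (λ n≤i → n∉ (s , ≤-<-trans n≤i i<)))
      (λ i<n → decidable-stable (em₀ (Domain i)) (below i i<n)))

  -- The domain is given by an unbounded search over stages, and no further jump is available to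
  -- decide it. An initial segment nevertheless has a decision procedure: a constant answer, or
  -- comparison with `n`.
  allDomainᵖ : RecList 𝔼″ F → RecPred 𝔼″ (λ x → All Domain (F x))
  allDomainᵖ r with domain-segment
  ... | inj₁ all = mapᵖ (λ x → mk⇔ (λ _ → All.universal all _) (λ _ → refl)) (rec-const 0 ≡ᵖ rec-const 0)
  ... | inj₂ (n , seg) = mapᵖ (λ x → mk⇔ (All.map (λ {i} → from (seg i))) (All.map (λ {i} → to (seg i))))
    (inRangeᵖ (rec-const n) r)

  domainᵖ : RecPred 𝔼″ Domain
  domainᵖ = mapᵖ (λ x → mk⇔ (λ { (p ∷ []) → p }) (_∷ []))
    (allDomainᵖ {F = _∷ []} (mkRecList (rec-suc ⊙ ⟪ rec-id , rec-const 0 ⟫)))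

  allDomain-raw : ∀ {n} (a : Vec Elem n) → All Domain (raw 𝓜 a)
  allDomain-raw []             = []
  allDomain-raw ((_ , i∈) ∷ a) = i∈ ∷ allDomain-raw a

  allDomain⇒live : ∀ {xs} → All Domain xs → ∃[ s ] InRange (size s) xs
  allDomain⇒live []              = 0 , []
  allDomain⇒live ((s , i<) ∷ xs) = let t , xs< = allDomain⇒live xs in
    s ⊔ t , <-≤-trans i< (size-mono (m≤m⊔n s t)) ∷ inRange-≤ (size-mono (m≤n⊔m s t)) xs<

  live⇒allDomain : ∀ {s xs} → InRange (size s) xs → All Domain xs
  live⇒allDomain {s} = All.map (s ,_)

  -- The diagrams of the limit

  private
    module _ (D : ωStructure L → Pred ℕ 0ℓ)
             (D-raw : ∀ {x} → D 𝓜 x → ∃[ n ] Σ[ a ∈ Vec Elem n ] (π₂ x ≡ encode (raw 𝓜 a)))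
             (D-≃ : ∀ {𝓐 𝓑 r xs ys} → SameType 𝓐 𝓑 xs ys → D 𝓐 ⟨ r , encode xs ⟩ → D 𝓑 ⟨ r , encode ys ⟩)
             (Dᵖ : RecPred (𝔼 ′) (Uncurry (λ k → D (struct k)))) where

      AtStage : ℕ → ℕ → Set
      AtStage x s = InRange (size s) (decode (π₂ x)) × D (struct (𝕜 s)) ⟨ π₁ x , encode (𝕓 s ⟨$⟩ decode (π₂ x)) ⟩

      atStageᵖ : RecPred 𝔼″ (Uncurry AtStage)
      atStageᵖ = inRangeᵖ (rec-size ⊙ rec-π₂) xs ×ᵖ
        apᵖ {R = λ k → D (struct k)} (jumpᵖ Dᵖ) (rec-𝕜 ⊙ rec-π₂) ⟪ rec-π₁ ⊙ rec-π₁ , encoded (rec-⟨$⟩ (rec-𝕓 ⊙ˡ rec-π₂) xs) ⟫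
        where
        xs : RecList 𝔼″ (λ e → decode (π₂ (π₁ e)))
        xs = rec-decode (rec-π₂ ⊙ rec-π₁)

      -- The positive and the negative diagram are treated alike. Both depend on types only, so
      -- membership can be read off at any stage where the entries are present.
      diagram-ce : CE 𝔼″ (D 𝓜)
      diagram-ce = ⌜ searchᶜ atStageᵖ ⌝ , enumerates-⇔ (λ x → mk⇔ (sound x) (complete x)) (enumerates {R = AtStage} atStageᵖ)
        where
        split : ∀ x → ⟨ π₁ x , encode (decode (π₂ x)) ⟩ ≡ x
        split x = trans (cong ⟨ π₁ x ,_⟩ (encode-decode (π₂ x))) (pair-unpair x)
        sound : ∀ x → ∃ (AtStage x) → D 𝓜 x
        sound x (s , xs< , d) = subst (D 𝓜) (split x) (D-≃ {r = π₁ x} (≃-sym (at-stage xs<)) d)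
        complete : ∀ x → D 𝓜 x → ∃ (AtStage x)
        complete x d =
          let _ , a , eq = D-raw d
              s , a< = live a
              xs< = subst (InRange (size s)) (trans (sym (decode-encode (raw 𝓜 a))) (cong decode (sym eq))) a<
          in s , xs< , D-≃ {r = π₁ x} (at-stage xs<) (subst (D 𝓜) (sym (split x)) d)

  rel-ce : CE 𝔼″ (RelDiagram 𝓜)
  rel-ce = diagram-ce RelDiagram
    (λ (R , a , eq , _) → _ , a , trans (cong π₂ eq) (trans (π₂-pair (proj₁ R) (code 𝓜 a)) (code≡encode 𝓜 a)))
    (λ {_} {_} {r} → ≃-rel {r = r}) relDiagramᵖ

  neg-ce : CE 𝔼″ (NegRelDiagram 𝓜)
  neg-ce = diagram-ce NegRelDiagram
    (λ (R , a , eq , _) → _ , a , trans (cong π₂ eq) (trans (π₂-pair (proj₁ R) (code 𝓜 a)) (code≡encode 𝓜 a)))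
    (λ {_} {_} {r} → ≃-neg {r = r}) negDiagramᵖ

  private
    FunAt : ℕ → ℕ → Set
    FunAt x s = InRange (size s) (π₂ (π₂ x) ∷ decode (π₁ (π₂ x))) ×
      FunDiagram (struct (𝕜 s)) ⟨ π₁ x , ⟨ encode (𝕓 s ⟨$⟩ decode (π₁ (π₂ x))) , nth (𝕓 s) (π₂ (π₂ x)) ⟩ ⟩

    funAtᵖ : RecPred 𝔼″ (Uncurry FunAt)
    funAtᵖ = inRangeᵖ (rec-size ⊙ rec-π₂) (mkRecList (rec-suc ⊙ ⟪ rec-y , encoded rec-ys ⟫)) ×ᵖ
      apᵖ {R = λ k → FunDiagram (struct k)} (jumpᵖ funDiagramᵖ) (rec-𝕜 ⊙ rec-π₂)
        ⟪ rec-π₁ ⊙ rec-π₁ , ⟪ encoded (rec-⟨$⟩ (rec-𝕓 ⊙ˡ rec-π₂) rec-ys) , rec-nth (rec-𝕓 ⊙ˡ rec-π₂) rec-y ⟫ ⟫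
      where
      rec-y : Rec 𝔼″ (λ e → π₂ (π₂ (π₁ e)))
      rec-y = rec-π₂ ⊙ rec-π₂ ⊙ rec-π₁
      rec-ys : RecList 𝔼″ (λ e → decode (π₁ (π₂ (π₁ e))))
      rec-ys = rec-decode (rec-π₁ ⊙ rec-π₂ ⊙ rec-π₁)

  fun-ce : CE 𝔼″ (FunDiagram 𝓜)
  fun-ce = ⌜ searchᶜ funAtᵖ ⌝ , enumerates-⇔ (λ x → mk⇔ (sound x) (complete x)) (enumerates {R = FunAt} funAtᵖ)
    where
    split : ∀ x → ⟨ π₁ x , ⟨ encode (decode (π₁ (π₂ x))) , π₂ (π₂ x) ⟩ ⟩ ≡ x
    split x = trans (cong ⟨ π₁ x ,_⟩ (trans (cong ⟨_, π₂ (π₂ x) ⟩ (encode-decode (π₁ (π₂ x)))) (pair-unpair (π₂ x))))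
      (pair-unpair x)
    sound : ∀ x → ∃ (FunAt x) → FunDiagram 𝓜 x
    sound x (s , xs< , d) = subst (FunDiagram 𝓜) (split x) (≃-fun {r = π₁ x} (≃-sym (at-stage xs<)) d)
    complete : ∀ x → FunDiagram 𝓜 x → ∃ (FunAt x)
    complete x d@(F , a , eq) =
      let v = Structure.fun 𝐌 F a
          s , a< = live (v ∷ a)
          eqs = trans (cong π₂ eq) (π₂-pair (proj₁ F) ⟨ code 𝓜 a , proj₁ v ⟩)
          eq-a = trans (cong π₁ eqs) (trans (π₁-pair (code 𝓜 a) (proj₁ v)) (code≡encode 𝓜 a))
          eq-v = trans (cong π₂ eqs) (π₂-pair (code 𝓜 a) (proj₁ v))
          xs< = subst (InRange (size s)) (cong₂ _∷_ (sym eq-v)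
            (trans (sym (decode-encode (raw 𝓜 a))) (cong decode (sym eq-a)))) a<
      in s , xs< , ≃-fun {r = π₁ x} (at-stage xs<) (subst (FunDiagram 𝓜) (sym (split x)) d)

  𝓜-computable : IsComputableStructure 𝔼″ 𝓜
  𝓜-computable = _ , record
    { packed         = refl
    ; dom-decides    = decides domainᵖ
    ; rel-enumerates = proj₂ rel-ce
    ; neg-enumerates = proj₂ neg-ce
    ; fun-enumerates = proj₂ fun-ce
    }

  -- Tuples generating an amalgamation base

  Generating : List ℕ → Set
  Generating xs = ∃[ s ] (InRange (size s) xs × Base (𝕜 s) (𝕓 s ⟨$⟩ xs))

  generating-at : ∀ {xs} → Generating xs → ∀ {t} → InRange (size t) xs → Base (𝕜 t) (𝕓 t ⟨$⟩ xs)
  generating-at (s , xs<s , base) xs<t = base-≃ (coherent₂ xs<s xs<t) base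

  private
    -- Properties of lists in the limit are tested at one stage, which has to be found effectively.
    -- Lists outside the domain satisfy the relation vacuously, so the search is total.
    stage : Σ[ f ∈ (ℕ → ℕ) ] (Rec 𝔼″ f × (∀ x → All Domain (decode x) → InRange (size (f x)) (decode x)))
    stage = choose (λ x s → All Domain (decode x) → InRange (size s) (decode x))
      (allDomainᵖ (rec-decode rec-π₁) →ᵖ inRangeᵖ (rec-size ⊙ rec-π₂) (rec-decode rec-π₁)) total
      where
      total : ∀ x → ∃[ s ] (All Domain (decode x) → InRange (size s) (decode x))
      total x with em₀ (All Domain (decode x))
      ... | yes all = let s , < = allDomain⇒live all in s , λ _ → <
      ... | no ¬all = 0 , λ all → contradiction all ¬all

  abstract
    stageOf : List ℕ → ℕ
    stageOf xs = proj₁ stage (encode xs)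

    rec-stageOf : RecList 𝔼″ F → Rec 𝔼″ (stageOf ∘ F)
    rec-stageOf r = proj₁ (proj₂ stage) ⊙ encoded r

    stageOf-live : ∀ {xs} → All Domain xs → InRange (size (stageOf xs)) xs
    stageOf-live {xs} xs∈ = subst (InRange (size (stageOf xs))) (decode-encode xs)
      (proj₂ (proj₂ stage) (encode xs) (subst (All Domain) (sym (decode-encode xs)) xs∈))

  generatingᵖ : RecList 𝔼″ F → RecPred 𝔼″ (λ x → Generating (F x))
  generatingᵖ {F = F} r = mapᵖ (λ x → mk⇔
      (λ (xs∈ , base) → stageOf (F x) , stageOf-live xs∈ , base)
      (λ gen@(s , xs< , _) → live⇒allDomain xs< , generating-at gen (stageOf-live (live⇒allDomain xs<))))
    (allDomainᵖ r ×ᵖ baseᵖ (rec-𝕜 ⊙ s) (rec-⟨$⟩ (rec-𝕓 ⊙ˡ s) r))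
    where
    s : Rec 𝔼″ (stageOf ∘ F)
    s = rec-stageOf r

  private
    raw-++ : ∀ {m n} (a : Vec Elem m) (b : Vec Elem n) → raw 𝓜 (a Vec.++ b) ≡ raw 𝓜 a ++ raw 𝓜 b
    raw-++ []      b = refl
    raw-++ (x ∷ a) b = cong (proj₁ x ∷_) (raw-++ a b)

  ∋⇒∈cl : ∀ {n} (b : Vec Elem n) {x} → raw 𝓜 b ∋ proj₁ x → cl 𝐌 b x
  ∋⇒∈cl {n} b (i , i< , eq) =
    let i<n = subst (i <_) (length-raw 𝓜 b) i<
    in cl-resp (trans (sym (nth-raw 𝓜 b (fromℕ< i<n))) (trans (cong (nth (raw 𝓜 b)) (toℕ-fromℕ< i<n)) eq)) (cl-gen (fromℕ< i<n))

  -- The tuple `b` consists of all positions below `size s`, that is, of the whole of `𝕓 s`, which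
  -- generates a base and contains `a` for `s` large enough.
  generating-cofinal : ∀ {n} (a : Vec Elem n) → ∃[ m ] Σ[ b ∈ Vec Elem m ] (Generating (raw 𝓜 b) × InClosure 𝐌 a b)
  generating-cofinal a =
    let s , a< = live a
        b , b≡ = elements (all-upTo (size s))
    in _ , b , subst Generating (sym b≡)
         (s , all-upTo (size s) , subst (Base (𝕜 s)) (sym (⟨$⟩-upTo (𝕓 s))) (proj₂ (proj₂ (good s))))
     , closure (size s) b b≡ a a<
    where
    closure : ∀ n {m} (b : Vec Elem m) → raw 𝓜 b ≡ upTo n → ∀ {k} (a : Vec Elem k) → InRange n (raw 𝓜 a) → InClosure 𝐌 a b
    closure n b b≡ []      []        = Allᵛ.[]
    closure n b b≡ (x ∷ a) (x< ∷ a<) = ∋⇒∈cl b (subst (_∋ proj₁ x) (sym b≡)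
        (proj₁ x , subst (proj₁ x <_) (sym (length-upTo n)) x< , proj₁ (∷-injective (upTo-⟨$⟩ (proj₁ x ∷ []) (x< ∷ [])))))
      Allᵛ.∷ closure n b b≡ a a<

  -- An element of the closure is the value of a term `τ`, so in every copy of `x ∷ b` the head is
  -- determined by the tail, and `base-determined` applies.
  generating-∷ : ∀ {n} (b : Vec Elem n) x → Generating (raw 𝓜 b) → cl 𝐌 b x → Generating (raw 𝓜 (x ∷ b))
  generating-∷ {n} b x gen x∈ = s , xs< ,
    base-determined tail (subst (λ m → InRange m tail) (sym |xs|) tail<) determined
      (subst (Base (𝕜 s)) (sym tail≡) (generating-at gen (All.tail xs<)))
    where
    s = proj₁ (live (x ∷ b))
    xs = raw 𝓜 (x ∷ b)
    xs< = proj₂ (live (x ∷ b))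
    tail = applyUpTo suc n
    tail< : InRange (suc n) tail
    tail< = applyUpTo⁺₁ suc n s<s
    |xs| : length (𝕓 s ⟨$⟩ xs) ≡ suc n
    |xs| = trans (length-map (nth (𝕓 s)) xs) (length-raw 𝓜 (x ∷ b))
    dropHead : ∀ y ys → length ys ≡ n → (y ∷ ys) ⟨$⟩ tail ≡ ys
    dropHead y ys refl = ⟨$⟩-applyUpTo ys {y ∷ ys} (λ _ → refl)
    tail≡ : 𝕓 s ⟨$⟩ xs ⟨$⟩ tail ≡ 𝕓 s ⟨$⟩ raw 𝓜 b
    tail≡ = dropHead _ (𝕓 s ⟨$⟩ raw 𝓜 b) (suc-injective |xs|)
    τ = proj₁ (cl⇒term 𝐌 b x∈)
    later : Vec (Fin (suc n)) n
    later = map Fin.suc (Vec.allFin n)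
    map-later : ∀ {A : Set} (y : A) (ys : Vec A n) → map (lookup (y ∷ ys)) later ≡ ys
    map-later y ys = trans (sym (map-∘ (lookup (y ∷ ys)) Fin.suc (Vec.allFin n))) (map-lookup-allFin ys)
    head-value : ∀ {m} (C : Vec ∣ ⟦ struct m ⟧ ∣ (suc n)) → SameAtomicType 𝐌 ⟦ struct m ⟧ (x ∷ b) C →
      proj₁ (Vec.head C) ≡ proj₁ (value ⟦ struct m ⟧ (Vec.tail C) τ)
    head-value {m} (y ∷ C) same = trans
      (to (same (var Fin.zero ≐ rename later τ)) (trans (sym (proj₂ (cl⇒term 𝐌 b x∈)))
        (cong proj₁ (trans (sym (cong (λ v → value 𝐌 v τ) (map-later x b))) (value-rename later 𝐌 (x ∷ b) τ)))))
      (cong proj₁ (trans (sym (value-rename later ⟦ struct m ⟧ (y ∷ C) τ)) (cong (λ v → value ⟦ struct m ⟧ v τ) (map-later y C))))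
    determined : Determined (𝕜 s) (𝕓 s ⟨$⟩ xs) tail
    determined {m} {u} {v} su sv eq = finish (image su) (image sv)
      where
      Image : List ℕ → Set
      Image u = Σ[ c ∈ Vec ∣ ⟦ struct m ⟧ ∣ (suc n) ]
        (raw (struct m) c ≡ u × SameAtomicType 𝐌 ⟦ struct m ⟧ (x ∷ b) c)
      image : ∀ {u} → 𝕜 s ∶ 𝕓 s ⟨$⟩ xs ≃ m ∶ u → Image u
      image su = retype (≃-trans (at-stage xs<) su) (x ∷ b) refl
      finish : Image u → Image v → u ≡ v
      finish (y ∷ c , refl , same) (z ∷ d , refl , same′) =
        let c≡d = trans (sym (dropHead _ _ (length-raw (struct m) c))) (trans eq (dropHead _ _ (length-raw (struct m) d)))
        in cong₂ _∷_ (trans (head-value (y ∷ c) same)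
             (trans (value-cong ⟦ struct m ⟧ (raw⁻ (struct m) c d c≡d) τ) (sym (head-value (z ∷ d) same′)))) c≡d

  generating-++ : ∀ {m n} (b : Vec Elem n) (a : Vec Elem m) → Generating (raw 𝓜 b) → InClosure 𝐌 a b →
    Generating (raw 𝓜 (a Vec.++ b))
  generating-++ b []      gen Allᵛ.[]          = gen
  generating-++ b (x ∷ a) gen (x∈ Allᵛ.∷ a∈) = generating-∷ (a Vec.++ b) x (generating-++ b a gen a∈)
    (cl-mono 𝐌 (weaken a b id) x∈)
    where
    weaken : ∀ {m n k} (a : Vec Elem m) (b : Vec Elem n) {c : Vec Elem k} →
      (∀ {x} → raw 𝓜 (a Vec.++ b) ∋ x → raw 𝓜 c ∋ x) → Allᵛ.All (cl 𝐌 c) b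
    weaken a []      inc = Allᵛ.[]
    weaken a (y ∷ b) {c} inc = ∋⇒∈cl c (inc (subst (_∋ proj₁ y) (sym (raw-++ a (y ∷ b))) (∋-++ʳ (raw 𝓜 a) (0 , z<s , refl))))
      Allᵛ.∷ weaken a b (λ {z} z∈ → inc (subst (_∋ z) (sym (raw-++ a (y ∷ b))) (shift (raw 𝓜 a) (subst (_∋ z) (raw-++ a b) z∈))))
      where
      shift : ∀ xs {y ys z} → xs ++ ys ∋ z → xs ++ y ∷ ys ∋ z
      shift []       (i , i< , eq)           = suc i , s≤s i< , eq
      shift (x ∷ xs) (zero , _ , eq)         = zero , z<s , eq
      shift (x ∷ xs) (suc i , s≤s i< , eq)   = let j , j< , eq′ = shift xs (i , i< , eq) in suc j , s≤s j< , eq′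

  generating-≃ : ∀ {xs ys} → Generating xs → SameType 𝓜 𝓜 xs ys → Generating ys
  generating-≃ {xs} {ys} gen@(s , xs< , _) same =
    let t , ys< = allDomain⇒live (domain-tuple same)
        u = s ⊔ t
        xs<u = inRange-≤ (size-mono (m≤m⊔n s t)) xs<
        ys<u = inRange-≤ (size-mono (m≤n⊔m s t)) ys<
    in u , ys<u , base-≃ (≃-trans (≃-sym (at-stage xs<u)) (≃-trans same (at-stage ys<u))) (generating-at gen xs<u)
    where
    domain-tuple : ∀ {xs ys} → SameType 𝓜 𝓜 xs ys → All Domain ys
    domain-tuple (mkSameType _ b _ refl _) = allDomain-raw b

  generating-isCofinal : IsCofinal 𝐌 (λ a → Generating (raw 𝓜 a))
  generating-isCofinal = record
    { cofinal   = generating-cofinal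
    ; extend    = generating-++
    ; invariant = λ a b gen same → generating-≃ gen (mkSameType a b refl refl same)
    }

  generating-computable : Computable 𝔼″ (λ x → ∃[ n ] Σ[ a ∈ Vec Elem n ] (x ≡ code 𝓜 a × Generating (raw 𝓜 a)))
  generating-computable = _ , decides (mapᵖ (λ x → mk⇔
      (λ gen@(s , xs< , _) → let a , a≡ = elements xs< in
        _ , a , trans (sym (encode-decode x)) (trans (cong encode (sym a≡)) (sym (code≡encode 𝓜 a))) ,
        subst Generating (sym a≡) gen)
      (λ (n , a , eq , gen) → subst Generating
        (trans (sym (decode-encode (raw 𝓜 a))) (cong decode (trans (sym (code≡encode 𝓜 a)) (sym eq)))) gen))
    (generatingᵖ (rec-decode rec-id)))

-- The age of the limit

decides-translate : ∀ {e} {A : Pred ℕ 0ℓ} → Decides ∅ e A → Decides O (translate e) A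
decides-translate {e = e} dec x = to (φ-translate e) ∘ proj₁ (dec x) , to (φ-translate e) ∘ proj₂ (dec x)

enumerates-translate : ∀ {e} {A : Pred ℕ 0ℓ} → Enumerates ∅ e A → Enumerates O (translate e) A
enumerates-translate {e = e} enum x = mk⇔
  (λ x∈ → let y , p = to (enum x) x∈ in y , to (φ-translate e) p)
  (λ (y , p) → from (enum x) (y , from (φ-translate e) p))

translateIndex : ℕ → ℕ
translateIndex e = ⟨ translate (π₁ e) , ⟨ translate (π₁ (π₂ e)) , ⟨ translate (π₁ (π₂ (π₂ e))) , translate (π₂ (π₂ (π₂ e))) ⟩ ⟩ ⟩

module LimitAge (em : ExcludedMiddle (lsuc 0ℓ)) {L : Language} {K : Pred (Structure L) (lsuc 0ℓ)}
             (𝕂 : Enumeration L) (ix : ℕ → ℕ) (rep : Represents 𝕂 ∅ ix K) (hp : HP K) (jep : JEP K) (cap : CAP K) where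
  open Enumeration 𝕂
  open Types 𝕂
  open Amalgamation 𝕂 rep
  open Decidability em 𝕂 ix rep
  open Chain em 𝕂 ix rep jep cap
  open LimitStructure em 𝕂 ix rep jep cap
  open Represents rep

  ix′ : ℕ → ℕ
  ix′ = translateIndex ∘ ix

  ix′-index : ∀ i → IsStructureIndex 𝔼″ (struct i) (ix′ i)
  ix′-index i = record
    { e-dom          = translate (Index.e-dom i)
    ; e-rel          = translate (Index.e-rel i)
    ; e-neg          = translate (Index.e-neg i)
    ; e-fun          = translate (Index.e-fun i)
    ; packed         = cong₂ (λ d z → ⟨ translate d , z ⟩) (e-dom≡ i)
        (cong₂ (λ r z → ⟨ translate r , z ⟩) (e-rel≡ i) (cong₂ (λ n f → ⟨ translate n , translate f ⟩) (e-neg≡ i) (e-fun≡ i)))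
    ; dom-decides    = decides-translate (Index.dom-decides i)
    ; rel-enumerates = enumerates-translate (Index.rel-enumerates i)
    ; neg-enumerates = enumerates-translate (Index.neg-enumerates i)
    ; fun-enumerates = enumerates-translate (Index.fun-enumerates i)
    }

  ix′-triples : CE 𝔼″ (λ x → ∃[ i ] x ≡ triple 𝕂 ix′ i)
  ix′-triples = ⌜ searchᶜ r ⌝ , enumerates {R = λ x i → x ≡ triple 𝕂 ix′ i} r
    where
    rec-gens : Rec 𝔼 (λ i → code (struct i) (gens i))
    rec-gens = Rec-≗ (λ i → π₁-pair (code (struct i) (gens i)) ⟨ ix i , i ⟩) (rec-π₁ ⊙ rec-triple)
    rec-ix′ : Rec 𝔼 ix′
    rec-ix′ = ⟪ rec-translate ⊙ rec-π₁ , ⟪ rec-translate ⊙ rec-π₁ ⊙ rec-π₂ ,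
      ⟪ rec-translate ⊙ rec-π₁ ⊙ rec-π₂ ⊙ rec-π₂ , rec-translate ⊙ rec-π₂ ⊙ rec-π₂ ⊙ rec-π₂ ⟫ ⟫ ⟫ ⊙ rec-ix
    r : RecPred 𝔼″ (Uncurry (λ x i → x ≡ triple 𝕂 ix′ i))
    r = rec-π₁ ≡ᵖ (relativize 𝔼≤𝔼″ ⟪ rec-gens , ⟪ rec-ix′ , rec-id ⟫ ⟫ ⊙ rec-π₂)

  -- Two members of the age embed into a common one, so they satisfy the same atomic sentences.
  []-≃ : ∀ k l → k ∶ [] ≃ l ∶ []
  []-≃ k l =
    let C , C∈K , f , g = jep (inAge k) (inAge l)
        n , iso = exhaustive C∈K
    in ≃-trans {𝓑 = struct n} (≃-embedding (≅⇒embedding iso ∘ₑ f) []) (≃-sym (≃-embedding (≅⇒embedding iso ∘ₑ g) []))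

  gens-realized : ∀ i → Σ[ a ∈ Vec ∣ 𝐌 ∣ (len i) ] SameAtomicType ⟦ struct i ⟧ 𝐌 (gens i) a
  gens-realized i =
    -- The generators of 𝓐ᵢ are an extension of the empty subtuple, which generates a base, so they
    -- form an admissible request at stage 0.
    let t , q , _ , q< , same , _ = realize 0 {[]} {i} {raw (struct i) (gens i)} {[]} []
          ([] , ≃-refl (gens i) , []-≃ (𝕜 0) i) (base-[] jep (𝕜 0))
        a , _ , same′ = retype (≃-sym (≃-trans (at-stage q<) same)) (gens i) refl
    in a , same′

  struct∈Age : ∀ i → Age 𝐌 ⟦ struct i ⟧
  struct∈Age i =
    let a , same = gens-realized i
        S = generatedBy 𝐌 a
        same-S : SameAtomicType ⟦ struct i ⟧ (substructure 𝐌 S) (gens i) (generators 𝐌 a)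
        same-S = sat-trans {A = ⟦ struct i ⟧} {B = 𝐌} {C = substructure 𝐌 S} {b = a} same
          (sat-sym {A = substructure 𝐌 S} {B = 𝐌} {a = generators 𝐌 a} (sat-generators 𝐌 a))
    in S , generated-fg 𝐌 a , generated-iso (generated i) same-S (generators-generate 𝐌 a)

  -- The generators of a substructure of the limit have the type of a tuple `b` at some stage. The
  -- substructure generated by `b` there is isomorphic to the given one and belongs to the age by
  -- HP.
  age-exhaustive : ∀ {B} → Age 𝐌 B → ∃[ i ] B ≅ ⟦ struct i ⟧
  age-exhaustive {B} (S , (n , c , gen) , B≅S) =
    let a = map proj₁ c
        s , a< = live a
        A = ⟦ struct (𝕜 s) ⟧
        b , _ , same = retype (at-stage a<) a refl
        T = generatedBy A b
        same-T : SameAtomicType (substructure 𝐌 S) (substructure A T) c (generators A b)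
        same-T = sat-trans {A = substructure 𝐌 S} {B = 𝐌} {C = substructure A T} {b = a} (sat-embedding (inclusion S) c)
          (sat-trans {A = 𝐌} {B = A} {C = substructure A T} {b = b} same
            (sat-sym {A = substructure A T} {B = A} {a = generators A b} (sat-generators A b)))
        i , T≅ = exhaustive (hp (inAge (𝕜 s)) T (generated-fg A b))
    in i , ≅-trans B≅S (≅-trans (generated-iso gen same-T (generators-generate A b)) T≅)

  represents-age : Represents 𝕂 𝔼″ ix′ (Age 𝐌)
  represents-age = record
    { triples-ce = ix′-triples
    ; indexed    = ix′-index
    ; inAge      = struct∈Age
    ; generated  = generated
    ; exhaustive = age-exhaustive
    }

-- Back-and-forth between tuples of the same type

module BackAndForth (em : ExcludedMiddle (lsuc 0ℓ)) {L : Language} {K : Pred (Structure L) (lsuc 0ℓ)}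
             (𝕂 : Enumeration L) (ix : ℕ → ℕ) (rep : Represents 𝕂 ∅ ix K) (jep : JEP K) (cap : CAP K) where
  open Classical em
  open Types 𝕂
  open Decidability em 𝕂 ix rep
  open Chain em 𝕂 ix rep jep cap
  open LimitStructure em 𝕂 ix rep jep cap

  Partial : List ℕ → List ℕ → ℕ → Set
  Partial p q s = InRange (size s) p × InRange (size s) q × 𝕜 s ∶ 𝕓 s ⟨$⟩ p ≃ 𝕜 s ∶ 𝕓 s ⟨$⟩ q × Base (𝕜 s) (𝕓 s ⟨$⟩ p)

  -- A pair of lists `p`, `q` is a finite map sending entries of `p` to the corresponding entries of
  -- `q`. Here `xs` goes to `ys`; this serves both for extension of maps and, with singletons, for
  -- membership in the graph.
  Contains : List ℕ → List ℕ → List ℕ → List ℕ → Set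
  Contains p q xs ys = ∃[ ρ ] (InRange (length p) ρ × p ⟨$⟩ ρ ≡ xs × q ⟨$⟩ ρ ≡ ys)

  Extension : ℕ → List ℕ → List ℕ → List ℕ → List ℕ → ℕ → Set
  Extension n p q p′ q′ s′ = Partial p′ q′ s′ × Contains p′ q′ p q × (Domain n → p′ ∋ n) × (Domain n → q′ ∋ n)

  contains-refl : ∀ {p q} → length p ≡ length q → Contains p q p q
  contains-refl {p} {q} eq = upTo (length p) , all-upTo (length p) , ⟨$⟩-upTo p ,
    trans (cong (λ n → q ⟨$⟩ upTo n) eq) (⟨$⟩-upTo q)

  partial-length : ∀ {p q s} → Partial p q s → length p ≡ length q
  partial-length {p} {q} {s} (_ , _ , same , _) =
    trans (sym (length-map (nth (𝕓 s)) p)) (trans (≃-length same) (length-map (nth (𝕓 s)) q))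

  contains-trans : ∀ {p q p′ q′ xs ys} → length p ≡ length q → Contains p′ q′ p q → Contains p q xs ys → Contains p′ q′ xs ys
  contains-trans {p′ = p′} {q′ = q′} eq (σ , σ< , refl , refl) (ρ , ρ< , refl , refl) =
    σ ⟨$⟩ ρ , ⟨$⟩-InRange σ ρ σ< ρ<σ , ⟨$⟩-assoc p′ σ ρ ρ<σ , ⟨$⟩-assoc q′ σ ρ ρ<σ
    where
    ρ<σ = subst (λ n → InRange n ρ) (length-map (nth p′) σ) ρ<

  module _ {p q s n} (part : Partial p q s) (u : ℕ) (n< : n < size u) where
    private
      s₁ = s ⊔ u
      s≤ = size-mono (m≤m⊔n s u)
      p< : InRange (size s₁) p
      p< = inRange-≤ s≤ (proj₁ part)
      q< : InRange (size s₁) q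
      q< = inRange-≤ s≤ (proj₁ (proj₂ part))
      same : 𝕜 s₁ ∶ 𝕓 s₁ ⟨$⟩ p ≃ 𝕜 s₁ ∶ 𝕓 s₁ ⟨$⟩ q
      same = ≃-trans (≃-sym (coherent (m≤m⊔n s u) (proj₁ part)))
        (≃-trans (proj₁ (proj₂ (proj₂ part))) (coherent (m≤m⊔n s u) (proj₁ (proj₂ part))))
      base-q : Base (𝕜 s₁) (𝕓 s₁ ⟨$⟩ q)
      base-q = base-≃ (≃-trans (coherent (m≤m⊔n s u) (proj₁ part)) same) (proj₂ (proj₂ (proj₂ part)))
      p₁ = upTo (size s₁)
      p₁≡ : 𝕓 s₁ ⟨$⟩ p₁ ≡ 𝕓 s₁
      p₁≡ = ⟨$⟩-upTo (𝕓 s₁)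

      Forth : Set
      Forth = ∃[ t ] ∃[ q₁ ] (s₁ ≤ t × InRange (size t) q₁ × 𝕜 t ∶ 𝕓 t ⟨$⟩ q₁ ≃ 𝕜 s₁ ∶ 𝕓 s₁ × q₁ ⟨$⟩ p ≡ q)

      -- Entries of `p` are positions in `𝕓 s₁`, so `𝕓 s₁` is an extension of the type of `q` in
      -- which the image lies at the positions `p`. Its copy `q₁` over `q` extends the map to all
      -- positions below `size s₁`.
      forth : Forth
      forth = realize s₁ q< (p< , valid s₁ , ≃-sym same) base-q

      module _ (forth : Forth) where
        t = proj₁ forth
        q₁ = proj₁ (proj₂ forth)
        s₁≤t = proj₁ (proj₂ (proj₂ forth))
        q₁< = proj₁ (proj₂ (proj₂ (proj₂ forth)))
        same₁ = proj₁ (proj₂ (proj₂ (proj₂ (proj₂ forth))))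
        q₁p≡q = proj₂ (proj₂ (proj₂ (proj₂ (proj₂ forth))))
        up : 𝕜 s₁ ∶ 𝕓 s₁ ≃ 𝕜 t ∶ 𝕓 t ⟨$⟩ p₁
        up = subst (λ z → 𝕜 s₁ ∶ z ≃ 𝕜 t ∶ 𝕓 t ⟨$⟩ p₁) p₁≡ (coherent s₁≤t (all-upTo (size s₁)))

        Back : Set
        Back = ∃[ v ] ∃[ p₂ ] (t ≤ v × InRange (size v) p₂ × 𝕜 v ∶ 𝕓 v ⟨$⟩ p₂ ≃ 𝕜 t ∶ 𝕓 t × p₂ ⟨$⟩ q₁ ≡ p₁)

        -- The same request with the sides exchanged: `𝕓 t` extends the type of `p₁`, with image at
        -- the positions `q₁`. The domain side acquires a copy `p₂` of all of `𝕓 t`.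
        back : Back
        back = realize t (inRange-≤ (size-mono s₁≤t) (all-upTo (size s₁)))
          (q₁< , valid t , ≃-trans (≃-sym up) (≃-sym same₁)) (base-≃ up (proj₂ (proj₂ (good s₁))))

        combine : Back → ∃[ p′ ] ∃[ q′ ] ∃[ s′ ] Extension n p q p′ q′ s′
        combine (v , p₂ , t≤v , p₂< , same₂ , p₂q₁≡p₁) = p₂ , q₂ , v ,
          (p₂< , inRange-≤ (size-mono t≤v) q₂< , ≃-trans same₂ down , base-≃ (≃-sym same₂) (proj₂ (proj₂ (good t)))) ,
          -- The new target list `q₂` is the identity on positions, so the list `q` itself selects
          -- `q` from it. The same selection gives `p` from `p₂`, because `p₂` maps `q₁` to `p₁` and
          -- `q₁` maps `p` to `q`.
          (q , subst (λ m → InRange m q) (sym |p₂|) q<t , p₂q≡p , upTo-⟨$⟩ q q<t) ,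
          (λ _ → subst (p₂ ∋_) n≡ (All.head p₂∋)) ,
          (λ _ → n , subst (n <_) (sym (length-upTo (size t))) n<t , proj₁ (∷-injective (upTo-⟨$⟩ (n ∷ []) (n<t ∷ []))))
          where
          q₂ = upTo (size t)
          q₂< = all-upTo (size t)
          down : 𝕜 t ∶ 𝕓 t ≃ 𝕜 v ∶ 𝕓 v ⟨$⟩ q₂
          down = subst (λ z → 𝕜 t ∶ z ≃ 𝕜 v ∶ 𝕓 v ⟨$⟩ q₂) (⟨$⟩-upTo (𝕓 t)) (coherent t≤v q₂<)
          |p₂| : length p₂ ≡ size t
          |p₂| = trans (sym (length-map (nth (𝕓 v)) p₂)) (≃-length same₂)
          |q₁| : length q₁ ≡ size s₁
          |q₁| = trans (sym (length-map (nth (𝕓 t)) q₁)) (≃-length same₁)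
          q<t : InRange (size t) q
          q<t = inRange-≤ (size-mono s₁≤t) q<
          p<q₁ : InRange (length q₁) p
          p<q₁ = subst (λ m → InRange m p) (sym |q₁|) p<
          n<s₁ : n < size s₁
          n<s₁ = <-≤-trans n< (size-mono (m≤n⊔m s u))
          n<q₁ : n < length q₁
          n<q₁ = subst (n <_) (sym |q₁|) n<s₁
          n<t : n < size t
          n<t = <-≤-trans n<s₁ (size-mono s₁≤t)
          p₂q≡p : p₂ ⟨$⟩ q ≡ p
          p₂q≡p = trans (cong (p₂ ⟨$⟩_) (sym q₁p≡q)) (trans (⟨$⟩-assoc p₂ q₁ p p<q₁)
            (trans (cong (_⟨$⟩ p) p₂q₁≡p₁) (upTo-⟨$⟩ p p<)))
          n≡ : nth p₁ n ≡ n
          n≡ = proj₁ (∷-injective (upTo-⟨$⟩ (n ∷ []) (n<s₁ ∷ [])))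
          p₂∋ : All (p₂ ∋_) (p₁ ⟨$⟩ (n ∷ []))
          p₂∋ = subst (All (p₂ ∋_)) (trans (⟨$⟩-assoc p₂ q₁ (n ∷ []) (n<q₁ ∷ [])) (cong (_⟨$⟩ (n ∷ [])) p₂q₁≡p₁))
            (⟨$⟩-∋ p₂ (subst (λ m → InRange m (q₁ ⟨$⟩ (n ∷ []))) (sym |p₂|) (nth< q₁ q₁< n<q₁ ∷ [])))

    extend-domain : ∃[ p′ ] ∃[ q′ ] ∃[ s′ ] Extension n p q p′ q′ s′
    extend-domain = combine forth (back forth)

  extension : ∀ n {p q s} → Partial p q s → ∃[ p′ ] ∃[ q′ ] ∃[ s′ ] Extension n p q p′ q′ s′
  extension n {p} {q} {s} part with em₀ (Domain n)
  ... | yes (u , n<) = extend-domain part u n<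
  ... | no n∉ = p , q , s , part , contains-refl {p} {q} (partial-length {p} {q} {s} part) ,
    (λ n∈ → contradiction n∈ n∉) , (λ n∈ → contradiction n∈ n∉)

  partialᵖ : RecList 𝔼″ F → RecList 𝔼″ G → Rec 𝔼″ f → RecPred 𝔼″ (λ x → Partial (F x) (G x) (f x))
  partialᵖ p q s = inRangeᵖ (rec-size ⊙ s) p ×ᵖ inRangeᵖ (rec-size ⊙ s) q ×ᵖ
    sameᵖ 𝔼≤𝔼″ (rec-𝕜 ⊙ s) (rec-⟨$⟩ (rec-𝕓 ⊙ˡ s) p) (rec-𝕜 ⊙ s) (rec-⟨$⟩ (rec-𝕓 ⊙ˡ s) q) ×ᵖ
    baseᵖ (rec-𝕜 ⊙ s) (rec-⟨$⟩ (rec-𝕓 ⊙ˡ s) p)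

  ∋ᵖ : RecList O F → Rec O f → RecPred (O ′) (λ x → F x ∋ f x)
  ∋ᵖ {F = F} {f = f} xs x = ∃ᵖ {R = λ e i → i < length (F e) × nth (F e) i ≡ f e}
    ((rec-π₂ <ᵖ rec-length (xs ⊙ˡ rec-π₁)) ×ᵖ (rec-nth (xs ⊙ˡ rec-π₁) rec-π₂ ≡ᵖ x ⊙ rec-π₁))

  private
    -- States are triples ⟨ ⟨ p , q ⟩ , s ⟩.

    pᵗ qᵗ : ℕ → List ℕ
    pᵗ z = decode (π₁ (π₁ z))
    qᵗ z = decode (π₂ (π₁ z))

    sᵗ : ℕ → ℕ
    sᵗ = π₂

    PartialN : ℕ → Set
    PartialN z = Partial (pᵗ z) (qᵗ z) (sᵗ z)

    Step : ℕ → ℕ → Set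
    Step x z′ = PartialN (π₂ x) → Extension (π₁ x) (pᵗ (π₂ x)) (qᵗ (π₂ x)) (pᵗ z′) (qᵗ z′) (sᵗ z′)

    rec-p : RecList O pᵗ
    rec-p = rec-decode (rec-π₁ ⊙ rec-π₁)
    rec-q : RecList O qᵗ
    rec-q = rec-decode (rec-π₂ ⊙ rec-π₁)

    stepᵖ : RecPred 𝔼″ (Uncurry Step)
    stepᵖ = partialᵖ rec-p₁ rec-q₁ (rec-π₂ ⊙ rec-z) →ᵖ partialᵖ rec-p₂ rec-q₂ (rec-π₂ ⊙ rec-z′) ×ᵖ
      jumpᵖ (mapᵖ {P = λ e → ∃ (λ r → Match e (decode r))} (λ e → mk⇔ (λ (r , h) → decode r , h)
          (λ (ρ , h) → encode ρ , subst (Match e) (sym (decode-encode ρ)) h))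
        (∃ᵖ {R = λ e r → Match e (decode r)}
          (inRangeᵖ (rec-length (rec-p₂ ⊙ˡ rec-π₁)) (rec-decode rec-π₂) ×ᵖ
           rec-⟨$⟩ (rec-p₂ ⊙ˡ rec-π₁) (rec-decode rec-π₂) ≡ˡ rec-p₁ ⊙ˡ rec-π₁ ×ᵖ
           rec-⟨$⟩ (rec-q₂ ⊙ˡ rec-π₁) (rec-decode rec-π₂) ≡ˡ rec-q₁ ⊙ˡ rec-π₁))) ×ᵖ
      (domainᵖ ⊙ᵖ rec-n →ᵖ jumpᵖ (∋ᵖ rec-p₂ rec-n)) ×ᵖ (domainᵖ ⊙ᵖ rec-n →ᵖ jumpᵖ (∋ᵖ rec-q₂ rec-n))
      where
      Match : ℕ → List ℕ → Set
      Match e ρ = InRange (length (pᵗ (π₂ e))) ρ × pᵗ (π₂ e) ⟨$⟩ ρ ≡ pᵗ (π₂ (π₁ e)) × qᵗ (π₂ e) ⟨$⟩ ρ ≡ qᵗ (π₂ (π₁ e))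
      rec-n : ∀ {O} → Rec O (λ e → π₁ (π₁ e))
      rec-n = rec-π₁ ⊙ rec-π₁
      rec-z : ∀ {O} → Rec O (λ e → π₂ (π₁ e))
      rec-z = rec-π₂ ⊙ rec-π₁
      rec-z′ : ∀ {O} → Rec O π₂
      rec-z′ = rec-π₂
      rec-p₁ : ∀ {O} → RecList O (λ e → pᵗ (π₂ (π₁ e)))
      rec-p₁ = rec-p ⊙ˡ rec-z
      rec-q₁ : ∀ {O} → RecList O (λ e → qᵗ (π₂ (π₁ e)))
      rec-q₁ = rec-q ⊙ˡ rec-z
      rec-p₂ : ∀ {O} → RecList O (λ e → pᵗ (π₂ e))
      rec-p₂ = rec-p ⊙ˡ rec-z′
      rec-q₂ : ∀ {O} → RecList O (λ e → qᵗ (π₂ e))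
      rec-q₂ = rec-q ⊙ˡ rec-z′

    module _ (p q : List ℕ) (s : ℕ) where
      state : ℕ
      state = ⟨ ⟨ encode p , encode q ⟩ , s ⟩
      pᵗ≡ : pᵗ state ≡ p
      pᵗ≡ = trans (cong (decode ∘ π₁) (π₁-pair ⟨ encode p , encode q ⟩ s)) (decode-π₁ p (encode q))
      qᵗ≡ : qᵗ state ≡ q
      qᵗ≡ = trans (cong (decode ∘ π₂) (π₁-pair ⟨ encode p , encode q ⟩ s)) (decode-π₂ (encode p) q)
      sᵗ≡ : sᵗ state ≡ s
      sᵗ≡ = π₂-pair ⟨ encode p , encode q ⟩ s

    step-total : ∀ x → ∃ (Step x)
    step-total x with em₀ (PartialN (π₂ x))
    ... | no ¬part = 0 , λ part → contradiction part ¬part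
    ... | yes part = finish (extension (π₁ x) part)
      where
      finish : (∃[ p′ ] ∃[ q′ ] ∃[ s′ ] Extension (π₁ x) (pᵗ (π₂ x)) (qᵗ (π₂ x)) p′ q′ s′) → ∃ (Step x)
      finish (p′ , q′ , s′ , ext) = state p′ q′ s′ , λ _ →
        subst (Extension _ _ _ (pᵗ (state p′ q′ s′)) (qᵗ (state p′ q′ s′))) (sym (sᵗ≡ p′ q′ s′))
          (subst₂ (λ p q → Extension (π₁ x) (pᵗ (π₂ x)) (qᵗ (π₂ x)) p q s′) (sym (pᵗ≡ p′ q′ s′)) (sym (qᵗ≡ p′ q′ s′)) ext)

    chosen : Σ[ f ∈ (ℕ → ℕ) ] (Rec 𝔼″ f × (∀ x → Step x (f x)))
    chosen = choose Step stepᵖ step-total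

  -- The sum, known to be recursive, bounds the stages of both lists.
  startStage : ℕ → ℕ
  startStage w = stageOf (decode (π₁ w)) + stageOf (decode (π₂ w))

  rec-startStage : Rec 𝔼″ startStage
  rec-startStage = ap₂ rec-+ (rec-stageOf (rec-decode rec-π₁)) (rec-stageOf (rec-decode rec-π₂))

  private
    abstract
      states : ℕ → ℕ → ℕ
      -- The input `w` already codes the pair of lists, as the first component of a state does.
      states w zero    = ⟨ w , startStage w ⟩
      states w (suc n) = proj₁ chosen ⟨ n , states w n ⟩

      rec-states : Rec₂ 𝔼″ states
      rec-states = rec-prec {f = λ w → ⟨ w , startStage w ⟩} {g = λ e → proj₁ chosen (π₂ e)}
        ⟪ rec-id , rec-startStage ⟫ (proj₁ (proj₂ chosen) ⊙ rec-π₂) states (λ _ → refl)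
        (λ w n → cong (proj₁ chosen) (π₂-pair w ⟨ n , states w n ⟩))

      states-0 : ∀ w → states w 0 ≡ ⟨ w , startStage w ⟩
      states-0 w = refl

      states-suc : ∀ w n → PartialN (states w n) →
        Extension n (pᵗ (states w n)) (qᵗ (states w n)) (pᵗ (states w (suc n))) (qᵗ (states w (suc n))) (sᵗ (states w (suc n)))
      states-suc w n = subst₂
        (λ m z → PartialN z → Extension m (pᵗ z) (qᵗ z) (pᵗ (states w (suc n))) (qᵗ (states w (suc n))) (sᵗ (states w (suc n))))
        (π₁-pair n (states w n)) (π₂-pair n (states w n)) (proj₂ (proj₂ chosen) ⟨ n , states w n ⟩)

    -- Step `x` puts `x` into the domain of the partial map, so its image can be looked up in the
    -- state with number `suc x`.
    Found : ℕ → ℕ → Set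
    Found e i = pᵗ σ ∋ π₂ e → i < length (pᵗ σ) × nth (pᵗ σ) i ≡ π₂ e
      where σ = states (π₁ e) (suc (π₂ e))

    rec-now : Rec 𝔼″ (λ e → states (π₁ e) (suc (π₂ e)))
    rec-now = ap₂ rec-states rec-π₁ (rec-suc ⊙ rec-π₂)

    found : Σ[ f ∈ (ℕ → ℕ) ] (Rec 𝔼″ f × (∀ e → Found e (f e)))
    found = choose Found
      (∋-now ⊙ᵖ rec-π₁ →ᵖ
        (rec-π₂ <ᵖ rec-length (p ⊙ˡ rec-π₁)) ×ᵖ (rec-nth (p ⊙ˡ rec-π₁) rec-π₂ ≡ᵖ rec-π₂ ⊙ rec-π₁)) total
      where
      p : RecList 𝔼″ (λ e → pᵗ (states (π₁ e) (suc (π₂ e))))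
      p = rec-p ⊙ˡ rec-now
      ∋-now : RecPred 𝔼″ (λ e → pᵗ (states (π₁ e) (suc (π₂ e))) ∋ π₂ e)
      ∋-now = apᵖ {R = λ l x → decode l ∋ x} (jumpᵖ (∋ᵖ {O = 𝔼} (rec-decode rec-π₁) rec-π₂)) (rec-π₁ ⊙ rec-π₁ ⊙ rec-now) rec-π₂
      total : ∀ e → ∃ (Found e)
      total e with em₀ (pᵗ (states (π₁ e) (suc (π₂ e))) ∋ π₂ e)
      ... | yes (i , h) = i , λ _ → h
      ... | no ¬∋ = 0 , λ x∈ → contradiction x∈ ¬∋

  opaque
    image : ℕ → ℕ → ℕ
    image w x = nth (qᵗ (states w (suc x))) (proj₁ found ⟨ w , x ⟩)

    rec-image : Rec₂ 𝔼″ image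
    rec-image = mkRec₂ (rec-nth (rec-q ⊙ˡ rec-now) (proj₁ (proj₂ found) ⊙ ⟪ rec-π₁ , rec-π₂ ⟫))

  module _ (w : ℕ) (start : Partial (decode (π₁ w)) (decode (π₂ w)) (startStage w)) where
    private
      p q : ℕ → List ℕ
      p n = pᵗ (states w n)
      q n = qᵗ (states w n)

      part : ∀ n → PartialN (states w n)
      part zero    = subst PartialN (sym (states-0 w)) (subst₂ (λ z s → Partial (decode (π₁ z)) (decode (π₂ z)) s)
        (sym (π₁-pair w (startStage w))) (sym (π₂-pair w (startStage w))) start)
      part (suc n) = proj₁ (states-suc w n (part n))

      contains-mono : ∀ {m n} → m ≤′ n → Contains (p n) (q n) (p m) (q m)
      contains-mono {m} ≤′-refl = contains-refl {p m} {q m} (partial-length {p m} {q m} {sᵗ (states w m)} (part m))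
      contains-mono {m} (≤′-step {n} m≤′n) =
        contains-trans {p n} {q n} {p (suc n)} {q (suc n)} (partial-length {p n} {q n} {sᵗ (states w n)} (part n))
          (proj₁ (proj₂ (states-suc w n (part n)))) (contains-mono m≤′n)

    -- The union of the partial isomorphisms.

    record Matched (xs ys : List ℕ) : Set where
      constructor matched
      field
        step     : ℕ
        contains : Contains (p step) (q step) xs ys

    matched-start : Matched (decode (π₁ w)) (decode (π₂ w))
    matched-start = matched 0 (subst₂ (Contains (p 0) (q 0))
      (trans (cong pᵗ (states-0 w)) (cong (decode ∘ π₁) (π₁-pair w (startStage w))))
      (trans (cong qᵗ (states-0 w)) (cong (decode ∘ π₂) (π₁-pair w (startStage w))))
      (contains-refl {p 0} {q 0} (partial-length {p 0} {q 0} {sᵗ (states w 0)} (part 0))))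

    private
      raise : ∀ {m n xs ys} → m ≤ n → Contains (p m) (q m) xs ys → Contains (p n) (q n) xs ys
      raise {m} {n} {xs} {ys} m≤n = contains-trans {p m} {q m} {p n} {q n} {xs} {ys}
        (partial-length {p m} {q m} {sᵗ (states w m)} (part m)) (contains-mono (≤⇒≤′ m≤n))

    matched-∷ : ∀ {x y xs ys} → Matched (x ∷ []) (y ∷ []) → Matched xs ys → Matched (x ∷ xs) (y ∷ ys)
    matched-∷ {x} {y} {xs} {ys} (matched m c) (matched n d) = matched (m ⊔ n)
      (join {p (m ⊔ n)} {q (m ⊔ n)} (raise {xs = x ∷ []} {y ∷ []} (m≤m⊔n m n) c) (raise {xs = xs} {ys} (m≤n⊔m m n) d))
      where
      join : ∀ {p′ q′} → Contains p′ q′ (x ∷ []) (y ∷ []) → Contains p′ q′ xs ys → Contains p′ q′ (x ∷ xs) (y ∷ ys)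
      join (i ∷ [] , i< ∷ [] , refl , refl) (ρ , ρ< , refl , refl) = i ∷ ρ , i< ∷ ρ< , refl , refl

    matched-[] : Matched [] []
    matched-[] = matched 0 ([] , [] , refl , refl)

    matched-head : ∀ {x y xs ys} → Matched (x ∷ xs) (y ∷ ys) → Matched (x ∷ []) (y ∷ [])
    matched-head (matched n (i ∷ ρ , i< ∷ _ , refl , refl)) = matched n (i ∷ [] , i< ∷ [] , refl , refl)

    matched-tail : ∀ {x y xs ys} → Matched (x ∷ xs) (y ∷ ys) → Matched xs ys
    matched-tail (matched n (i ∷ ρ , _ ∷ ρ< , refl , refl)) = matched n (ρ , ρ< , refl , refl)

    matched-≃ : ∀ {xs ys} → Matched xs ys → SameType 𝓜 𝓜 xs ys
    matched-≃ (matched n (ρ , ρ< , refl , refl)) =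
      let p< , q< , same , _ = part n
      in ≃-reindex (≃-trans (at-stage p<) (≃-trans same (≃-sym (at-stage q<)))) ρ ρ<

    -- The list `x ∷ x ∷ []` is matched with `y ∷ y′ ∷ []`, and equality of the two entries is an
    -- atomic formula.
    matched-functional : ∀ {x y y′} → Matched (x ∷ []) (y ∷ []) → Matched (x ∷ []) (y′ ∷ []) → y ≡ y′
    matched-functional m m′ = ≃-nth (matched-≃ (matched-∷ m m′)) {0} {1} z<s (s<s z<s) refl

    matched-injective : ∀ {x x′ y} → Matched (x ∷ []) (y ∷ []) → Matched (x′ ∷ []) (y ∷ []) → x ≡ x′
    matched-injective m m′ = ≃-nth (≃-sym (matched-≃ (matched-∷ m m′))) {0} {1} z<s (s<s z<s) refl

    opaque
      unfolding image

      matched-image : ∀ {x} → Domain x → Matched (x ∷ []) (image w x ∷ [])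
      matched-image {x} x∈ = matched (suc x) (i ∷ [] , proj₁ i-found ∷ [] , cong (_∷ []) (proj₂ i-found) , refl)
        where
        i : ℕ
        i = proj₁ found ⟨ w , x ⟩
        i-found : i < length (p (suc x)) × nth (p (suc x)) i ≡ x
        i-found = subst₂
          (λ w x → pᵗ (states w (suc x)) ∋ x → i < length (pᵗ (states w (suc x))) × nth (pᵗ (states w (suc x))) i ≡ x)
          (π₁-pair w x) (π₂-pair w x) (proj₂ (proj₂ found) ⟨ w , x ⟩) (proj₁ (proj₂ (proj₂ (states-suc w x (part x)))) x∈)

    matched-surjective : ∀ {y} → Domain y → ∃[ x ] Matched (x ∷ []) (y ∷ [])
    matched-surjective {y} y∈ =
      let i , i< , eq = proj₂ (proj₂ (proj₂ (states-suc w y (part y)))) y∈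
          |p|≡|q| = partial-length {p (suc y)} {q (suc y)} {sᵗ (states w (suc y))} (part (suc y))
      in nth (p (suc y)) i , matched (suc y) (i ∷ [] , subst (i <_) (sym |p|≡|q|) i< ∷ [] , refl , cong (_∷ []) eq)

    matched-domain : ∀ {xs ys} → Matched xs ys → All Domain xs × All Domain ys
    matched-domain m with mkSameType a b refl refl _ ← matched-≃ m = allDomain-raw a , allDomain-raw b

-- Programs restricted to a decidable domain

restrictᶜ : RecPred O P → Rec O f → Code
restrictᶜ {O} r s = compᶜ (program s) (compᶜ leftᶜ (pairᶜ (program (rec-id {O = O})) (searchᶜ (r ⊙ᵖ rec-π₁))))

-- The search asks for `P x` whatever the number tried, so it halts at once or never. Its result is
-- discarded by `leftᶜ`, and it serves only to make the program diverge outside `P`.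
restrictᶜ-⇓ : (r : RecPred O P) (s : Rec O f) → O ⊢ restrictᶜ r s [ x ]⇓ y ⇔ (P x × f x ≡ y)
restrictᶜ-⇓ {O} {P} {f} {x} {y} r s = mk⇔ sound complete
  where
  sound : O ⊢ restrictᶜ r s [ x ]⇓ y → P x × f x ≡ y
  sound (⇓comp (⇓comp (⇓pair {y = x′} {z = n} a b) ⇓left) c) =
    subst P (π₁-pair x n) (searchᶜ-sound (r ⊙ᵖ rec-π₁) x b) ,
    trans (cong f (sym (trans (π₁-pair x′ n) (⇓-deterministic a (correct rec-id x))))) (⇓-deterministic (correct s _) c)
  complete : P x × f x ≡ y → O ⊢ restrictᶜ r s [ x ]⇓ y
  complete (p , eq) = finish (searchᶜ-halts {y = 0} (r ⊙ᵖ rec-π₁) x (subst P (sym (π₁-pair x 0)) p))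
    where
    finish : ∃[ n ] (P (π₁ ⟨ x , n ⟩) × O ⊢ searchᶜ (r ⊙ᵖ rec-π₁) [ x ]⇓ n) → O ⊢ restrictᶜ r s [ x ]⇓ y
    finish (n , _ , run) = ⇓comp (⇓comp (⇓pair (correct rec-id x) run) ⇓left)
      (subst (O ⊢ program s [ π₁ ⟨ x , n ⟩ ]⇓_) (trans (cong f (π₁-pair x n)) eq) (correct s (π₁ ⟨ x , n ⟩)))

-- Finite permutations of a recursive set, as products of transpositions

transpose : ℕ → ℕ → ℕ → ℕ
transpose u v z = if does (z ≟ u) then v else if does (z ≟ v) then u else z

transpose-left : ∀ u v → transpose u v u ≡ v
transpose-left u v = if-yes (u ≟ u) refl

transpose-right : ∀ u v → transpose u v v ≡ u
transpose-right u v = [ (λ v≡u → trans (if-yes (v ≟ u) v≡u) v≡u) , (λ v≢u → trans (if-no (v ≟ u) v≢u) (if-yes (v ≟ v) refl)) ]′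
  (toSum (v ≟ u))

transpose-fixed : ∀ {u v z} → z ≢ u → z ≢ v → transpose u v z ≡ z
transpose-fixed {u} {v} {z} z≢u z≢v = trans (if-no (z ≟ u) z≢u) (if-no (z ≟ v) z≢v)

data TransposeView (u v z : ℕ) : Set where
  first   : z ≡ u → TransposeView u v z
  second  : z ≡ v → TransposeView u v z
  neither : z ≢ u → z ≢ v → TransposeView u v z

transposeView : ∀ u v z → TransposeView u v z
transposeView u v z = [ first , (λ z≢u → [ second , neither z≢u ]′ (toSum (z ≟ v))) ]′ (toSum (z ≟ u))

transpose-involutive : ∀ u v z → transpose u v (transpose u v z) ≡ z
transpose-involutive u v z with transposeView u v z
... | first refl       = trans (cong (transpose u v) (transpose-left u v)) (transpose-right u v)
... | second refl      = trans (cong (transpose u v) (transpose-right u v)) (transpose-left u v)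
... | neither z≢u z≢v = trans (cong (transpose u v) (transpose-fixed z≢u z≢v)) (transpose-fixed z≢u z≢v)

SamePattern : List ℕ → List ℕ → Set
SamePattern a b = length a ≡ length b ×
  (∀ i j → i < length a → j < length a → (nth a i ≡ nth a j → nth b i ≡ nth b j) × (nth b i ≡ nth b j → nth a i ≡ nth a j))

module FinitePermutation {D : Pred ℕ 0ℓ} (Dᵖ : RecPred O D) where
  private
    bothᵖ : RecPred O (λ e → D (π₁ e) × D (π₂ e))
    bothᵖ = (Dᵖ ⊙ᵖ rec-π₁) ×ᵖ (Dᵖ ⊙ᵖ rec-π₂)

  -- Transpositions not supported in D are ignored.

  swap : ℕ → ℕ → ℕ
  swap e z = if does (decide bothᵖ e) then transpose (π₁ e) (π₂ e) z else z

  permute : List ℕ → ℕ → ℕ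
  permute []      z = z
  permute (e ∷ w) z = swap e (permute w z)

  rec-permute : ∀ {F : ℕ → List ℕ} → RecList O F → Rec O f → Rec O (λ x → permute (F x) (f x))
  rec-permute r s = Rec-≗ (λ x → cong (λ w → permute w _) (decode-encode _)) (ap₂
    (rec-foldr rec-id (rec-swap ⊙ rec-π₂) (λ z w → permute w z) (λ _ → refl)
      (λ z e w → cong₂ swap (trans (cong π₁ (π₂-pair z ⟨ e , permute w z ⟩)) (π₁-pair e (permute w z)))
        (trans (cong π₂ (π₂-pair z ⟨ e , permute w z ⟩)) (π₂-pair e (permute w z))))) s (encoded r))
    where
    rec-swap : Rec O (λ x → swap (π₁ x) (π₂ x))
    rec-swap = rec-if (bothᵖ ⊙ᵖ rec-π₁)
      (rec-if (rec-π₂ ≡ᵖ rec-π₁ ⊙ rec-π₁) (rec-π₂ ⊙ rec-π₁) (rec-if (rec-π₂ ≡ᵖ rec-π₂ ⊙ rec-π₁) (rec-π₁ ⊙ rec-π₁) rec-π₂)) rec-π₂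

  swap-pair : ∀ {u v} → D u → D v → ∀ z → swap ⟨ u , v ⟩ z ≡ transpose u v z
  swap-pair {u} {v} u∈ v∈ z = trans
    (if-yes (decide bothᵖ ⟨ u , v ⟩) (subst D (sym (π₁-pair u v)) u∈ , subst D (sym (π₂-pair u v)) v∈))
    (cong₂ (λ u v → transpose u v z) (π₁-pair u v) (π₂-pair u v))

  swap-involutive : ∀ e z → swap e (swap e z) ≡ z
  swap-involutive e z with toSum (decide bothᵖ e)
  ... | inj₁ both = trans (if-yes (decide bothᵖ e) both) (trans (cong (transpose (π₁ e) (π₂ e)) (if-yes (decide bothᵖ e) both))
    (transpose-involutive (π₁ e) (π₂ e) z))
  ... | inj₂ none = trans (if-no (decide bothᵖ e) none) (if-no (decide bothᵖ e) none)

  swap-∈ : ∀ e {z} → D z → D (swap e z)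
  swap-∈ e {z} z∈ with toSum (decide bothᵖ e)
  ... | inj₂ none = subst D (sym (if-no (decide bothᵖ e) none)) z∈
  ... | inj₁ both@(u∈ , v∈) = subst D (sym (if-yes (decide bothᵖ e) both)) (go (transposeView (π₁ e) (π₂ e) z))
    where
    go : TransposeView (π₁ e) (π₂ e) z → D (transpose (π₁ e) (π₂ e) z)
    go (first z≡u)       = subst D (sym (trans (cong (transpose (π₁ e) (π₂ e)) z≡u) (transpose-left (π₁ e) (π₂ e)))) v∈
    go (second z≡v)      = subst D (sym (trans (cong (transpose (π₁ e) (π₂ e)) z≡v) (transpose-right (π₁ e) (π₂ e)))) u∈
    go (neither z≢u z≢v) = subst D (sym (transpose-fixed z≢u z≢v)) z∈

  permute-∈ : ∀ w {z} → D z → D (permute w z)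
  permute-∈ []      z∈ = z∈
  permute-∈ (e ∷ w) z∈ = swap-∈ e (permute-∈ w z∈)

  permute-injective : ∀ w {y z} → permute w y ≡ permute w z → y ≡ z
  permute-injective []      eq = eq
  permute-injective (e ∷ w) eq = permute-injective w
    (trans (sym (swap-involutive e _)) (trans (cong (swap e) eq) (swap-involutive e _)))

  permute-surjective : ∀ w {y} → D y → ∃[ x ] (D x × permute w x ≡ y)
  permute-surjective []      y∈ = _ , y∈ , refl
  permute-surjective (e ∷ w) y∈ = let x , x∈ , eq = permute-surjective w (swap-∈ e y∈) in
    x , x∈ , trans (cong (swap e) eq) (swap-involutive e _)

  -- Once `w` moves the tail of `a` to the tail of `b`, transposing `permute w x` with `y` places
  -- the head. Equality of patterns protects the tail: if one of its entries is sent to either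
  -- point, then `permute w x` is already `y` and the transposition is trivial.
  permutation : ∀ a b → All D a → All D b → SamePattern a b → ∃[ w ] List.map (permute w) a ≡ b
  permutation []      []      _          _          _           = [] , refl
  permutation (x ∷ a) (y ∷ b) (x∈ ∷ a∈) (y∈ ∷ b∈) (len , pat) =
    let w , eq = permutation a b a∈ b∈ (suc-injective len , λ i j i< j< → pat (suc i) (suc j) (s≤s i<) (s≤s j<))
        u = permute w x
        u∈ = permute-∈ w x∈
    in ⟨ u , y ⟩ ∷ w , cong₂ _∷_ (trans (swap-pair u∈ y∈ u) (transpose-left u y))
      (fix w u∈ a b eq (λ i i< → pat (suc i) 0 (s≤s i<) z<s))
    where
    fix : ∀ w → D (permute w x) → ∀ a′ b′ → List.map (permute w) a′ ≡ b′ →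
      (∀ i → i < length a′ → (nth a′ i ≡ x → nth b′ i ≡ y) × (nth b′ i ≡ y → nth a′ i ≡ x)) →
      List.map (permute (⟨ permute w x , y ⟩ ∷ w)) a′ ≡ b′
    fix w u∈ []       .[]  refl h = refl
    fix w u∈ (x′ ∷ a′) .(permute w x′ ∷ List.map (permute w) a′) refl h =
      cong₂ _∷_ (trans (swap-pair u∈ y∈ (permute w x′)) (stays (transposeView (permute w x) y (permute w x′))))
        (fix w u∈ a′ _ refl (λ i i< → h (suc i) (s≤s i<)))
      where
      stays : TransposeView (permute w x) y (permute w x′) → transpose (permute w x) y (permute w x′) ≡ permute w x′
      stays (first eq) = trans (trans (cong (transpose (permute w x) y) eq) (transpose-left (permute w x) y))
        (sym (proj₁ (h 0 z<s) (permute-injective w eq)))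
      stays (second eq) = stays (first (cong (permute w) (proj₂ (h 0 z<s) eq)))
      stays (neither ≢u ≢v) = transpose-fixed ≢u ≢v

  rec-map-permute : ∀ {F G : ℕ → List ℕ} → RecList O F → RecList O G → RecList O (λ x → List.map (permute (F x)) (G x))
  rec-map-permute {F} {G} r s = mkRecList (Rec-≗
      (λ x → cong₂ (λ w a → encode (List.map (permute w) a)) (decode-encode (F x)) (decode-encode (G x)))
      (ap₂ (rec-foldr (rec-const 0) step H (λ _ → refl) H-∷) (encoded r) (encoded s)))
    where
    H : ℕ → List ℕ → ℕ
    H w a = encode (List.map (permute (decode w)) a)
    step : Rec O (λ e → suc ⟨ permute (decode (π₁ e)) (π₁ (π₂ e)) , π₂ (π₂ e) ⟩)
    step = rec-suc ⊙ ⟪ rec-permute (rec-decode rec-π₁) (rec-π₁ ⊙ rec-π₂) , rec-π₂ ⊙ rec-π₂ ⟫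
    H-∷ : ∀ w x a → let e = ⟨ w , ⟨ x , H w a ⟩ ⟩ in
      suc ⟨ permute (decode (π₁ e)) (π₁ (π₂ e)) , π₂ (π₂ e) ⟩ ≡ H w (x ∷ a)
    H-∷ w x a = cong₂ (λ u v → suc ⟨ u , v ⟩)
      (cong₂ (λ w x → permute (decode w) x) (π₁-pair w ⟨ x , H w a ⟩) (second≡ w x (H w a))) (third≡ w x (H w a))

-- Cofinal ultrahomogeneity

module Homogeneity (em : ExcludedMiddle (lsuc 0ℓ)) {L : Language} {K : Pred (Structure L) (lsuc 0ℓ)}
             (𝕂 : Enumeration L) (ix : ℕ → ℕ) (rep : Represents 𝕂 ∅ ix K) (jep : JEP K) (cap : CAP K) where
  open Classical em
  open Types 𝕂
  open Decidability em 𝕂 ix rep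
  open Chain em 𝕂 ix rep jep cap
  open LimitStructure em 𝕂 ix rep jep cap
  open BackAndForth em 𝕂 ix rep jep cap
  open FinitePermutation domainᵖ

  private
    Elem = ∣ 𝐌 ∣

    left right : ℕ → List ℕ
    left w  = decode (π₁ w)
    right w = decode (π₂ w)

    rec-left : ∀ {O} → RecList O left
    rec-left = rec-decode rec-π₁

    rec-right : ∀ {O} → RecList O right
    rec-right = rec-decode rec-π₂

    samePatternᵖ : RecPred 𝔼″ (λ w → SamePattern (left w) (right w))
    samePatternᵖ = (rec-length rec-left ≡ᵖ rec-length rec-right) ×ᵖ
      ∀ᵖ (∀ᵖ {R = λ e j → π₂ e < length (left (π₁ e)) → j < length (left (π₁ e)) →
          (nth (left (π₁ e)) (π₂ e) ≡ nth (left (π₁ e)) j → nth (right (π₁ e)) (π₂ e) ≡ nth (right (π₁ e)) j) ×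
          (nth (right (π₁ e)) (π₂ e) ≡ nth (right (π₁ e)) j → nth (left (π₁ e)) (π₂ e) ≡ nth (left (π₁ e)) j)}
        ((i <ᵖ rec-length a) →ᵖ (rec-π₂ <ᵖ rec-length a) →ᵖ
          ((rec-nth a i ≡ᵖ rec-nth a rec-π₂) →ᵖ (rec-nth b i ≡ᵖ rec-nth b rec-π₂)) ×ᵖ
          ((rec-nth b i ≡ᵖ rec-nth b rec-π₂) →ᵖ (rec-nth a i ≡ᵖ rec-nth a rec-π₂))))
      where
      a = rec-left ⊙ˡ (rec-π₁ ⊙ rec-π₁)
      b = rec-right ⊙ˡ (rec-π₁ ⊙ rec-π₁)
      i = rec-π₂ ⊙ rec-π₁

    Pattern : ℕ → Set
    Pattern w = All Domain (left w) × All Domain (right w) × SamePattern (left w) (right w)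

    chosen : Σ[ f ∈ (ℕ → ℕ) ] (Rec 𝔼″ f × (∀ w → Pattern w → List.map (permute (decode (f w))) (left w) ≡ right w))
    chosen = choose (λ w v → Pattern w → List.map (permute (decode v)) (left w) ≡ right w)
      ((allDomainᵖ rec-left ×ᵖ allDomainᵖ rec-right ×ᵖ samePatternᵖ) ⊙ᵖ rec-π₁ →ᵖ
        rec-map-permute (rec-decode rec-π₂) (rec-left ⊙ˡ rec-π₁) ≡ˡ rec-right ⊙ˡ rec-π₁) total
      where
      total : ∀ w → ∃[ v ] (Pattern w → List.map (permute (decode v)) (left w) ≡ right w)
      total w with em₀ (Pattern w)
      ... | no ¬pat = 0 , λ pat → contradiction pat ¬pat
      ... | yes (a∈ , b∈ , pat) = let v , eq = permutation (left w) (right w) a∈ b∈ pat in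
        encode v , λ _ → trans (cong (λ v → List.map (permute v) (left w)) (decode-encode v)) eq

    opaque
      swaps : ℕ → List ℕ
      swaps w = decode (proj₁ chosen w)

      rec-swaps : RecList 𝔼″ swaps
      rec-swaps = rec-decode (proj₁ (proj₂ chosen))

      swaps-correct : ∀ w → Pattern w → List.map (permute (swaps w)) (left w) ≡ right w
      swaps-correct = proj₂ (proj₂ chosen)

    -- For lists in the domain this decides equality of types in the limit, at one stage where both
    -- lists are present.
    record Iso (w : ℕ) : Set where
      constructor isomorphic
      field
        same-type : 𝕜 (startStage w) ∶ 𝕓 (startStage w) ⟨$⟩ left w ≃ 𝕜 (startStage w) ∶ 𝕓 (startStage w) ⟨$⟩ right w

    isoᵖ : RecPred 𝔼″ Iso
    isoᵖ = mapᵖ (λ w → mk⇔ isomorphic Iso.same-type)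
      (sameᵖ 𝔼≤𝔼″ (rec-𝕜 ⊙ rec-startStage) (rec-⟨$⟩ (rec-𝕓 ⊙ˡ rec-startStage) rec-left)
        (rec-𝕜 ⊙ rec-startStage) (rec-⟨$⟩ (rec-𝕓 ⊙ˡ rec-startStage) rec-right))

    opaque
      moves : Σ[ h ∈ (ℕ → ℕ) ] (Rec 𝔼″ h × (∀ e → Iso (π₁ e) → h e ≡ image (π₁ e) (π₂ e)) ×
        (∀ e → ¬ Iso (π₁ e) → h e ≡ permute (swaps (π₁ e)) (π₂ e)))
      moves = byCases {P = λ e → Iso (π₁ e)} (_⊙ᵖ_ {P = Iso} {f = π₁} isoᵖ rec-π₁)
        (ap₂ rec-image rec-π₁ rec-π₂) (rec-permute (rec-swaps ⊙ˡ rec-π₁) rec-π₂)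

    opaque
      move : ℕ → ℕ → ℕ
      move w x = proj₁ moves ⟨ w , x ⟩

      rec-move : Rec 𝔼″ (λ e → move (π₁ e) (π₂ e))
      rec-move = proj₁ (proj₂ moves) ⊙ ⟪ rec-π₁ , rec-π₂ ⟫

      move-iso : ∀ {w} → Iso w → ∀ x → move w x ≡ image w x
      move-iso {w} iso x = subst₂ (λ w′ x′ → Iso w′ → move w x ≡ image w′ x′) (π₁-pair w x) (π₂-pair w x)
        (proj₁ (proj₂ (proj₂ moves)) ⟨ w , x ⟩) iso

      move-¬iso : ∀ {w} → ¬ Iso w → ∀ x → move w x ≡ permute (swaps w) x
      move-¬iso {w} ¬iso x = subst₂ (λ w′ x′ → ¬ Iso w′ → move w x ≡ permute (swaps w′) x′) (π₁-pair w x) (π₂-pair w x)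
        (proj₂ (proj₂ (proj₂ moves)) ⟨ w , x ⟩) ¬iso

    opaque
      uniformᶜ : Code
      uniformᶜ = restrictᶜ (domainᵖ ⊙ᵖ rec-π₂) rec-move

      uniformᶜ-⇓ : ∀ w x y → 𝔼″ ⊢ uniformᶜ [ ⟨ w , x ⟩ ]⇓ y ⇔ (Domain x × move w x ≡ y)
      uniformᶜ-⇓ w x y = subst₂ (λ w′ x′ → 𝔼″ ⊢ uniformᶜ [ ⟨ w , x ⟩ ]⇓ y ⇔ (Domain x′ × move w′ x′ ≡ y))
        (π₁-pair w x) (π₂-pair w x) (restrictᶜ-⇓ (domainᵖ ⊙ᵖ rec-π₂) rec-move)

      identityᶜ : Code
      identityᶜ = program (rec-id {O = 𝔼″})

      identityᶜ-⇓ : ∀ x → 𝔼″ ⊢ identityᶜ [ x ]⇓ x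
      identityᶜ-⇓ = correct (rec-id {O = 𝔼″})

      -- One program computes all the maps uniformly; with `w` hard-wired its Gödel number becomes a
      -- recursive function of `w`, as `g` requires.
      moveᶜ : ℕ → Code
      moveᶜ w = compᶜ uniformᶜ (pairᶜ (constᶜ w) identityᶜ)

      moveᶜ-⇓ : ∀ w x y → 𝔼″ ⊢ moveᶜ w [ x ]⇓ y ⇔ (Domain x × move w x ≡ y)
      moveᶜ-⇓ w x y = mk⇔ sound (λ h → ⇓comp (⇓pair (⇓const w) (identityᶜ-⇓ x)) (from (uniformᶜ-⇓ w x y) h))
        where
        sound : 𝔼″ ⊢ moveᶜ w [ x ]⇓ y → Domain x × move w x ≡ y
        sound (⇓comp (⇓pair a b) c) = to (uniformᶜ-⇓ w x y) (subst₂ (λ w x → 𝔼″ ⊢ uniformᶜ [ ⟨ w , x ⟩ ]⇓ y)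
          (⇓-deterministic a (⇓const w)) (⇓-deterministic b (identityᶜ-⇓ x)) c)

      rec-⌜argument⌝ : Rec 𝔼″ (λ w → ⌜ pairᶜ (constᶜ w) identityᶜ ⌝)
      rec-⌜argument⌝ = ⟪ rec-const 5 , ⟪ rec-⌜const⌝ , rec-const ⌜ identityᶜ ⌝ ⟫ ⟫

      rec-⌜move⌝ : Rec 𝔼″ (λ w → ⌜ moveᶜ w ⌝)
      rec-⌜move⌝ = ⟪ rec-const 6 , ⟪ rec-const ⌜ uniformᶜ ⌝ , rec-⌜argument⌝ ⟫ ⟫

    Pairs : ℕ → Set
    Pairs w = Generating (left w) × All Domain (right w) × SamePattern (left w) (right w)

    pairsᵖ : RecPred 𝔼″ Pairs
    pairsᵖ = generatingᵖ rec-left ×ᵖ allDomainᵖ rec-right ×ᵖ samePatternᵖ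

    opaque
      gᶜ : Code
      gᶜ = restrictᶜ pairsᵖ rec-⌜move⌝

      gᶜ-⇓ : ∀ w y → 𝔼″ ⊢ gᶜ [ w ]⇓ y ⇔ (Pairs w × ⌜ moveᶜ w ⌝ ≡ y)
      gᶜ-⇓ w y = restrictᶜ-⇓ pairsᵖ rec-⌜move⌝

    convert : ∀ {i j k l : ℕ} → i ≡ k → j ≡ l → i ≡ j → k ≡ l
    convert refl refl eq = eq

    module _ {n} (a b : Vec Elem n) where
      pairCode : ℕ
      pairCode = ⟨ code 𝓜 a , code 𝓜 b ⟩

      left≡ : left pairCode ≡ raw 𝓜 a
      left≡ = trans (cong decode (trans (π₁-pair (code 𝓜 a) (code 𝓜 b)) (code≡encode 𝓜 a))) (decode-encode (raw 𝓜 a))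

      right≡ : right pairCode ≡ raw 𝓜 b
      right≡ = trans (cong decode (trans (π₂-pair (code 𝓜 a) (code 𝓜 b)) (code≡encode 𝓜 b))) (decode-encode (raw 𝓜 b))

      same⇒pattern : SameEqualities 𝐌 a b → SamePattern (raw 𝓜 a) (raw 𝓜 b)
      same⇒pattern same = trans (length-raw 𝓜 a) (sym (length-raw 𝓜 b)) , λ i j i< j< →
        let i<n = subst (i <_) (length-raw 𝓜 a) i<
            j<n = subst (j <_) (length-raw 𝓜 a) j<
            e = same (fromℕ< i<n) (fromℕ< j<n)
        in (λ eq → convert (at b i<n) (at b j<n) (to e (convert (sym (at a i<n)) (sym (at a j<n)) eq))) ,
           (λ eq → convert (at a i<n) (at a j<n) (from e (convert (sym (at b i<n)) (sym (at b j<n)) eq)))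
        where
        at : ∀ (c : Vec Elem n) {i} (i< : i < n) → proj₁ (lookup c (fromℕ< i<)) ≡ nth (raw 𝓜 c) i
        at c i< = trans (sym (nth-raw 𝓜 c (fromℕ< i<))) (cong (nth (raw 𝓜 c)) (toℕ-fromℕ< i<))

      pattern⇒same : SamePattern (raw 𝓜 a) (raw 𝓜 b) → SameEqualities 𝐌 a b
      pattern⇒same (_ , pat) i j =
        let e = pat (toℕ i) (toℕ j) (inBounds i) (inBounds j)
        in mk⇔ (λ eq → convert (nth-raw 𝓜 b i) (nth-raw 𝓜 b j)
                  (proj₁ e (convert (sym (nth-raw 𝓜 a i)) (sym (nth-raw 𝓜 a j)) eq)))
               (λ eq → convert (nth-raw 𝓜 a i) (nth-raw 𝓜 a j)
                  (proj₂ e (convert (sym (nth-raw 𝓜 b i)) (sym (nth-raw 𝓜 b j)) eq)))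
        where
        inBounds : ∀ (i : Fin n) → toℕ i < length (raw 𝓜 a)
        inBounds i = subst (toℕ i <_) (sym (length-raw 𝓜 a)) (toℕ<n i)

      pairs : Generating (raw 𝓜 a) → SameEqualities 𝐌 a b → Pairs pairCode
      pairs gen same = subst Generating (sym left≡) gen , subst (All Domain) (sym right≡) (allDomain-raw b) ,
        subst₂ SamePattern (sym left≡) (sym right≡) (same⇒pattern same)

  g-enumerates : Enumerates 𝔼″ ⌜ gᶜ ⌝ (λ x → ∃[ n ] Σ[ a ∈ Vec Elem n ] Σ[ b ∈ Vec Elem n ]
    (x ≡ ⟨ code 𝓜 a , code 𝓜 b ⟩ × Generating (raw 𝓜 a) × SameEqualities 𝐌 a b))
  g-enumerates x = mk⇔
    (λ (n , a , b , eq , gen , same) → ⌜ moveᶜ x ⌝ , gᶜ , refl ,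
      from (gᶜ-⇓ x ⌜ moveᶜ x ⌝) (subst Pairs (sym eq) (pairs a b gen same) , refl))
    (λ (y , p) → complete (proj₁ (to (gᶜ-⇓ x y) (φ-⌜⌝ gᶜ p))))
    where
    complete : Pairs x → ∃[ n ] Σ[ a ∈ Vec Elem n ] Σ[ b ∈ Vec Elem n ]
      (x ≡ ⟨ code 𝓜 a , code 𝓜 b ⟩ × Generating (raw 𝓜 a) × SameEqualities 𝐌 a b)
    complete (gen@(s , a< , _) , b∈ , pat) =
      let a , a≡ = elements a<
          t , b< = allDomain⇒live b∈
          b , b≡ = sized (sym (proj₁ pat)) (elements b<)
      in _ , a , b , sym (trans (cong₂ ⟨_,_⟩ (code≡ a a≡) (code≡ b b≡)) (pair-unpair x))
       , subst Generating (sym a≡) gen , pattern⇒same a b (subst₂ SamePattern (sym a≡) (sym b≡) pat)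
      where
      sized : ∀ {m n xs} → m ≡ n → Σ[ b ∈ Vec Elem m ] raw 𝓜 b ≡ xs → Σ[ b ∈ Vec Elem n ] raw 𝓜 b ≡ xs
      sized refl b = b
      code≡ : ∀ {n z} (a : Vec Elem n) → raw 𝓜 a ≡ decode z → code 𝓜 a ≡ z
      code≡ a eq = trans (code≡encode 𝓜 a) (trans (cong encode eq) (encode-decode _))

  -- The interface shared by the back-and-forth map and the permutation. Preservation of types is
  -- demanded only if `a` and `b` have the same type.
  record Mover {n} (a b : Vec Elem n) (h : ℕ → ℕ) : Set where
    field
      preserves : ∀ {x} → Domain x → Domain (h x)
      injective : ∀ {x y} → Domain x → Domain y → h x ≡ h y → x ≡ y
      onto      : ∀ {y} → Domain y → ∃[ x ] (Domain x × h x ≡ y)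
      sends     : List.map h (raw 𝓜 a) ≡ raw 𝓜 b
      types     : SameAtomicType 𝐌 𝐌 a b → ∀ {xs} → All Domain xs → SameType 𝓜 𝓜 xs (List.map h xs)

  mover⇒moves : ∀ {n} {a b : Vec Elem n} w → Mover a b (move w) → Moves 𝔼″ 𝓜 a b ⌜ moveᶜ w ⌝
  mover⇒moves {n} {a} {b} w mover = record
    { bijection    = record
      { to        = ĥ
      ; cong      = cong (move w)
      ; bijective = (λ {x} {y} → injective (proj₂ x) (proj₂ y)) , λ (y , y∈) →
          let x , x∈ , eq = onto y∈ in (x , x∈) , λ z≡x → trans (cong (move w) z≡x) eq
      }
    ; index        = λ x y → mk⇔ (λ p → to (moveᶜ-⇓ w x y) (φ-⌜⌝ (moveᶜ w) p)) (λ h → moveᶜ w , refl , from (moveᶜ-⇓ w x y) h)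
    ; moves        = raw⁻ 𝓜 (map ĥ a) b (trans (raw-map a) sends)
    ; automorphism = λ same → record
      -- The value together with its arguments keeps its type, so the image of the value is again
      -- the value at the images.
      { fun-hom = λ F xs → fun-diagram-functional 𝓜 {proj₁ F} {raw 𝓜 (map ĥ xs)}
          (subst (λ ys → FunDiagram 𝓜 ⟨ proj₁ F , ⟨ encode ys , move w (proj₁ (Structure.fun 𝐌 F xs)) ⟩ ⟩) (sym (raw-map xs))
            (≃-fun {r = proj₁ F} (types same (allDomain-raw (Structure.fun 𝐌 F xs ∷ xs))) (fun-diagram 𝓜 F xs)))
          (fun-diagram 𝓜 F (map ĥ xs))
      ; rel-hom = λ R xs →
          let s = subst (SameType 𝓜 𝓜 (raw 𝓜 xs)) (sym (raw-map xs)) (types same (allDomain-raw xs))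
          in mk⇔ (to (rel-diagram 𝓜 R (map ĥ xs)) ∘ ≃-rel {r = proj₁ R} s ∘ from (rel-diagram 𝓜 R xs))
                 (to (rel-diagram 𝓜 R xs) ∘ ≃-rel {r = proj₁ R} (≃-sym s) ∘ from (rel-diagram 𝓜 R (map ĥ xs)))
      }
    }
    where
    open Mover mover
    ĥ : Elem → Elem
    ĥ (x , x∈) = move w x , preserves x∈
    raw-map : ∀ {m} (xs : Vec Elem m) → raw 𝓜 (map ĥ xs) ≡ List.map (move w) (raw 𝓜 xs)
    raw-map []       = refl
    raw-map (x ∷ xs) = cong (move w (proj₁ x) ∷_) (raw-map xs)

  module _ {n} (a b : Vec Elem n) (w : ℕ) (left≡a : left w ≡ raw 𝓜 a) (right≡b : right w ≡ raw 𝓜 b)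
           (w-pairs : Pairs w) where
    private
      s : ℕ
      s = startStage w

      left∈ : All Domain (left w)
      left∈ = subst (All Domain) (sym left≡a) (allDomain-raw a)

      right∈ : All Domain (right w)
      right∈ = subst (All Domain) (sym right≡b) (allDomain-raw b)

      left< : InRange (size s) (left w)
      left< = inRange-≤ (size-mono (m≤m+n _ _)) (stageOf-live left∈)

      right< : InRange (size s) (right w)
      right< = inRange-≤ (size-mono (m≤n+m _ (stageOf (left w)))) (stageOf-live right∈)

    automorphic : Iso w → Partial (left w) (right w) (startStage w) → Mover a b (move w)
    automorphic iso start = record
      { preserves = λ x∈ → subst Domain (sym (move≡ _)) (All.head (proj₂ (matched-domain w start (matched-image w start x∈))))
      ; injective = λ {x} {y} x∈ y∈ eq → matched-injective w start (matched-image w start x∈)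
          (subst (λ z → Matched w start (y ∷ []) (z ∷ [])) (trans (sym (move≡ y)) (trans (sym eq) (move≡ x)))
            (matched-image w start y∈))
      ; onto      = λ {y} y∈ → let x , m = matched-surjective w start y∈
                                   x∈ = All.head (proj₁ (matched-domain w start m))
                               in x , x∈ , trans (move≡ x) (matched-functional w start (matched-image w start x∈) m)
      ; sends     = trans (map-cong move≡ (raw 𝓜 a)) (sent (allDomain-raw a)
          (subst₂ (Matched w start) left≡a right≡b (matched-start w start)))
      ; types     = λ _ xs∈ → matched-≃ w start (subst (Matched w start _) (sym (map-cong move≡ _)) (matched-map xs∈))
      }
      where
      move≡ : ∀ x → move w x ≡ image w x
      move≡ = move-iso iso
      sent : ∀ {xs ys} → All Domain xs → Matched w start xs ys → List.map (image w) xs ≡ ys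
      sent {[]}     {[]}     _          m = refl
      sent {[]}     {y ∷ ys} _          m with () ← ≃-length (matched-≃ w start m)
      sent {x ∷ xs} {[]}     _          m with () ← ≃-length (matched-≃ w start m)
      sent {x ∷ xs} {y ∷ ys} (x∈ ∷ xs∈) m = cong₂ _∷_
        (matched-functional w start (matched-image w start x∈) (matched-head w start m)) (sent xs∈ (matched-tail w start m))
      matched-map : ∀ {xs} → All Domain xs → Matched w start xs (List.map (image w) xs)
      matched-map []         = matched-[] w start
      matched-map (x∈ ∷ xs∈) = matched-∷ w start (matched-image w start x∈) (matched-map xs∈)

    permuting : ¬ Iso w → Mover a b (move w)
    permuting ¬iso = record
      { preserves = λ x∈ → subst Domain (sym (move≡ _)) (permute-∈ (swaps w) x∈)
      ; injective = λ {x} {y} _ _ eq → permute-injective (swaps w) (trans (sym (move≡ x)) (trans eq (move≡ y)))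
      ; onto      = λ y∈ → let x , x∈ , eq = permute-surjective (swaps w) y∈ in x , x∈ , trans (move≡ x) eq
      ; sends     = trans (map-cong move≡ (raw 𝓜 a)) (subst₂ (λ xs ys → List.map (permute (swaps w)) xs ≡ ys) left≡a right≡b
          (swaps-correct w (left∈ , right∈ , proj₂ (proj₂ w-pairs))))
      -- A common type in the limit would show at the starting stage, against `¬iso`, so a
      -- permutation owes no preservation of types.
      ; types     = λ type → contradiction
          (isomorphic (≃-trans (≃-sym (at-stage left<)) (≃-trans
            (subst₂ (SameType 𝓜 𝓜) (sym left≡a) (sym right≡b) (mkSameType a b refl refl type)) (at-stage right<))))
          ¬iso
      }
      where
      move≡ : ∀ x → move w x ≡ permute (swaps w) x
      move≡ = move-¬iso ¬iso

    moves-exist : Moves 𝔼″ 𝓜 a b ⌜ moveᶜ w ⌝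
    moves-exist = mover⇒moves w ([
      (λ iso → automorphic iso (left< , right< , Iso.same-type iso , generating-at (proj₁ w-pairs) left<)) ,
      permuting ]′ (toSum (decide isoᵖ w)))

  g-moves : ∀ {n} (a b : Vec Elem n) → Generating (raw 𝓜 a) → SameEqualities 𝐌 a b →
    ∀ y → φ 𝔼″ ⌜ gᶜ ⌝ ⟨ code 𝓜 a , code 𝓜 b ⟩ y → Moves 𝔼″ 𝓜 a b y
  g-moves a b gen same y p = subst (Moves 𝔼″ 𝓜 a b) (proj₂ (to (gᶜ-⇓ (pairCode a b) y) (φ-⌜⌝ gᶜ p)))
    (moves-exist a b (pairCode a b) (left≡ a b) (right≡ a b) (pairs a b gen same))

  ultrahomogeneous : CofinallyUltrahomogeneous 𝔼″ 𝓜
  ultrahomogeneous = record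
    { E            = λ a → Generating (raw 𝓜 a)
    ; E-cofinal    = generating-isCofinal
    ; E-computable = generating-computable
    ; g            = ⌜ gᶜ ⌝
    ; g-domain     = g-enumerates
    ; g-value      = g-moves
    }

corollary6p22 : ExcludedMiddle (lsuc 0ℓ) → (L : Language) (K : Pred (Structure L) (lsuc 0ℓ)) → IsAge K →
    (𝕂 : Enumeration L) (ix : ℕ → ℕ) → Represents 𝕂 ∅ ix K →
    HP K → JEP K → CAP K →
    Σ[ 𝓜 ∈ ωStructure L ] IsCofinalFraïsséLimit ((EI 𝕂 ix ′) ′) 𝓜 𝕂
corollary6p22 em L K _ 𝕂 ix rep hp jep cap = 𝓜 , record
  { computable       = 𝓜-computable
  ; ultrahomogeneous = Homogeneity.ultrahomogeneous em 𝕂 ix rep jep cap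
  ; ix               = LimitAge.ix′ em 𝕂 ix rep hp jep cap
  ; represents       = LimitAge.represents-age em 𝕂 ix rep hp jep cap
  }
  where open LimitStructure em 𝕂 ix rep jep cap
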